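{- There exists a (randomized) streaming algorithm that, given an integer $k\ge 1$ and $n$ coins arriving one by one in a stream in arbitrary order, with gap parameter $\Delta_k>0$ (the gap between the biases of the $k$-th and $(k+1)$-th most biased coins) and confidence parameter $\delta\in(0,1/2)$, finds the $k$ most biased coins with probability at least $1-\delta$ using $O\!\left(\frac{n}{\Delta_k^2}\cdot\log(k/\delta)\right)$ coin tosses and a memory of $O(k)$ coins.
   Context: Streaming top-$k$ coin tossing. There are $n$ coins with unknown biases $p_1,\dots,p_n\in[0,1]$; each toss of the $i$-th coin is an independent Bernoulli$(p_i)$ random variable. Let $\mathrm{coin}_{[i]}$ denote the $i$-th most biased coin and $p_{[i]}$ its bias. The gap parameter is $\Delta_k=p_{[k]}-p_{[k+1]}$, assumed positive (so the set of the $k$ most biased coins is unique). The values $k,\Delta_k,\delta$ are known to the algorithm. The coins arrive one by one in a stream. At any time the algorithm may toss only the currently arriving coin or a coin explicitly stored in its memory; a coin that is not stored, or that is removed from memory, can no longer be tossed or recovered. The memory of the algorithm is the maximum number of coins it stores at any point (auxiliary information such as counters is not counted). "Finds the $k$ most biased coins" means that at the end of the stream the algorithm outputs exactly the set $\{\mathrm{coin}_{[1]},\dots,\mathrm{coin}_{[k]}\}$ (in no particular order). $O(\cdot)$ hides absolute constants. -}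

module Defs where

open import Level using (0ℓ)
open import Algebra.Bundles using (CommutativeRing)
open import Algebra.Apartness.Bundles using (HeytingField)
import Algebra.Apartness.Properties.HeytingCommutativeRing as HeytingProperties
import Algebra.Properties.Ring as RingProperties
import Algebra.Properties.Semiring.Mult as SemiringMult
open import Data.Bool.Base using (Bool; true; false; if_then_else_)
open import Data.Bool.Properties using () renaming (_≟_ to _≟ᵇ_)
open import Data.Empty using (⊥-elim)
open import Data.Fin.Base using (Fin; toℕ; fromℕ<)
open import Data.Fin.Permutation using (Permutation′; _⟨$⟩ʳ_; _⟨$⟩ˡ_)
open import Data.Fin.Subset using (Subset; ⁅_⁆; ⋃)
open import Data.List.Base as List using (List; []; _∷_; allFin)
open import Data.Nat.Base as ℕ using (ℕ; zero; suc; z≤n; s≤s)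
import Data.Nat.Properties as ℕ
open import Data.Product.Base using (Σ; ∃; _×_; _,_; proj₁; proj₂)
open import Data.Sum.Base using (_⊎_; inj₁; inj₂)
open import Data.Unit.Base using (⊤; tt)
open import Data.Vec.Base using (Vec; []; _∷_; lookup; removeAt; tabulate)
open import Data.Vec.Properties using (≡-dec)
open import Relation.Binary.Core using (Rel)
open import Relation.Binary.PropositionalEquality.Core using (_≡_)
open import Relation.Binary.Structures using (IsStrictPartialOrder)
open import Relation.Nullary using (¬_; does)
open import Relation.Unary using (Decidable)

-- The Cauchy-complete Archimedean ordered fields. Classically this
-- determines ℝ up to isomorphism. No decidability of the order is assumed,
-- so constructive reals (Cauchy or Dedekind) are models as well.

record RealNumbers : Set₁ where
  infix 4 _<_ _≤_
  field
    heytingField : HeytingField 0ℓ 0ℓ 0ℓ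

  open HeytingField heytingField public
  commutativeRing : CommutativeRing 0ℓ 0ℓ
  commutativeRing = record { isCommutativeRing = isCommutativeRing }

  open SemiringMult (CommutativeRing.semiring commutativeRing) public
    using () renaming (_×_ to _×ℝ_)

  fromℕ : ℕ → Carrier
  fromℕ n = n ×ℝ 1#

  field
    _<_                  : Rel Carrier 0ℓ
    isStrictPartialOrder : IsStrictPartialOrder _≈_ _<_
    #⇒<⊎>                : ∀ {x y} → x # y → x < y ⊎ y < x
    <⇒#                  : ∀ {x y} → x < y → x # y
    0<1                  : 0# < 1#
    +-monoˡ-<            : ∀ z {x y} → x < y → x + z < y + z
    *-pos                : ∀ {x y} → 0# < x → 0# < y → 0# < x * y
    archimedean          : ∀ x → ∃ λ n → x < fromℕ n
    complete             : (u : ℕ → Carrier) →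
      (∀ ε → 0# < ε → ∃ λ N → ∀ i j → N ℕ.≤ i → N ℕ.≤ j → u i - u j < ε) →
      ∃ λ l → ∀ ε → 0# < ε → ∃ λ N → ∀ i → N ℕ.≤ i →
        (u i - l < ε) × (l - u i < ε)

  open IsStrictPartialOrder isStrictPartialOrder public
    using (<-resp-≈; <-respˡ-≈; <-respʳ-≈)
    renaming (irrefl to <-irrefl; trans to <-trans; asym to <-asym)

  _≤_ : Rel Carrier 0ℓ
  x ≤ y = ¬ (y < x)


module Reals (ℝ : RealNumbers) where
  open RealNumbers ℝ public
  open RingProperties (CommutativeRing.ring commutativeRing)
    using (-‿distribˡ-*)
  open HeytingProperties (HeytingField.heytingCommutativeRing heytingField)
    using (x-0≈x; invertibleˡ⇒#)

  infixl 7 _*⁺_ _/_ _/⁺_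

  ℝ⁺ : Set
  ℝ⁺ = ∃ λ x → 0# < x

  inverse : ℝ⁺ → Carrier
  inverse (_ , 0<y) = proj₁ (#⇒invertible (#-sym (<⇒# 0<y)))

  inverse-*ˡ : (y : ℝ⁺) → inverse y * proj₁ y ≈ 1#
  inverse-*ˡ (y , 0<y) = trans (*-congˡ (sym (x-0≈x y)))
    (proj₁ (proj₂ (#⇒invertible (#-sym (<⇒# 0<y)))))

  ¬inverse<0 : (y : ℝ⁺) → ¬ (inverse y < 0#)
  ¬inverse<0 y⁺@(y , 0<y) z<0 = <-asym 0<1 1<0
    where
    z = inverse y⁺

    0<-z : 0# < - z
    0<-z = <-respˡ-≈ (-‿inverseʳ z)
      (<-respʳ-≈ (+-identityˡ (- z)) (+-monoˡ-< (- z) z<0))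

    0<-1 : 0# < - 1#
    0<-1 = <-respʳ-≈
      (trans (sym (-‿distribˡ-* z y)) (-‿cong (inverse-*ˡ y⁺)))
      (*-pos 0<-z 0<y)

    1<0 : 1# < 0#
    1<0 = <-respˡ-≈ (+-identityˡ 1#)
      (<-respʳ-≈ (-‿inverseˡ 1#) (+-monoˡ-< 1# 0<-1))

  0<inverse : (y : ℝ⁺) → 0# < inverse y
  0<inverse y⁺@(y , _) with #⇒<⊎> (invertibleˡ⇒#
    (y , trans (*-congˡ (x-0≈x (inverse y⁺)))
      (trans (*-comm y (inverse y⁺)) (inverse-*ˡ y⁺))))
  ... | inj₁ z<0 = ⊥-elim (¬inverse<0 y⁺ z<0)
  ... | inj₂ 0<z = 0<z

  0<fromℕ-suc : ∀ n → 0# < fromℕ (suc n)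
  0<fromℕ-suc zero    = <-respʳ-≈ (sym (+-identityʳ 1#)) 0<1
  0<fromℕ-suc (suc n) = <-trans (0<fromℕ-suc n)
    (<-respˡ-≈ (+-identityˡ _) (+-monoˡ-< (fromℕ (suc n)) 0<1))

  _/_ : Carrier → ℝ⁺ → Carrier
  x / y = x * inverse y

  _*⁺_ : ℝ⁺ → ℝ⁺ → ℝ⁺
  (x , 0<x) *⁺ (y , 0<y) = x * y , *-pos 0<x 0<y

  _/⁺_ : ℝ⁺ → ℝ⁺ → ℝ⁺
  (x , 0<x) /⁺ y = x / y , *-pos 0<x (0<inverse y)

  fromℕ⁺ : ∀ n → 1 ℕ.≤ n → ℝ⁺
  fromℕ⁺ (suc n) _ = fromℕ (suc n) , 0<fromℕ-suc n

  ½ : Carrier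
  ½ = 1# / fromℕ⁺ 2 (s≤s z≤n)

  -- These properties characterise the base-2 logarithm.
  record BinaryLogarithm : Set where
    field
      log      : ℝ⁺ → Carrier
      log-cong : ∀ {x y} → proj₁ x ≈ proj₁ y → log x ≈ log y
      log-mono : ∀ {x y} → proj₁ x < proj₁ y → log x < log y
      log-*    : ∀ x y → log (x *⁺ y) ≈ log x + log y
      log-2    : log (fromℕ⁺ 2 (s≤s z≤n)) ≈ 1#

  record UnitInterval : Set where
    field
      value   : Carrier
      0≤value : 0# ≤ value
      value≤1 : value ≤ 1#

  open UnitInterval public


module Probability (ℝ : RealNumbers) where
  open Reals ℝ

  -- A finite random experiment: a tree of independent Bernoulli trials,
  -- in which branch  true  of  bernoulli q  has probability q.
  data Dist (A : Set) : Set where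
    return    : A → Dist A
    bernoulli : UnitInterval → (Bool → Dist A) → Dist A

  infixl 1 _>>=_
  _>>=_ : ∀ {A B} → Dist A → (A → Dist B) → Dist B
  return a      >>= g = g a
  bernoulli q f >>= g = bernoulli q λ b → f b >>= g

  Pr[_] : ∀ {A} {E : A → Set} → Decidable E → Dist A → Carrier
  Pr[ E? ] (return a)      = if does (E? a) then 1# else 0#
  Pr[ E? ] (bernoulli q f) =
    value q * Pr[ E? ] (f true) + (1# - value q) * Pr[ E? ] (f false)

  -- The property holds however the Bernoulli trials turn out.
  Surely : ∀ {A} → (A → Set) → Dist A → Set
  Surely P (return a)      = P a
  Surely P (bernoulli q f) = ∀ b → Surely P (f b)


module Streaming (ℝ : RealNumbers) where
  open Reals ℝ public
  open Probability ℝ public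

  data Phase : Set where
    arriving ended : Phase

  -- Computation performed while a coin is arriving, or after the stream has
  -- ended. In  Program R φ s  the memory currently holds s coins, which the
  -- program can address by their slot in memory only; the type R s of results
  -- depends on the number s of coins held on termination.
  data Program (R : ℕ → Set) : Phase → ℕ → Set where
    return       : ∀ {φ s} → R s → Program R φ s
    tossArriving : ∀ {s} → (Bool → Program R arriving s) → Program R arriving s
    tossStored   : ∀ {φ s} → Fin s → (Bool → Program R φ s) → Program R φ s
    random       : ∀ {φ s} → UnitInterval → (Bool → Program R φ s) →
                   Program R φ s
    store        : ∀ {s} → Program R arriving (suc s) → Program R arriving s
    discard      : ∀ {φ s} → Fin (suc s) → Program R φ s → Program R φ (suc s)

  -- The auxiliary information  State s , kept while s coins are stored, is
  -- unrestricted. The algorithm is told neither the length of the stream nor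
  -- the identities of the coins; its answer is a list of memory slots.
  record StreamingAlgorithm : Set₁ where
    field
      State     : ℕ → Set
      initial   : State 0
      onArrival : ∀ {s} → State s → Program State arriving s
      atEnd     : ∀ {s} → State s → Program (λ s → List (Fin s)) ended s

  Coin : Phase → ℕ → Set
  Coin arriving n = Fin n
  Coin ended    n = ⊤

  record Config (n : ℕ) (R : ℕ → Set) : Set where
    constructor config
    field
      {size}     : ℕ
      result     : R size
      memory     : Vec (Fin n) size
      tosses     : ℕ
      peakMemory : ℕ

  record Outcome (n : ℕ) : Set where
    constructor outcome
    field
      output     : Subset n
      tosses     : ℕ
      peakMemory : ℕ

  module _ {n : ℕ} (p : Fin n → UnitInterval) where

    exec : ∀ {R φ s} → Program R φ s → Coin φ n → Vec (Fin n) s →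
           (tosses peakMemory : ℕ) → Dist (Config n R)
    exec (return r)       c mem t m = return (config r mem t m)
    exec (tossArriving f) c mem t m =
      bernoulli (p c) λ b → exec (f b) c mem (suc t) m
    exec (tossStored i f) c mem t m =
      bernoulli (p (lookup mem i)) λ b → exec (f b) c mem (suc t) m
    exec (random q f)     c mem t m = bernoulli q λ b → exec (f b) c mem t m
    exec {s = s} (store P) c mem t m = exec P c (c ∷ mem) t (m ℕ.⊔ suc s)
    exec (discard i P)    c mem t m = exec P c (removeAt mem i) t m

    module _ (alg : StreamingAlgorithm) where
      open StreamingAlgorithm alg

      feed : List (Fin n) → Config n State → Dist (Config n State)
      feed []       cfg                  = return cfg
      feed (c ∷ cs) (config st mem t m) =
        exec (onArrival st) c mem t m >>= feed cs

      finish : Config n State → Dist (Outcome n)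
      finish (config st mem t m) = exec (atEnd st) tt mem t m >>=
        λ { (config slots mem′ t′ m′) →
            return (outcome (⋃ (List.map (λ i → ⁅ lookup mem′ i ⁆) slots)) t′ m′) }

      -- The coins arrive in the order 0, 1, …, n - 1. As p is arbitrary, so is
      -- the order of arrival of the biases.
      run : Dist (Outcome n)
      run = feed (allFin n) (config initial [] 0 0) >>= finish

  -- σ lists the coins by non-increasing bias; positions count from 0.
  IsRanking : ∀ {n} → (Fin n → UnitInterval) → Permutation′ n → Set
  IsRanking p σ = ∀ i j → toℕ i ℕ.≤ toℕ j →
    value (p (σ ⟨$⟩ʳ j)) ≤ value (p (σ ⟨$⟩ʳ i))

  -- coin_[i], with i counting from 1.
  coin[_] : ∀ {n} i → Permutation′ n → 1 ℕ.≤ i → i ℕ.≤ n → Fin n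
  coin[ suc i ] σ _ i<n = σ ⟨$⟩ʳ fromℕ< i<n

  gap : ∀ {n} → (Fin n → UnitInterval) → Permutation′ n →
        ∀ k → 1 ℕ.≤ k → k ℕ.< n → Carrier
  gap p σ k 1≤k k<n =
    value (p (coin[ k ] σ 1≤k (ℕ.<⇒≤ k<n))) -
    value (p (coin[ suc k ] σ (s≤s z≤n) k<n))

  topCoins : ∀ {n} → Permutation′ n → ℕ → Subset n
  topCoins σ k = tabulate λ c → does (toℕ (σ ⟨$⟩ˡ c) ℕ.<? k)

  FindsTop : ∀ {n} → Permutation′ n → ℕ → Outcome n → Set
  FindsTop σ k o = Outcome.output o ≡ topCoins σ k

  findsTop? : ∀ {n} (σ : Permutation′ n) k → Decidable (FindsTop σ k)
  findsTop? σ k o = ≡-dec _≟ᵇ_ (Outcome.output o) (topCoins σ k)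

{-# OPTIONS --safe #-}
module Submission where

-- The memory holds k kings, each with a budget, and up to k newcomers. Whenever k
-- newcomers have gathered (and once more at the end), all stored coins are tossed s₀
-- times, s₀ being of order log(k/δ)/Δ². The kings, sorted by increasing numbers of
-- heads, are paired with the newcomers, sorted by decreasing numbers, so that as long
-- as the ranking separates the top coins from the others, no two top coins are paired.
-- A newcomer with more heads than its king challenges it: at level ℓ = 1, 2, … the king
-- pays ℓ units of its budget, both coins are tossed s₀ ℓ times, and the king stays if
-- it wins; otherwise they go to the next level, and a king that cannot pay is replaced.
-- Each king earns one unit per round, which bounds the number of tosses.
--
-- For a fixed top coin, the probability of losing it is bounded by a potential. A king
-- with budget b has potential θ ^ b: in a round without top newcomers the loss of a
-- misranked round is made up for by the unit earned. A round with top newcomers may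
-- fail outright, but there are at most k of them, which costs ζ each. A top newcomer
-- fails only if it loses at some level, and the errors decrease geometrically. The
-- choice θ = τ², where τ is about δ/k, lets one unit of initial budget suffice.

open import Defs
open import Level using (0ℓ)
open import Algebra.Bundles using (CommutativeRing)
import Algebra.Properties.CommutativeSemiring.Exp as CommutativeSemiringExp
import Algebra.Properties.Group as GroupProperties
import Algebra.Properties.Ring as RingProperties
import Algebra.Properties.Semiring.Exp as SemiringExp
import Algebra.Properties.Semiring.Mult as SemiringMult
import Algebra.Solver.Ring.NaturalCoefficients.Default as NaturalCoefficients
open import Data.Bool.Base using (true; false; if_then_else_)
open import Data.Bool.Properties using (¬-not)
open import Data.Empty using (⊥-elim)
open import Data.Fin.Base using (Fin; zero; suc; toℕ; fromℕ<; inject≤; punchIn)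
import Data.Fin.Properties as Fin
open import Data.Fin.Permutation using (Permutation′; _⟨$⟩ʳ_; _⟨$⟩ˡ_; inverseˡ; inverseʳ)
open import Data.Fin.Subset using (⁅_⁆; ⋃) renaming (_∈_ to _∈ˢ_)
open import Data.Fin.Subset.Properties using (x∈p∪q⁺; x∈p∪q⁻; x∈⁅x⁆; x∈⁅y⁆⇒x≡y; ∉⊥; _∈?_)
open import Data.List.Base as List using (List; []; _∷_; length)
import Data.List.Properties as List
open import Data.List.Membership.Propositional using (_∈_; _∉_)
open import Data.List.Membership.Propositional.Properties
  using (∈-filter⁺; ∈-filter⁻; ∈-allFin; ∈-lookup)
open import Data.List.Relation.Binary.Permutation.Propositional as Permutation using (_↭_; ↭-sym)
open import Data.List.Relation.Binary.Permutation.Propositional.Properties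
  using (All-resp-↭; ∈-resp-↭; ↭-length)
open import Data.List.Relation.Unary.All as All using (All; []; _∷_)
import Data.List.Relation.Unary.All.Properties as All
open import Data.List.Relation.Unary.AllPairs using (AllPairs; []; _∷_)
open import Data.List.Relation.Unary.Any using (here; there)
open import Data.List.Relation.Unary.Sorted.TotalOrder.Properties using (Sorted⇒AllPairs)
open import Data.List.Relation.Unary.Unique.Propositional using (Unique)
import Data.List.Relation.Unary.Unique.Propositional.Properties as Unique
open import Data.List.Sort using (sort; sort-↭; sort-↗)
open import Data.Maybe.Base as Maybe using (Maybe; just; nothing; fromMaybe)
import Data.Maybe.Properties as Maybe
open import Data.Nat.Base as ℕ using (ℕ; zero; suc)
import Data.Nat.Properties as ℕ
open import Data.Nat.Solver using (module +-*-Solver)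
open import Data.Product.Base using (Σ; ∃; _×_; _,_; proj₁; proj₂)
open import Data.Sum.Base using (_⊎_; inj₁; inj₂; [_,_]′)
open import Data.Unit.Base using (⊤; tt)
open import Data.Vec.Base as Vec using (Vec; []; _∷_; lookup; removeAt; _[_]≔_)
open import Data.Vec.Properties
  using (lookup∘update; lookup∘update′; lookup-map; lookup-allFin; removeAt-punchOut;
         []=⇒lookup; lookup⇒[]=; tabulate∘lookup; tabulate-cong)
open import Function.Base using (_∘_)
open import Relation.Binary.Bundles using (DecTotalOrder)
import Relation.Binary.Construct.Flip.EqAndOrd as Flip
import Relation.Binary.Construct.On as On
open import Relation.Binary.PropositionalEquality as ≡ using (_≡_; _≢_)
import Relation.Binary.Reasoning.Base.Triple as TripleReasoning
open import Relation.Binary.Structures using (IsPreorder)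
open import Relation.Nullary using (¬_; Dec; does; yes; no)
open import Relation.Nullary.Decidable using (_×-dec_; ¬?; decidable-stable; dec-true; dec-false)
open import Relation.Unary using (Decidable)

-- The bound has no log n, which rules out a union bound over rounds or over all coins. It is taken
-- over the k top coins only, and the chances of losing one of them in its many rounds as a king
-- must not add up. What makes such rounds free is multiplicative: a unit of budget changes the
-- potential by the factor θ, the price of level ℓ by 1/θ^ℓ, while the error at level ℓ is of order
-- r^ℓ. Price and reliability grow at the same rate, so the single condition 4r/θ² ≤ 1 serves all
-- levels.
--
-- With θ = τ the potentials of k fresh kings could already use up all of δ; hence τ². The condition
-- then asks for 4r ≤ τ⁴, and r ≤ τ⁵ ensures it because τ ≤ 1/4.
--
-- No concentration inequality is invoked. Each toss multiplies a weight by 1 + ch or 1 - (1 - c)h,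
-- or by their inverses, which are first-order forms of Chernoff's exponentials, and a misranked
-- pair forces a weight of at least 1. Markov's inequality then amounts to charging the weight to
-- the continuation of the program.

-- Ordered fields without a decidable order.

module OrderedField (ℝ : RealNumbers) where
  open Streaming ℝ public
  open SemiringExp (CommutativeRing.semiring commutativeRing) public
    using (_^_; ^-homo-*; ^-assocʳ; ^-congˡ)
  open CommutativeSemiringExp (CommutativeRing.commutativeSemiring commutativeRing) public
    using (^-distrib-*)
  open SemiringMult (CommutativeRing.semiring commutativeRing)
    using (×-homo-+; ×1-homo-*)
  open RingProperties (CommutativeRing.ring commutativeRing)
    using (-‿distribʳ-*)
  module Solver = NaturalCoefficients (CommutativeRing.commutativeSemiring commutativeRing)
  open Solver using (solve; _:+_; _:*_; _:=_; con)

  -- Substitute for trichotomy: apartness is cotransitive, and `#⇒<⊎>` orients whichever apartness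
  -- results.
  <-cotrans : ∀ {x y} → x < y → ∀ z → x < z ⊎ z < y
  <-cotrans {x} {y} x<y z with #-cotrans (<⇒# x<y) z
  ... | inj₁ x#z with #⇒<⊎> x#z
  ...   | inj₁ x<z = inj₁ x<z
  ...   | inj₂ z<x = inj₂ (<-trans z<x x<y)
  <-cotrans {x} {y} x<y z | inj₂ z#y with #⇒<⊎> z#y
  ...   | inj₁ z<y = inj₂ z<y
  ...   | inj₂ y<z = inj₁ (<-trans x<y y<z)

  ≤-reflexive : ∀ {x y} → x ≈ y → x ≤ y
  ≤-reflexive x≈y = <-irrefl (sym x≈y)

  ≤-refl : ∀ {x} → x ≤ x
  ≤-refl = ≤-reflexive refl

  ≤-trans : ∀ {x y z} → x ≤ y → y ≤ z → x ≤ z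
  ≤-trans {y = y} x≤y y≤z z<x with <-cotrans z<x y
  ... | inj₁ z<y = y≤z z<y
  ... | inj₂ y<x = x≤y y<x

  <⇒≤ : ∀ {x y} → x < y → x ≤ y
  <⇒≤ = <-asym

  <-≤-trans : ∀ {x y z} → x < y → y ≤ z → x < z
  <-≤-trans {z = z} x<y y≤z with <-cotrans x<y z
  ... | inj₁ x<z = x<z
  ... | inj₂ z<y = ⊥-elim (y≤z z<y)

  ≤-<-trans : ∀ {x y z} → x ≤ y → y < z → x < z
  ≤-<-trans {x} x≤y y<z with <-cotrans y<z x
  ... | inj₁ y<x = ⊥-elim (x≤y y<x)
  ... | inj₂ x<z = x<z

  ≤-isPreorder : IsPreorder _≈_ _≤_
  ≤-isPreorder = record { isEquivalence = isEquivalence ; reflexive = ≤-reflexive ; trans = ≤-trans }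

  module ≤-Reasoning = TripleReasoning ≤-isPreorder
    <-asym <-trans <-resp-≈ <⇒≤ <-≤-trans ≤-<-trans

  -- Non-strict inequalities are negations, so the order may be treated as
  -- total when proving one of them.
  ≤-cases : ∀ {x y a b} → (x < y → a ≤ b) → (y ≤ x → a ≤ b) → a ≤ b
  ≤-cases x<y⇒ y≤x⇒ b<a = y≤x⇒ (λ x<y → x<y⇒ x<y b<a) b<a

  +-monoʳ-< : ∀ z {x y} → x < y → z + x < z + y
  +-monoʳ-< z x<y = <-respˡ-≈ (+-comm _ z) (<-respʳ-≈ (+-comm _ z) (+-monoˡ-< z x<y))

  private
    x+z-z : ∀ x z → x + z + - z ≈ x
    x+z-z x z = trans (+-assoc x z (- z)) (trans (+-congˡ (-‿inverseʳ z)) (+-identityʳ x))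

  +-cancelʳ-< : ∀ z {x y} → x + z < y + z → x < y
  +-cancelʳ-< z {x} {y} lt = <-respˡ-≈ (x+z-z x z) (<-respʳ-≈ (x+z-z y z) (+-monoˡ-< (- z) lt))

  +-monoˡ-≤ : ∀ z {x y} → x ≤ y → x + z ≤ y + z
  +-monoˡ-≤ z x≤y lt = x≤y (+-cancelʳ-< z lt)

  +-monoʳ-≤ : ∀ z {x y} → x ≤ y → z + x ≤ z + y
  +-monoʳ-≤ z {x} {y} x≤y = ≤-trans (≤-reflexive (+-comm z x))
    (≤-trans (+-monoˡ-≤ z x≤y) (≤-reflexive (+-comm y z)))

  +-mono-≤ : ∀ {x y u v} → x ≤ y → u ≤ v → x + u ≤ y + v
  +-mono-≤ {y = y} {u} x≤y u≤v = ≤-trans (+-monoˡ-≤ u x≤y) (+-monoʳ-≤ y u≤v)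

  +-cancelʳ-≤ : ∀ z {x y} → x + z ≤ y + z → x ≤ y
  +-cancelʳ-≤ z le y<x = le (+-monoˡ-< z y<x)

  x≤x+y : ∀ {x y} → 0# ≤ y → x ≤ x + y
  x≤x+y {x} 0≤y = ≤-trans (≤-reflexive (sym (+-identityʳ x))) (+-monoʳ-≤ x 0≤y)

  x≤y+x : ∀ {x y} → 0# ≤ y → x ≤ y + x
  x≤y+x {x} {y} 0≤y = ≤-trans (x≤x+y 0≤y) (≤-reflexive (+-comm x y))

  0≤+ : ∀ {x y} → 0# ≤ x → 0# ≤ y → 0# ≤ x + y
  0≤+ 0≤x 0≤y = ≤-trans 0≤x (x≤x+y 0≤y)

  0≤1 : 0# ≤ 1#
  0≤1 = <⇒≤ 0<1

  x+y-x : ∀ {x y} → x + (y - x) ≈ y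
  x+y-x {x} {y} = trans (+-comm x (y - x))
    (trans (+-assoc y (- x) x) (trans (+-congˡ (-‿inverseˡ x)) (+-identityʳ y)))

  x≤y⇒0≤y-x : ∀ {x y} → x ≤ y → 0# ≤ y - x
  x≤y⇒0≤y-x {x} {y} x≤y lt = x≤y (<-respˡ-≈ x+y-x (<-respʳ-≈ (+-identityʳ x) (+-monoʳ-< x lt)))

  x<y⇒0<y-x : ∀ {x y} → x < y → 0# < y - x
  x<y⇒0<y-x {x} {y} x<y = <-respˡ-≈ (-‿inverseʳ x) (+-monoˡ-< (- x) x<y)

  0<y-x⇒x<y : ∀ {x y} → 0# < y - x → x < y
  0<y-x⇒x<y {x} lt = <-respˡ-≈ (+-identityʳ x) (<-respʳ-≈ x+y-x (+-monoʳ-< x lt))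

  private
    *-distribˡ-- : ∀ a x y → a * y - a * x ≈ a * (y - x)
    *-distribˡ-- a x y = trans (+-congˡ (-‿distribʳ-* a x)) (sym (distribˡ a y (- x)))

  0<*⇒0<ʳ : ∀ {a b} → 0# < a → 0# < a * b → 0# < b
  0<*⇒0<ʳ {a} {b} 0<a 0<ab =
    <-respʳ-≈ (trans (sym (*-assoc _ a b)) (trans (*-congʳ (inverse-*ˡ (a , 0<a))) (*-identityˡ b)))
      (*-pos (0<inverse (a , 0<a)) 0<ab)

  *-monoˡ-< : ∀ {a x y} → 0# < a → x < y → a * x < a * y
  *-monoˡ-< {a} {x} {y} 0<a x<y =
    0<y-x⇒x<y (<-respʳ-≈ (sym (*-distribˡ-- a x y)) (*-pos 0<a (x<y⇒0<y-x x<y)))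

  *-cancelˡ-< : ∀ {a x y} → 0# < a → a * x < a * y → x < y
  *-cancelˡ-< {a} {x} {y} 0<a lt =
    0<y-x⇒x<y (0<*⇒0<ʳ 0<a (<-respʳ-≈ (*-distribˡ-- a x y) (x<y⇒0<y-x lt)))

  *-cancelˡ-≤ : ∀ {a x y} → 0# < a → a * x ≤ a * y → x ≤ y
  *-cancelˡ-≤ 0<a le y<x = le (*-monoˡ-< 0<a y<x)

  0≤* : ∀ {x y} → 0# ≤ x → 0# ≤ y → 0# ≤ x * y
  0≤* {x} {y} 0≤x 0≤y =
    -- A factor that is both nonnegative and at most 0 is equal to 0 by tightness of the apartness.
    ≤-cases {0#} {x}
      (λ 0<x → ≤-cases {0#} {y} (λ 0<y → <⇒≤ (*-pos 0<x 0<y))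
        (λ y≤0 → ≤-reflexive (sym (trans (*-congˡ (antisym y≤0 0≤y)) (zeroʳ x)))))
      (λ x≤0 → ≤-reflexive (sym (trans (*-congʳ (antisym x≤0 0≤x)) (zeroˡ y))))
    where
    antisym : ∀ {x y} → x ≤ y → y ≤ x → x ≈ y
    antisym {x} {y} x≤y y≤x = proj₁ (tight x y) λ x#y →
      [ y≤x , x≤y ]′ (#⇒<⊎> x#y)

  *-monoˡ-≤ : ∀ {a x y} → 0# ≤ a → x ≤ y → a * x ≤ a * y
  *-monoˡ-≤ {a} {x} {y} 0≤a x≤y = ≤-trans (x≤x+y (0≤* 0≤a (x≤y⇒0≤y-x x≤y)))
    (≤-reflexive (trans (sym (distribˡ a x (y - x))) (*-congˡ x+y-x)))

  *-monoʳ-≤ : ∀ {a x y} → 0# ≤ a → x ≤ y → x * a ≤ y * a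
  *-monoʳ-≤ {a} {x} {y} 0≤a x≤y = ≤-trans (≤-reflexive (*-comm x a))
    (≤-trans (*-monoˡ-≤ 0≤a x≤y) (≤-reflexive (*-comm a y)))

  *-mono-≤ : ∀ {x y u v} → 0# ≤ x → 0# ≤ v → x ≤ y → u ≤ v → x * u ≤ y * v
  *-mono-≤ 0≤x 0≤v x≤y u≤v = ≤-trans (*-monoˡ-≤ 0≤x u≤v) (*-monoʳ-≤ 0≤v x≤y)

  0≤^ : ∀ {x} → 0# ≤ x → ∀ n → 0# ≤ x ^ n
  0≤^ 0≤x zero    = 0≤1
  0≤^ 0≤x (suc n) = 0≤* 0≤x (0≤^ 0≤x n)

  0<^ : ∀ {x} → 0# < x → ∀ n → 0# < x ^ n
  0<^ 0<x zero    = 0<1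
  0<^ 0<x (suc n) = *-pos 0<x (0<^ 0<x n)

  ^-monoˡ-≤ : ∀ {x y} → 0# ≤ x → x ≤ y → ∀ n → x ^ n ≤ y ^ n
  ^-monoˡ-≤ 0≤x x≤y zero    = ≤-refl
  ^-monoˡ-≤ 0≤x x≤y (suc n) =
    *-mono-≤ 0≤x (0≤^ (≤-trans 0≤x x≤y) n) x≤y (^-monoˡ-≤ 0≤x x≤y n)

  1^≈1 : ∀ n → 1# ^ n ≈ 1#
  1^≈1 zero    = refl
  1^≈1 (suc n) = trans (*-identityˡ _) (1^≈1 n)

  ^≤1 : ∀ {x} → 0# ≤ x → x ≤ 1# → ∀ n → x ^ n ≤ 1#
  ^≤1 0≤x x≤1 n = ≤-trans (^-monoˡ-≤ 0≤x x≤1 n) (≤-reflexive (1^≈1 n))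

  ^-antitoneʳ-≤ : ∀ {x} → 0# ≤ x → x ≤ 1# → ∀ {m n} → m ℕ.≤ n → x ^ n ≤ x ^ m
  ^-antitoneʳ-≤ 0≤x x≤1 {n = n} ℕ.z≤n = ^≤1 0≤x x≤1 n
  ^-antitoneʳ-≤ 0≤x x≤1 (ℕ.s≤s m≤n)   = *-monoˡ-≤ 0≤x (^-antitoneʳ-≤ 0≤x x≤1 m≤n)

  fromℕ-+ : ∀ m n → fromℕ (m ℕ.+ n) ≈ fromℕ m + fromℕ n
  fromℕ-+ m n = ×-homo-+ 1# m n

  fromℕ-* : ∀ m n → fromℕ (m ℕ.* n) ≈ fromℕ m * fromℕ n
  fromℕ-* m n = ×1-homo-* m n

  0≤fromℕ : ∀ n → 0# ≤ fromℕ n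
  0≤fromℕ zero    = ≤-refl
  0≤fromℕ (suc n) = <⇒≤ (0<fromℕ-suc n)

  fromℕ-mono-≤ : ∀ {m n} → m ℕ.≤ n → fromℕ m ≤ fromℕ n
  fromℕ-mono-≤ {n = n} ℕ.z≤n = 0≤fromℕ n
  fromℕ-mono-≤ (ℕ.s≤s m≤n)   = +-monoʳ-≤ 1# (fromℕ-mono-≤ m≤n)

  fromℕ-1 : fromℕ 1 ≈ 1#
  fromℕ-1 = +-identityʳ 1#

  -- One of the two factors is at least 1: if the first is below 1, the second is at least the
  -- product.
  1≤*⇒1≤-bound : ∀ {x y z} → 0# ≤ y → 1# ≤ x * y → x ≤ z → y ≤ z → 1# ≤ z
  1≤*⇒1≤-bound {x} {y} 0≤y 1≤xy x≤z y≤z =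
    ≤-cases {x} {1#}
      (λ x<1 → ≤-trans 1≤xy (≤-trans (*-monoʳ-≤ 0≤y (<⇒≤ x<1))
        (≤-trans (≤-reflexive (*-identityˡ y)) y≤z)))
      (λ 1≤x → ≤-trans 1≤x x≤z)

  *-≤1 : ∀ {x y} → 0# ≤ x → x ≤ 1# → y ≤ 1# → x * y ≤ 1#
  *-≤1 0≤x x≤1 y≤1 = ≤-trans (*-mono-≤ 0≤x 0≤1 x≤1 y≤1) (≤-reflexive (*-identityˡ 1#))

-- Expectations of programs and exponential weights.

module Expectation (ℝ : RealNumbers) where
  open OrderedField ℝ
  open Solver using (solve; _:+_; _:*_; _:=_; con)

  E : ∀ {A : Set} → Dist A → (A → Carrier) → Carrier
  E (return a)      f = f a
  E (bernoulli q d) f = value q * E (d true) f + (1# - value q) * E (d false) f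

  0≤1-q : ∀ q → 0# ≤ 1# - value q
  0≤1-q q = x≤y⇒0≤y-x (value≤1 q)

  mix-≤ : ∀ q {x y u v} → x ≤ u → y ≤ v →
          value q * x + (1# - value q) * y ≤ value q * u + (1# - value q) * v
  mix-≤ q x≤u y≤v = +-mono-≤ (*-monoˡ-≤ (0≤value q) x≤u) (*-monoˡ-≤ (0≤1-q q) y≤v)

  mix-const : ∀ q v → value q * v + (1# - value q) * v ≈ v
  mix-const q v = trans (sym (distribʳ v _ _)) (trans (*-congʳ x+y-x) (*-identityˡ v))

  mix-≤-const : ∀ q {x y v} → x ≤ v → y ≤ v → value q * x + (1# - value q) * y ≤ v
  mix-≤-const q {v = v} x≤v y≤v = ≤-trans (mix-≤ q x≤v y≤v) (≤-reflexive (mix-const q v))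

  E->>= : ∀ {A B : Set} (d : Dist A) (g : A → Dist B) f → E (d >>= g) f ≡ E d (λ a → E (g a) f)
  E->>= (return a)      g f = ≡.refl
  E->>= (bernoulli q d) g f = ≡.cong₂ (λ x y → value q * x + (1# - value q) * y)
    (E->>= (d true) g f) (E->>= (d false) g f)

  Pr≡E : ∀ {A : Set} {P : A → Set} (P? : Decidable P) d →
         Pr[ P? ] d ≡ E d (λ a → if does (P? a) then 1# else 0#)
  Pr≡E P? (return a)      = ≡.refl
  Pr≡E P? (bernoulli q d) = ≡.cong₂ (λ x y → value q * x + (1# - value q) * y)
    (Pr≡E P? (d true)) (Pr≡E P? (d false))

  E-mono : ∀ {A : Set} {P : A → Set} (d : Dist A) → Surely P d → ∀ {f g} →
           (∀ a → P a → f a ≤ g a) → E d f ≤ E d g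
  E-mono (return a)      Pa f≤g = f≤g a Pa
  E-mono (bernoulli q d) sP f≤g =
    mix-≤ q (E-mono (d true) (sP true) f≤g) (E-mono (d false) (sP false) f≤g)

  surely-⊤ : ∀ {A : Set} {P : A → Set} (d : Dist A) → (∀ a → P a) → Surely P d
  surely-⊤ (return a)      P = P a
  surely-⊤ (bernoulli q d) P = λ b → surely-⊤ (d b) P

  surely-map : ∀ {A : Set} {P Q : A → Set} (d : Dist A) → (∀ a → P a → Q a) →
               Surely P d → Surely Q d
  surely-map (return a)      P⇒Q Pa = P⇒Q a Pa
  surely-map (bernoulli q d) P⇒Q sP = λ b → surely-map (d b) P⇒Q (sP b)

  surely->>= : ∀ {A B : Set} {P : A → Set} {Q : B → Set} (d : Dist A) {g : A → Dist B} →
               Surely P d → (∀ a → P a → Surely Q (g a)) → Surely Q (d >>= g)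
  surely->>= (return a)      Pa P⇒Q = P⇒Q a Pa
  surely->>= (bernoulli q d) sP P⇒Q = λ b → surely->>= (d b) (sP b) P⇒Q

  E-const : ∀ {A : Set} (d : Dist A) v → E d (λ _ → v) ≈ v
  E-const (return a)      v = refl
  E-const (bernoulli q d) v = trans
    (+-cong (*-congˡ (E-const (d true) v)) (*-congˡ (E-const (d false) v))) (mix-const q v)

  E-+ : ∀ {A : Set} (d : Dist A) f g → E d (λ a → f a + g a) ≈ E d f + E d g
  E-+ (return a)      f g = refl
  E-+ (bernoulli q d) f g = trans
    (+-cong (*-congˡ (E-+ (d true) f g)) (*-congˡ (E-+ (d false) f g)))
    (solve 6 (λ p p̄ a b c e →
       p :* (a :+ b) :+ p̄ :* (c :+ e) := (p :* a :+ p̄ :* c) :+ (p :* b :+ p̄ :* e))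
     refl (value q) (1# - value q) (E (d true) f) (E (d true) g) (E (d false) f) (E (d false) g))

  E-≤-const : ∀ {A : Set} {P : A → Set} (d : Dist A) → Surely P d → ∀ {f v} →
              (∀ a → P a → f a ≤ v) → E d f ≤ v
  E-≤-const d sP {v = v} f≤v = ≤-trans (E-mono d sP f≤v) (≤-reflexive (E-const d v))

  -- Chernoff's exponential weight, written as one factor per toss: `a` for tails and `a′` for
  -- heads.
  weight : Carrier → Carrier → ℕ → ℕ → Carrier
  weight a a′ m h = a′ ^ h * a ^ (m ℕ.∸ h)

  0≤weight : ∀ {a a′} → 0# ≤ a → 0# ≤ a′ → ∀ m h → 0# ≤ weight a a′ m h
  0≤weight 0≤a 0≤a′ m h = 0≤* (0≤^ 0≤a′ h) (0≤^ 0≤a (m ℕ.∸ h))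

  tosses : ∀ {R φ s} → Fin s → ℕ → (ℕ → Program R φ s) → Program R φ s
  tosses i zero    K = K 0
  tosses i (suc m) K = tossStored i λ b → tosses i m λ h → K (if b then suc h else h)

  -- Uniform in the counters of tosses and memory, so that estimates of probabilities need not track
  -- them. As a record it keeps memory and program visible to unification, which the unfolded
  -- expectation would not.
  record Bounded {n : ℕ} (p : Fin n → UnitInterval) {R : ℕ → Set} {φ : Phase} (c : Coin φ n)
                 (F : Config n R → Carrier) {s : ℕ} (mem : Vec (Fin n) s)
                 (P : Program R φ s) (v : Carrier) : Set where
    constructor bounded
    field bound : ∀ t m → E (exec p P c mem t m) F ≤ v

  open Bounded public

  module _ {n : ℕ} {p : Fin n → UnitInterval} {R : ℕ → Set} {φ : Phase} {c : Coin φ n}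
           {F : Config n R → Carrier} where

    bounded-≤ : ∀ {s} {mem : Vec (Fin n) s} {P u v} → u ≤ v →
                Bounded p c F mem P u → Bounded p c F mem P v
    bounded-≤ u≤v P≤u .bound t m = ≤-trans (P≤u .bound t m) u≤v

    bounded-if : ∀ {s} {mem : Vec (Fin n) s} {X : Set} (X? : Dec X) {P Q v} →
      (X → Bounded p c F mem P v) → (¬ X → Bounded p c F mem Q v) →
      Bounded p c F mem (if does X? then P else Q) v
    bounded-if (yes x) P≤v Q≤v = P≤v x
    bounded-if (no ¬x) P≤v Q≤v = Q≤v ¬x

    tosses-bounded : ∀ {s} {mem : Vec (Fin n) s} i m {K v} →
      (∀ h → Bounded p c F mem (K h) v) → Bounded p c F mem (tosses i m K) v
    tosses-bounded i zero    K≤v = K≤v 0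
    tosses-bounded {mem = mem} i (suc m) K≤v .bound t u = mix-≤-const (p (lookup mem i))
      (tosses-bounded i m (λ h → K≤v (suc h)) .bound (suc t) u)
      (tosses-bounded i m K≤v .bound (suc t) u)

    -- The exponential moment method, read backwards along the program: a continuation charged `u`
    -- times the weight of the observed heads costs `u` times the mean weight beforehand. The
    -- induction absorbs the factor of the first toss into `u`.
    tosses-weighted : ∀ {s} {mem : Vec (Fin n) s} i {a a′ ρ} →
      value (p (lookup mem i)) * a′ + (1# - value (p (lookup mem i))) * a ≤ ρ →
      0# ≤ a → 0# ≤ a′ → 0# ≤ ρ →
      ∀ m {K v u} → 0# ≤ u →
      (∀ h → h ℕ.≤ m → Bounded p c F mem (K h) (v + u * weight a a′ m h)) →
      Bounded p c F mem (tosses i m K) (v + u * ρ ^ m)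
    tosses-weighted i _ _ _ _ zero {v = v} {u} 0≤u K≤ =
      bounded-≤ (≤-reflexive (+-congˡ (*-congˡ (*-identityˡ 1#)))) (K≤ 0 ℕ.z≤n)
    tosses-weighted {mem = mem} i {a} {a′} {ρ} mean≤ρ 0≤a 0≤a′ 0≤ρ (suc m) {K} {v} {u} 0≤u K≤ .bound t x =
      begin
        q * _ + q̄ * _
          ≤⟨ mix-≤ (p (lookup mem i))
               (tosses-weighted i mean≤ρ 0≤a 0≤a′ 0≤ρ m {u = u * a′} (0≤* 0≤u 0≤a′)
                 (λ h h≤m → bounded-≤ (≤-reflexive (+-congˡ (heads h)))
                   (K≤ (suc h) (ℕ.s≤s h≤m))) .bound (suc t) x)
               (tosses-weighted i mean≤ρ 0≤a 0≤a′ 0≤ρ m {u = u * a} (0≤* 0≤u 0≤a)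
                 (λ h h≤m → bounded-≤ (≤-reflexive (+-congˡ (tails h h≤m)))
                   (K≤ h (ℕ.m≤n⇒m≤1+n h≤m))) .bound (suc t) x) ⟩
        q * (v + u * a′ * r) + q̄ * (v + u * a * r)
          ≈⟨ solve 7 (λ q q̄ v u a a′ r →
               q :* (v :+ u :* a′ :* r) :+ q̄ :* (v :+ u :* a :* r) :=
               (q :* v :+ q̄ :* v) :+ u :* ((q :* a′ :+ q̄ :* a) :* r))
             refl q q̄ v u a a′ r ⟩
        (q * v + q̄ * v) + u * ((q * a′ + q̄ * a) * r)
          ≈⟨ +-congʳ (mix-const (p (lookup mem i)) v) ⟩
        v + u * ((q * a′ + q̄ * a) * r)
          ≤⟨ +-monoʳ-≤ v (*-monoˡ-≤ 0≤u (*-monoʳ-≤ (0≤^ 0≤ρ m) mean≤ρ)) ⟩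
        v + u * (ρ * r) ∎
      where
      open ≤-Reasoning
      q = value (p (lookup mem i))
      q̄ = 1# - q
      r = ρ ^ m
      heads : ∀ h → u * weight a a′ (suc m) (suc h) ≈ u * a′ * weight a a′ m h
      heads h = solve 4 (λ u a′ x y → u :* (a′ :* x :* y) := u :* a′ :* (x :* y))
        refl u a′ (a′ ^ h) (a ^ (m ℕ.∸ h))
      tails : ∀ h → h ℕ.≤ m → u * weight a a′ (suc m) h ≈ u * a * weight a a′ m h
      tails h h≤m = trans
        (*-congˡ (*-congˡ (reflexive (≡.cong (a ^_) (ℕ.+-∸-assoc 1 h≤m)))))
        (solve 4 (λ u a x y → u :* (x :* (a :* y)) := u :* a :* (x :* y))
          refl u a (a′ ^ h) (a ^ (m ℕ.∸ h)))

-- The algorithm: a slot holds `just` the budget of a king, or `nothing` for a newcomer.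

Status : ℕ → Set
Status = Vec (Maybe ℕ)

ascending descending : ∀ {s} → Vec ℕ s → DecTotalOrder 0ℓ 0ℓ 0ℓ
ascending  hs = On.decTotalOrder ℕ.≤-decTotalOrder (lookup hs)
descending hs = Flip.decTotalOrder (ascending hs)

IsNewcomer : ∀ {s} → Status s → Fin s → Set
IsNewcomer st i = lookup st i ≡ nothing

newcomer? : ∀ {s} (st : Status s) → Decidable (IsNewcomer st)
newcomer? st i = Maybe.≡-dec ℕ._≟_ (lookup st i) nothing

king? : ∀ {s} (st : Status s) → Decidable (λ i → ¬ IsNewcomer st i)
king? st i = ¬? (newcomer? st i)

kings newcomers : ∀ {s} → Status s → List (Fin s)
kings     st = List.filter (king? st) (List.allFin _)
newcomers st = List.filter (newcomer? st) (List.allFin _)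

module Algorithm (ℝ : RealNumbers) (k s₀ : ℕ) where
  open OrderedField ℝ
  open Expectation ℝ

  tossAll : ∀ {R φ s m} → Vec (Fin s) m → (Vec ℕ m → Program R φ s) → Program R φ s
  tossAll []       K = K []
  tossAll (i ∷ is) K = tosses i s₀ λ h → tossAll is λ hs → K (h ∷ hs)

  -- The first argument only serves termination: it must be at least the budget b.
  challenge : ∀ {R φ s} → ℕ → Fin s → Fin s → (b ℓ : ℕ) →
              (Maybe ℕ → Program R φ s) → Program R φ s
  challenge zero       i j b ℓ K = K nothing
  challenge (suc fuel) i j b ℓ K =
    if does (ℓ ℕ.≤? b)
    then (tosses i (s₀ ℕ.* ℓ) λ x → tosses j (s₀ ℕ.* ℓ) λ y →
            if does (y ℕ.<? x)
            then K (just (b ℕ.∸ ℓ))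
            else challenge fuel i j (b ℕ.∸ ℓ) (suc ℓ) K)
    else K nothing

  -- A deposed king is marked as a newcomer only so that `compact` discards it.
  settle : ∀ {s} → Fin s → Fin s → Status s → Maybe ℕ → Status s
  settle i j st (just b) = st [ i ]≔ just b
  settle i j st nothing  = (st [ i ]≔ nothing) [ j ]≔ just 1

  settle-other : ∀ {s} {i j l : Fin s} st o → l ≢ i → l ≢ j →
                 lookup (settle i j st o) l ≡ lookup st l
  settle-other st (just b) l≢i l≢j = lookup∘update′ l≢i st (just b)
  settle-other {i = i} st nothing  l≢i l≢j =
    ≡.trans (lookup∘update′ l≢j (st [ i ]≔ nothing) (just 1)) (lookup∘update′ l≢i st nothing)

  budget : ∀ {s} → Status s → Fin s → ℕ
  budget st i = fromMaybe 0 (lookup st i)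

  fights : ∀ {R φ s} → Vec ℕ s → List (Fin s) → List (Fin s) → Status s →
           (Status s → Program R φ s) → Program R φ s
  fights hs (i ∷ is) (j ∷ js) st K =
    if does (lookup hs i ℕ.<? lookup hs j)
    then (challenge (budget st i) i j (budget st i) 1 λ o →
            fights hs is js (settle i j st o) K)
    else fights hs is js st K
  -- Newcomers without a king to face remain newcomers and are discarded afterwards.
  fights hs _        _        st K = K st

  compact : ∀ {R φ s} → Status s → (∀ {s′} → Status s′ → Program R φ s′) → Program R φ s
  compact {s = zero}  st K = K st
  compact {s = suc s} st K with Fin.any? (newcomer? st)
  ... | yes (i , _) = discard i (compact (removeAt st i) K)
  ... | no  _       = K st

  cull : ∀ {R φ s} → Status s → (∀ {s′} → Status s′ → Program R φ s′) → Program R φ s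
  cull {s = s} st K = tossAll (Vec.allFin s) λ hs →
    fights hs (sort (ascending hs) (kings st)) (sort (descending hs) (newcomers st))
      -- The income of the round is credited before the fights, so every king can afford level 1.
      (Vec.map (Maybe.map suc) st) λ st′ → compact st′ K

  arrive : ∀ {s} → Status s → Program Status arriving s
  arrive {s} st =
    if does (s ℕ.<? k) then store (return (just 1 ∷ st))
    else if does (suc s ℕ.<? k ℕ.+ k) then store (return (nothing ∷ st))
    -- The coin that fills slot 2k triggers the round at once; memory never exceeds 2k.
    else store (cull (nothing ∷ st) return)

  algorithm : StreamingAlgorithm
  algorithm = record
    { State     = Status
    ; initial   = []
    ; onArrival = arrive
    ; atEnd     = λ st → cull st (λ {s} _ → return (List.allFin s))
    }

-- A single challenge between a king and a newcomer.

module Challenge (ℝ : RealNumbers) (k s₀ : ℕ) where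
  open OrderedField ℝ
  open Solver using (solve; _:+_; _:*_; _:=_; con)
  open Expectation ℝ
  open Algorithm ℝ k s₀

  -- Weights a, a′ of the tails and heads of top coins and b, b′ of those of the others. The
  -- weight of m tosses has mean at most ρ ^ m, but if a top coin shows no more heads than
  -- another coin, the product of their weights is at least 1.
  record Separation {n : ℕ} (p : Fin n → UnitInterval) (Top : Fin n → Set) : Set where
    field
      a a′ b b′ ρ : Carrier
      0≤a  : 0# ≤ a
      0≤a′ : 0# ≤ a′
      0≤b  : 0# ≤ b
      0≤b′ : 0# ≤ b′
      0≤ρ  : 0# ≤ ρ
      a′≤a : a′ ≤ a
      ab   : a * b ≈ 1#
      a′b′ : a′ * b′ ≈ 1#
      top-mean   : ∀ c → Top c → value (p c) * a′ + (1# - value (p c)) * a ≤ ρ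
      other-mean : ∀ c → ¬ Top c → value (p c) * b′ + (1# - value (p c)) * b ≤ ρ

    r : Carrier
    r = ρ ^ s₀

    0≤r : 0# ≤ r
    0≤r = 0≤^ 0≤ρ s₀

    topWeight otherWeight : ℕ → ℕ → Carrier
    topWeight   = weight a a′
    otherWeight = weight b b′

    0≤topWeight : ∀ m h → 0# ≤ topWeight m h
    0≤topWeight = 0≤weight 0≤a 0≤a′

    0≤otherWeight : ∀ m h → 0# ≤ otherWeight m h
    0≤otherWeight = 0≤weight 0≤b 0≤b′

    -- Turning a tail into a head replaces a factor `a` by `a′`, which is not larger.
    topWeight-antitone : ∀ {m x y} → x ℕ.≤ y → y ℕ.≤ m → topWeight m y ≤ topWeight m x
    topWeight-antitone {m} {x} {y} x≤y y≤m with ℕ.m≤n⇒∃[o]m+o≡n x≤y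
    ... | e , ≡.refl = begin
      a′ ^ (x ℕ.+ e) * a ^ (m ℕ.∸ (x ℕ.+ e))
        ≈⟨ trans (*-congʳ (^-homo-* a′ x e)) (*-assoc _ _ _) ⟩
      a′ ^ x * (a′ ^ e * a ^ (m ℕ.∸ (x ℕ.+ e)))
        ≤⟨ *-monoˡ-≤ (0≤^ 0≤a′ x) (*-monoʳ-≤ (0≤^ 0≤a (m ℕ.∸ (x ℕ.+ e))) (^-monoˡ-≤ 0≤a′ a′≤a e)) ⟩
      a′ ^ x * (a ^ e * a ^ (m ℕ.∸ (x ℕ.+ e)))
        ≈⟨ *-congˡ (trans (sym (^-homo-* a e _)) (reflexive (≡.cong (a ^_) exponent))) ⟩
      a′ ^ x * a ^ (m ℕ.∸ x) ∎
      where
      open ≤-Reasoning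
      exponent : e ℕ.+ (m ℕ.∸ (x ℕ.+ e)) ≡ m ℕ.∸ x
      exponent = ≡.trans (≡.cong (e ℕ.+_) (≡.sym (ℕ.∸-+-assoc m x e)))
        (ℕ.m+[n∸m]≡n (ℕ.m+n≤o⇒m≤o∸n e (≡.subst (ℕ._≤ m) (ℕ.+-comm x e) y≤m)))

    weights-inverse : ∀ m h → topWeight m h * otherWeight m h ≈ 1#
    weights-inverse m h = begin-equality
      (a′ ^ h * a ^ (m ℕ.∸ h)) * (b′ ^ h * b ^ (m ℕ.∸ h))
        ≈⟨ solve 4 (λ x y z w → (x :* y) :* (z :* w) := (x :* z) :* (y :* w)) refl
             (a′ ^ h) (a ^ (m ℕ.∸ h)) (b′ ^ h) (b ^ (m ℕ.∸ h)) ⟩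
      (a′ ^ h * b′ ^ h) * (a ^ (m ℕ.∸ h) * b ^ (m ℕ.∸ h))
        ≈⟨ *-cong (sym (^-distrib-* a′ b′ h)) (sym (^-distrib-* a b (m ℕ.∸ h))) ⟩
      (a′ * b′) ^ h * (a * b) ^ (m ℕ.∸ h)
        ≈⟨ *-cong (trans (^-congˡ h a′b′) (1^≈1 h)) (trans (^-congˡ (m ℕ.∸ h) ab) (1^≈1 (m ℕ.∸ h))) ⟩
      1# * 1#
        ≈⟨ *-identityˡ 1# ⟩
      1# ∎
      where open ≤-Reasoning

    -- At equal numbers of heads the two weights are inverse to each other, and fewer heads can only
    -- raise the weight of the top coin. So the product is at least 1, and hence one of the weights
    -- is.
    misranked : ∀ {m x y z} → x ℕ.≤ y → y ℕ.≤ m →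
                topWeight m x ≤ z → otherWeight m y ≤ z → 1# ≤ z
    misranked {m} {x} {y} x≤y y≤m = 1≤*⇒1≤-bound (0≤otherWeight m y)
      (≤-trans (≤-reflexive (sym (weights-inverse m y)))
        (*-monoʳ-≤ (0≤otherWeight m y) (topWeight-antitone x≤y y≤m)))

  -- `θ` is what one unit of budget contributes to the potential, and `ϑ` is its inverse, the price
  -- of spending it. By `r-small` the error of a level outweighs the price of the next one; by
  -- `θ+r-small` the unit earned in a round pays for the chance that one of the 2k stored coins
  -- spoils the ranking.
  record Calibration (r : Carrier) : Set where
    field
      θ ϑ : Carrier
      0≤r : 0# ≤ r
      0≤θ : 0# ≤ θ
      0≤ϑ : 0# ≤ ϑ
      1≤ϑ : 1# ≤ ϑ
      θϑ  : θ * ϑ ≈ 1#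
      r-small : (r + r + (r + r)) * (ϑ * ϑ) ≤ 1#
      θ+r-small : θ + fromℕ (k ℕ.+ k) * (r + r) ≤ 1#

    4r≤1 : r + r + (r + r) ≤ 1#
    4r≤1 = ≤-trans (≤-trans (≤-reflexive (sym (*-identityʳ _)))
      (*-monoˡ-≤ 0≤4r (≤-trans (≤-reflexive (sym (*-identityˡ 1#))) (*-mono-≤ 0≤1 0≤ϑ 1≤ϑ 1≤ϑ))))
      r-small
      where 0≤4r = 0≤+ (0≤+ 0≤r 0≤r) (0≤+ 0≤r 0≤r)

    2r≤1 : r + r ≤ 1#
    2r≤1 = ≤-trans (x≤x+y (0≤+ 0≤r 0≤r)) 4r≤1

    θ≤1 : θ ≤ 1#
    θ≤1 = ≤-trans (≤-trans (≤-reflexive (sym (*-identityʳ θ))) (*-monoˡ-≤ 0≤θ 1≤ϑ)) (≤-reflexive θϑ)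

    rϑ≤1 : r * ϑ ≤ 1#
    rϑ≤1 = ≤-trans (*-mono-≤ 0≤r (0≤* 0≤ϑ 0≤ϑ)
      (≤-trans (x≤x+y 0≤r) (x≤x+y (0≤+ 0≤r 0≤r)))
      (≤-trans (≤-reflexive (sym (*-identityʳ ϑ))) (*-monoˡ-≤ 0≤ϑ 1≤ϑ))) r-small

    θ^b*ϑ^b : ∀ b → θ ^ b * ϑ ^ b ≈ 1#
    θ^b*ϑ^b b = trans (sym (^-distrib-* θ ϑ b)) (trans (^-congˡ b θϑ) (1^≈1 b))

    1≤ϑ^ : ∀ b → 1# ≤ ϑ ^ b
    1≤ϑ^ zero    = ≤-refl
    1≤ϑ^ (suc b) = ≤-trans (≤-reflexive (sym (*-identityˡ 1#))) (*-mono-≤ 0≤1 (0≤^ 0≤ϑ b) 1≤ϑ (1≤ϑ^ b))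

    θ^ϑ^ : ∀ {b ℓ} → ℓ ℕ.≤ b → θ ^ b * ϑ ^ ℓ ≈ θ ^ (b ℕ.∸ ℓ)
    θ^ϑ^ {b} {ℓ} ℓ≤b = trans (*-congʳ (trans (reflexive (≡.cong (θ ^_) (≡.sym (ℕ.m∸n+n≡m ℓ≤b))))
        (^-homo-* θ (b ℕ.∸ ℓ) ℓ)))
      (trans (*-assoc _ _ _) (trans (*-congˡ (θ^b*ϑ^b ℓ)) (*-identityʳ _)))

    1≤θ^ϑ^ : ∀ {b ℓ} → b ℕ.≤ ℓ → 1# ≤ θ ^ b * ϑ ^ ℓ
    1≤θ^ϑ^ {b} b≤ℓ with ℕ.m≤n⇒∃[o]m+o≡n b≤ℓ
    ... | e , ≡.refl = ≤-trans (1≤ϑ^ e) (≤-reflexive (sym (trans (*-congˡ (^-homo-* ϑ b e))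
      (trans (sym (*-assoc _ _ _)) (trans (*-congʳ (θ^b*ϑ^b b)) (*-identityˡ _))))))

    potential : Maybe ℕ → Carrier
    potential (just b) = θ ^ b
    potential nothing  = 1#

    potential≤1 : ∀ o → potential o ≤ 1#
    potential≤1 (just b) = ^≤1 0≤θ θ≤1 b
    potential≤1 nothing  = ≤-refl

    -- Going on from level ℓ + 1 has chance at most 2 r^(ℓ+1), and the next level costs ϑ^(ℓ+2). A
    -- factor 4rϑ² takes up the doublings and the surplus price; what remains is a power of rϑ ≤ 1.
    level-decay : ∀ x ℓ → 0# ≤ x →
      (x * ϑ ^ suc (suc ℓ) + x * ϑ ^ suc (suc ℓ)) * (r ^ suc ℓ + r ^ suc ℓ) ≤ x
    level-decay x ℓ 0≤x = begin
      (x * ϑ ^ suc (suc ℓ) + x * ϑ ^ suc (suc ℓ)) * (r ^ suc ℓ + r ^ suc ℓ)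
        ≈⟨ solve 5 (λ x ϑ r s t →
             (x :* (ϑ :* (ϑ :* s)) :+ x :* (ϑ :* (ϑ :* s))) :* (r :* t :+ r :* t) :=
             x :* (((r :+ r :+ (r :+ r)) :* (ϑ :* ϑ)) :* (t :* s))) refl x ϑ r (ϑ ^ ℓ) (r ^ ℓ) ⟩
      x * (((r + r + (r + r)) * (ϑ * ϑ)) * (r ^ ℓ * ϑ ^ ℓ))
        ≈⟨ *-congˡ (*-congˡ (^-distrib-* r ϑ ℓ)) ⟨
      x * (((r + r + (r + r)) * (ϑ * ϑ)) * (r * ϑ) ^ ℓ)
        ≤⟨ *-monoˡ-≤ 0≤x (*-≤1 (0≤* (0≤+ (0≤+ 0≤r 0≤r) (0≤+ 0≤r 0≤r)) (0≤* 0≤ϑ 0≤ϑ)) r-small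
             (^≤1 (0≤* 0≤r 0≤ϑ) rϑ≤1 ℓ)) ⟩
      x * 1#
        ≈⟨ *-identityʳ x ⟩
      x ∎
      where open ≤-Reasoning

  module _ {n : ℕ} {p : Fin n → UnitInterval} {R : ℕ → Set} {φ : Phase} {c : Coin φ n}
           {F : Config n R → Carrier} where

    challenge-bounded : ∀ {s} {mem : Vec (Fin n) s} fuel i j b ℓ {K v} →
      (∀ o → Bounded p c F mem (K o) v) → Bounded p c F mem (challenge fuel i j b ℓ K) v
    challenge-bounded zero       i j b ℓ K≤v = K≤v nothing
    challenge-bounded (suc fuel) i j b ℓ K≤v = bounded-if (ℓ ℕ.≤? b)
      (λ _ → tosses-bounded i (s₀ ℕ.* ℓ) λ x → tosses-bounded j (s₀ ℕ.* ℓ) λ y →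
        bounded-if (y ℕ.<? x) (λ _ → K≤v (just (b ℕ.∸ ℓ)))
          (λ _ → challenge-bounded fuel i j (b ℕ.∸ ℓ) (suc ℓ) K≤v))
      (λ _ → K≤v nothing)

    module _ {Top : Fin n → Set} (separation : Separation p Top) where
      open Separation separation hiding (a; a′; b; b′; ab; a′b′)

      tosses-compared : ∀ {s} {mem : Vec (Fin n) s} i j {x x′ y y′} →
        value (p (lookup mem i)) * x′ + (1# - value (p (lookup mem i))) * x ≤ ρ →
        value (p (lookup mem j)) * y′ + (1# - value (p (lookup mem j))) * y ≤ ρ →
        0# ≤ x → 0# ≤ x′ → 0# ≤ y → 0# ≤ y′ →
        ∀ ℓ {K : ℕ → ℕ → Program R φ s} {v u} → 0# ≤ u →
        (∀ g h → g ℕ.≤ s₀ ℕ.* ℓ → h ℕ.≤ s₀ ℕ.* ℓ →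
          Bounded p c F mem (K g h)
            (v + u * (weight x x′ (s₀ ℕ.* ℓ) g + weight y y′ (s₀ ℕ.* ℓ) h))) →
        Bounded p c F mem (tosses i (s₀ ℕ.* ℓ) λ g → tosses j (s₀ ℕ.* ℓ) λ h → K g h)
          (v + u * (r ^ ℓ + r ^ ℓ))
      tosses-compared i j {x} {x′} {y} {y′} meanᵢ meanⱼ 0≤x 0≤x′ 0≤y 0≤y′ ℓ {K} {v} {u} 0≤u K≤ =
        bounded-≤
          (≤-reflexive (trans
            (solve 3 (λ v u r → (v :+ u :* r) :+ u :* r := v :+ u :* (r :+ r)) refl v u (ρ ^ m))
            (+-congˡ (*-congˡ (+-cong r^ℓ r^ℓ)))))
          (tosses-weighted i meanᵢ 0≤x 0≤x′ 0≤ρ m 0≤u λ g g≤m →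
            bounded-≤ (≤-reflexive (solve 4 (λ v u w r → (v :+ u :* w) :+ u :* r := (v :+ u :* r) :+ u :* w)
                refl v u (weight x x′ m g) (ρ ^ m)))
              (tosses-weighted j meanⱼ 0≤y 0≤y′ 0≤ρ m 0≤u λ h h≤m →
                bounded-≤ (≤-reflexive (solve 4 (λ v u w w′ → v :+ u :* (w :+ w′) := (v :+ u :* w) :+ u :* w′)
                    refl v u (weight x x′ m g) (weight y y′ m h)))
                  (K≤ g h g≤m h≤m)))
        where
        m = s₀ ℕ.* ℓ
        r^ℓ : ρ ^ m ≈ r ^ ℓ
        r^ℓ = sym (^-assocʳ ρ s₀ ℓ)

      -- Markov's inequality: a comparison that the king does not win forces one of the two weights
      -- to at least 1, so the extra cost `u` is charged to their sum, whose mean is at most 2 r^ℓ.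
      compare-topKing : ∀ {s} {mem : Vec (Fin n) s} i j →
        Top (lookup mem i) → ¬ Top (lookup mem j) → ∀ ℓ {K : ℕ → ℕ → Program R φ s} {v u} → 0# ≤ u →
        (∀ g h → h ℕ.< g → Bounded p c F mem (K g h) v) →
        (∀ g h → Bounded p c F mem (K g h) (v + u)) →
        Bounded p c F mem (tosses i (s₀ ℕ.* ℓ) λ g → tosses j (s₀ ℕ.* ℓ) λ h → K g h)
          (v + u * (r ^ ℓ + r ^ ℓ))
      compare-topKing {mem = mem} i j topᵢ ¬topⱼ ℓ {K} {v} {u} 0≤u good bad =
        tosses-compared i j (top-mean _ topᵢ) (other-mean _ ¬topⱼ) 0≤a 0≤a′ 0≤b 0≤b′ ℓ 0≤u estimate
        where
        m = s₀ ℕ.* ℓ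
        estimate : ∀ g h → g ℕ.≤ m → h ℕ.≤ m →
                Bounded p c F mem (K g h) (v + u * (topWeight m g + otherWeight m h))
        estimate g h g≤m h≤m with h ℕ.<? g
        ... | yes h<g = bounded-≤ (x≤x+y (0≤* 0≤u (0≤+ (0≤topWeight m g) (0≤otherWeight m h))))
                          (good g h h<g)
        ... | no  h≮g = bounded-≤ (+-monoʳ-≤ v (≤-trans (≤-reflexive (sym (*-identityʳ u)))
                            (*-monoˡ-≤ 0≤u (misranked (ℕ.≮⇒≥ h≮g) h≤m
                              (x≤x+y (0≤otherWeight m h)) (x≤y+x (0≤topWeight m g))))))
                          (bad g h)

      -- The mirror image, except that a tie now counts as good: the king wins only with strictly
      -- more heads.
      compare-topNewcomer : ∀ {s} {mem : Vec (Fin n) s} i j →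
        ¬ Top (lookup mem i) → Top (lookup mem j) → ∀ ℓ {K : ℕ → ℕ → Program R φ s} {v u} → 0# ≤ u →
        (∀ g h → g ℕ.≤ h → Bounded p c F mem (K g h) v) →
        (∀ g h → Bounded p c F mem (K g h) (v + u)) →
        Bounded p c F mem (tosses i (s₀ ℕ.* ℓ) λ g → tosses j (s₀ ℕ.* ℓ) λ h → K g h)
          (v + u * (r ^ ℓ + r ^ ℓ))
      compare-topNewcomer {mem = mem} i j ¬topᵢ topⱼ ℓ {K} {v} {u} 0≤u good bad =
        tosses-compared i j (other-mean _ ¬topᵢ) (top-mean _ topⱼ) 0≤b 0≤b′ 0≤a 0≤a′ ℓ 0≤u estimate
        where
        m = s₀ ℕ.* ℓ
        estimate : ∀ g h → g ℕ.≤ m → h ℕ.≤ m →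
                Bounded p c F mem (K g h) (v + u * (otherWeight m g + topWeight m h))
        estimate g h g≤m h≤m with g ℕ.≤? h
        ... | yes g≤h = bounded-≤ (x≤x+y (0≤* 0≤u (0≤+ (0≤otherWeight m g) (0≤topWeight m h))))
                          (good g h g≤h)
        ... | no  g≰h = bounded-≤ (+-monoʳ-≤ v (≤-trans (≤-reflexive (sym (*-identityʳ u)))
                            (*-monoˡ-≤ 0≤u (misranked (ℕ.<⇒≤ (ℕ.≰⇒> g≰h)) g≤m
                              (x≤y+x (0≤otherWeight m g)) (x≤x+y (0≤topWeight m h))))))
                          (bad g h)

      module _ (calibration : Calibration r) where
        open Calibration calibration hiding (0≤r)

        -- The chance that a top king with budget b loses, from level ℓ on, to a coin
        -- that is not a top coin; θ ^ b is the potential of an unchallenged king.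
        challenge-topKing : ∀ {s} {mem : Vec (Fin n) s} i j →
          Top (lookup mem i) → ¬ Top (lookup mem j) →
          ∀ fuel b ℓ {K : Maybe ℕ → Program R φ s} → b ℕ.≤ fuel →
          (∀ b → Bounded p c F mem (K (just b)) (θ ^ b)) → Bounded p c F mem (K nothing) 1# →
          Bounded p c F mem (challenge fuel i j b (suc ℓ) K)
            (θ ^ b * ϑ ^ suc ℓ + θ ^ b * ϑ ^ suc ℓ)
        challenge-topKing i j topᵢ ¬topⱼ zero b ℓ b≤0 win lose =
          -- Without fuel the budget is 0, so the claimed bound is at least 1 and covers a certain
          -- loss.
          bounded-≤ (≤-trans (1≤θ^ϑ^ {b} {suc ℓ} (ℕ.≤-trans b≤0 ℕ.z≤n))
            (x≤x+y (0≤* (0≤^ 0≤θ b) (0≤^ 0≤ϑ (suc ℓ))))) lose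
        challenge-topKing {mem = mem} i j topᵢ ¬topⱼ (suc fuel) b ℓ {K} b≤fuel win lose =
          bounded-if (suc ℓ ℕ.≤? b) continue
            (λ ℓ≰b → bounded-≤ (≤-trans (1≤θ^ϑ^ (ℕ.<⇒≤ (ℕ.≰⇒> ℓ≰b)))
              (x≤x+y (0≤* (0≤^ 0≤θ b) (0≤^ 0≤ϑ (suc ℓ))))) lose)
          where
          b′ = b ℕ.∸ suc ℓ
          x = θ ^ b′
          y = x * ϑ ^ suc (suc ℓ)
          0≤x : 0# ≤ x
          0≤x = 0≤^ 0≤θ b′
          0≤2y : 0# ≤ y + y
          0≤2y = 0≤+ 0≤y 0≤y
            where
            0≤y : 0# ≤ y
            0≤y = 0≤* 0≤x (0≤^ 0≤ϑ (suc (suc ℓ)))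
          next : Bounded p c F mem (challenge fuel i j b′ (suc (suc ℓ)) K) (y + y)
          next = challenge-topKing i j topᵢ ¬topⱼ fuel b′ (suc ℓ)
            (ℕ.≤-trans (ℕ.∸-monoˡ-≤ (suc ℓ) b≤fuel) (ℕ.m∸n≤m fuel ℓ)) win lose
          continue : suc ℓ ℕ.≤ b → Bounded p c F mem _ (θ ^ b * ϑ ^ suc ℓ + θ ^ b * ϑ ^ suc ℓ)
          -- Winning leaves the potential `x` of the remaining budget, and the chance of going on
          -- costs at most as much again. This is why the bound has two equal summands.
          continue ℓ≤b = bounded-≤
            (≤-trans (+-monoʳ-≤ x (level-decay x ℓ 0≤x))
              (≤-reflexive (sym (+-cong (θ^ϑ^ ℓ≤b) (θ^ϑ^ ℓ≤b)))))
            (compare-topKing i j topᵢ ¬topⱼ (suc ℓ) 0≤2y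
              (λ g h h<g → bounded-if (h ℕ.<? g) (λ _ → win b′) (λ h≮g → ⊥-elim (h≮g h<g)))
              (λ g h → bounded-if (h ℕ.<? g) (λ _ → bounded-≤ (x≤x+y 0≤2y) (win b′))
                (λ _ → bounded-≤ (x≤y+x 0≤x) next)))

        -- Losing at level ℓ has chance at most 2 r^ℓ, and the later levels add at most as much,
        -- since 2r ≤ 1. A king out of budget or fuel is deposed, which is the desired outcome with
        -- cost `v`.
        challenge-topNewcomer : ∀ {s} {mem : Vec (Fin n) s} i j →
          ¬ Top (lookup mem i) → Top (lookup mem j) →
          ∀ fuel b ℓ {K : Maybe ℕ → Program R φ s} {v} → 0# ≤ v →
          (∀ b → Bounded p c F mem (K (just b)) 1#) → Bounded p c F mem (K nothing) v →
          Bounded p c F mem (challenge fuel i j b ℓ K) (v + (r ^ ℓ + r ^ ℓ + (r ^ ℓ + r ^ ℓ)))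
        challenge-topNewcomer i j ¬topᵢ topⱼ zero b ℓ 0≤v win lose =
          bounded-≤ (x≤x+y (0≤+ (0≤+ 0≤r^ 0≤r^) (0≤+ 0≤r^ 0≤r^))) lose
          where
          0≤r^ : 0# ≤ r ^ ℓ
          0≤r^ = 0≤^ 0≤r ℓ
        challenge-topNewcomer {mem = mem} i j ¬topᵢ topⱼ (suc fuel) b ℓ {K} {v} 0≤v win lose =
          bounded-if (ℓ ℕ.≤? b) continue
            (λ _ → bounded-≤ (x≤x+y (0≤+ (0≤+ 0≤x 0≤x) (0≤+ 0≤x 0≤x))) lose)
          where
          x = r ^ ℓ
          0≤x : 0# ≤ x
          0≤x = 0≤^ 0≤r ℓ
          y = r ^ suc ℓ
          w = v + (y + y + (y + y))
          0≤w : 0# ≤ w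
          0≤w = 0≤+ 0≤v (0≤+ (0≤+ 0≤y 0≤y) (0≤+ 0≤y 0≤y))
            where
            0≤y : 0# ≤ y
            0≤y = 0≤^ 0≤r (suc ℓ)
          next : Bounded p c F mem (challenge fuel i j (b ℕ.∸ ℓ) (suc ℓ) K) w
          next = challenge-topNewcomer i j ¬topᵢ topⱼ fuel (b ℕ.∸ ℓ) (suc ℓ) 0≤v win lose
          halved : y + y + (y + y) ≤ x + x
          halved = ≤-trans
            (≤-reflexive (solve 2 (λ r x → r :* x :+ r :* x :+ (r :* x :+ r :* x) :=
              (r :+ r) :* (x :+ x)) refl r x))
            (≤-trans (*-monoʳ-≤ (0≤+ 0≤x 0≤x) 2r≤1) (≤-reflexive (*-identityˡ (x + x))))
          continue : ℓ ℕ.≤ b → Bounded p c F mem _ (v + (x + x + (x + x)))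
          continue _ = bounded-≤
            (≤-trans (+-monoˡ-≤ _ (+-monoʳ-≤ v halved))
              (≤-reflexive (trans (+-congˡ (*-identityˡ (x + x))) (+-assoc v (x + x) (x + x)))))
            (compare-topNewcomer i j ¬topᵢ topⱼ ℓ {v = w} {u = 1#} 0≤1
              (λ g h g≤h → bounded-if (h ℕ.<? g) (λ h<g → ⊥-elim (ℕ.<⇒≱ h<g g≤h)) (λ _ → next))
              (λ g h → bounded-if (h ℕ.<? g) (λ _ → bounded-≤ (x≤y+x 0≤w) (win (b ℕ.∸ ℓ)))
                (λ _ → bounded-≤ (x≤x+y 0≤1) next)))

-- Pairing kings with newcomers.

-- Concerns only the positions present in both lists, which are those where `fights` compares.
Paired : ∀ {A : Set} → (A → A → Set) → List A → List A → Set
Paired P (x ∷ xs) (y ∷ ys) = P x y × Paired P xs ys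
Paired P _        _        = ⊤

paired-all : ∀ {A : Set} {P : A → A → Set} {Q S : A → Set} {xs ys} →
  (∀ {x y} → Q x → S y → P x y) → All Q xs → All S ys → Paired P xs ys
paired-all f []         _          = tt
paired-all f (_  ∷ _)   []         = tt
paired-all f (qx ∷ qxs) (sy ∷ sys) = f qx sy , paired-all f qxs sys

paired-zip : ∀ {A : Set} {P O : A → A → Set} {Q S : A → Set} {xs ys} →
  (∀ {x y} → Q x → S y → O x y → P x y) → All Q xs → All S ys → Paired O xs ys → Paired P xs ys
paired-zip f []         _          _        = tt
paired-zip f (_  ∷ _)   []         _        = tt
paired-zip f (qx ∷ qxs) (sy ∷ sys) (o , os) = f qx sy o , paired-zip f qxs sys os

-- Kings in ascending and newcomers in descending order of their heads: a pair of
-- two top coins would force more top coins than there are kings.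
module _ {A : Set} (f : A → ℕ) {T : A → Set} (T? : Decidable T)
         (ranked : ∀ {x y} → T x → ¬ T y → f y ℕ.< f x) where

  private
    count : List A → ℕ
    count xs = length (List.filter T? xs)

  count-none : ∀ {xs} → count xs ℕ.≤ 0 → All (λ x → ¬ T x) xs
  count-none {[]}     _ = []
  count-none {x ∷ xs} n with T? x
  ... | no ¬t = ¬t ∷ count-none n
  count-none {x ∷ xs} () | yes t

  matched : ∀ {xs ys} → AllPairs (λ x x′ → f x ℕ.≤ f x′) xs → AllPairs (λ y y′ → f y′ ℕ.≤ f y) ys →
    count xs ℕ.+ count ys ℕ.≤ length xs → Paired (λ x y → ¬ (T x × T y)) xs ys
  matched {[]}               _          _          _  = tt
  matched {x ∷ xs} {[]}      _          _          _  = tt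
  matched {x ∷ xs} {y ∷ ys} (x≤ ∷ xs↗) (≤y ∷ ys↘) le with T? x
  -- The king with the fewest heads is a top coin, so all kings are, and the count leaves no top
  -- coin among the newcomers.
  ... | yes tx = paired-all (λ _ ¬ty → λ t → ¬ty (proj₂ t)) (All.universal (λ _ → tt) (x ∷ xs))
      (count-none (ℕ.+-cancelˡ-≤ (length xs) _ _ (≡.subst₂ ℕ._≤_
        (≡.cong (λ zs → length zs ℕ.+ count (y ∷ ys)) (List.filter-all T? allT))
        (≡.sym (ℕ.+-identityʳ (length xs))) (ℕ.s≤s⁻¹ le))))
    where
    allT : All T xs
    allT = All.map (λ {x′} x≤x′ → stable x′ x≤x′) x≤
      where
      stable : ∀ x′ → f x ℕ.≤ f x′ → T x′
      stable x′ x≤x′ with T? x′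
      ... | yes t  = t
      ... | no  ¬t = ⊥-elim (ℕ.<⇒≱ (ranked tx ¬t) x≤x′)
  ... | no ¬tx with T? y
  ...   | yes ty = (λ t → ¬tx (proj₁ t)) ,
          matched xs↗ ys↘ (ℕ.s≤s⁻¹ (≡.subst (ℕ._≤ suc (length xs)) (ℕ.+-suc (count xs) (count ys)) le))
  -- The newcomer with the most heads is not a top coin, so none of them is.
  ...   | no ¬ty = (λ t → ¬tx (proj₁ t)) ,
          paired-all (λ _ ¬ty → λ t → ¬ty (proj₂ t)) (All.universal (λ _ → tt) xs)
            (All.map (λ {y′} y′≤y ty′ → ℕ.<⇒≱ (ranked ty′ ¬ty) y′≤y) ≤y)

-- The fights of one round, followed from the slot of a fixed top coin.

module Fights (ℝ : RealNumbers) (k s₀ : ℕ) where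
  open OrderedField ℝ
  open Expectation ℝ
  open Algorithm ℝ k s₀
  open Challenge ℝ k s₀

  module _ {n : ℕ} {p : Fin n → UnitInterval} {R : ℕ → Set} {φ : Phase} {c : Coin φ n}
           {F : Config n R → Carrier} {Top : Fin n → Set} (separation : Separation p Top) where
    open Separation separation using (r)

    module _ (calibration : Calibration r) where
      open Calibration calibration

      fights-bounded : ∀ {s} {mem : Vec (Fin n) s} hs is js st {K : Status s → Program R φ s} {v} →
        (∀ st → Bounded p c F mem (K st) v) → Bounded p c F mem (fights hs is js st K) v
      fights-bounded hs []       js       st K≤ = K≤ st
      fights-bounded hs (i ∷ is) []       st K≤ = K≤ st
      fights-bounded hs (i ∷ is) (j ∷ js) st K≤ = bounded-if (lookup hs i ℕ.<? lookup hs j)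
        (λ _ → challenge-bounded (budget st i) i j (budget st i) 1
          λ o → fights-bounded hs is js (settle i j st o) K≤)
        (λ _ → fights-bounded hs is js st K≤)

      module _ {s : ℕ} {mem : Vec (Fin n) s} (hs : Vec ℕ s) (l : Fin s) {K : Status s → Program R φ s}
               (K≤ : ∀ st → Bounded p c F mem (K st) (potential (lookup st l))) where

        K≤1 : ∀ st → Bounded p c F mem (K st) 1#
        K≤1 st = bounded-≤ (potential≤1 (lookup st l)) (K≤ st)

        Unchallenged : Fin s → Fin s → Set
        Unchallenged i j = l ≢ j × (l ≡ i → lookup hs j ℕ.≤ lookup hs i)

        fights-unchallenged : ∀ is js st {o} → lookup st l ≡ o → Paired Unchallenged is js →
          Bounded p c F mem (fights hs is js st K) (potential o)
        fights-unchallenged []       js       st ≡.refl _ = K≤ st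
        fights-unchallenged (i ∷ is) []       st ≡.refl _ = K≤ st
        fights-unchallenged (i ∷ is) (j ∷ js) st eq ((l≢j , quiet) , rest) =
          bounded-if (lookup hs i ℕ.<? lookup hs j)
            (λ hᵢ<hⱼ → challenge-bounded (budget st i) i j (budget st i) 1 λ o →
              fights-unchallenged is js (settle i j st o)
                (≡.trans (settle-other st o (λ l≡i → ℕ.<⇒≱ hᵢ<hⱼ (quiet l≡i)) l≢j) eq) rest)
            (λ _ → fights-unchallenged is js st eq rest)

        -- Nothing is assumed about the ranking: this is the price of a misranked round without top
        -- newcomers. The kings being distinct, the coin fights at most once, and against a coin
        -- that is not a top coin.
        fights-topKing : ∀ is js st {b} → Top (lookup mem l) → lookup st l ≡ just b →
          Unique is → All (λ j → l ≢ j × ¬ Top (lookup mem j)) js →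
          Bounded p c F mem (fights hs is js st K) (θ ^ b * ϑ ^ 1 + θ ^ b * ϑ ^ 1)
        fights-topKing is js st {b} top eq unique others = go is js st eq unique others
          where
          v = θ ^ b * ϑ ^ 1 + θ ^ b * ϑ ^ 1
          θ^b≤v : θ ^ b ≤ v
          θ^b≤v = ≤-trans (≤-trans (≤-reflexive (sym (*-identityʳ (θ ^ b))))
            (*-monoˡ-≤ (0≤^ 0≤θ b) (1≤ϑ^ 1))) (x≤x+y (0≤* (0≤^ 0≤θ b) (0≤^ 0≤ϑ 1)))
          go : ∀ is js st → lookup st l ≡ just b → Unique is →
            All (λ j → l ≢ j × ¬ Top (lookup mem j)) js → Bounded p c F mem (fights hs is js st K) v
          go []       js       st eq _ _ =
            bounded-≤ (≤-trans (≤-reflexive (reflexive (≡.cong potential eq))) θ^b≤v) (K≤ st)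
          go (i ∷ is) []       st eq _ _ =
            bounded-≤ (≤-trans (≤-reflexive (reflexive (≡.cong potential eq))) θ^b≤v) (K≤ st)
          go (i ∷ is) (j ∷ js) st eq (i∉is ∷ unique) ((l≢j , ¬topⱼ) ∷ others) =
            bounded-if (lookup hs i ℕ.<? lookup hs j) (λ _ → fight (i Fin.≟ l))
              (λ _ → go is js st eq unique others)
            where
            fight : Dec (i ≡ l) → Bounded p c F mem
              (challenge (budget st i) i j (budget st i) 1 λ o → fights hs is js (settle i j st o) K) v
            fight (yes ≡.refl) rewrite eq =
              challenge-topKing separation calibration i j top ¬topⱼ b b 0 ℕ.≤-refl
                (λ b′ → fights-unchallenged is js (settle i j st (just b′)) (lookup∘update i st _)
                  (paired-all (λ i≢i′ l≢j′ → l≢j′ , λ i≡i′ → ⊥-elim (i≢i′ i≡i′)) i∉is (All.map proj₁ others)))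
                (fights-bounded hs is js (settle i j st nothing) K≤1)
            fight (no i≢l) = challenge-bounded (budget st i) i j (budget st i) 1 λ o →
              go is js (settle i j st o)
                (≡.trans (settle-other st o (λ l≡i → i≢l (≡.sym l≡i)) l≢j) eq) unique others

        Ahead : Fin s → Fin s → Set
        Ahead i j = l ≡ j → lookup hs i ℕ.< lookup hs j × ¬ Top (lookup mem i)

        -- The comparison of lengths guarantees the newcomer a king to face. Having deposed it, the
        -- newcomer holds one unit of budget, hence the term `θ ^ 1`.
        fights-topNewcomer : ∀ is js st → Top (lookup mem l) → l ∈ js →
          length js ℕ.≤ length is → All (l ≢_) is → Unique js → Paired Ahead is js →
          Bounded p c F mem (fights hs is js st K) (θ ^ 1 + (r ^ 1 + r ^ 1 + (r ^ 1 + r ^ 1)))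
        fights-topNewcomer [] (j ∷ js) st top l∈js ()
        fights-topNewcomer (i ∷ is) (j ∷ js) st top (here ≡.refl) _ (l≢i ∷ l∉is) (l∉js ∷ _)
          (ahead , _) = bounded-if (lookup hs i ℕ.<? lookup hs l)
            (λ _ → challenge-topNewcomer separation calibration i l (proj₂ (ahead ≡.refl)) top
              (budget st i) (budget st i) 1 (0≤^ 0≤θ 1)
              (λ b → fights-bounded hs is js _ K≤1)
              (fights-unchallenged is js _ (lookup∘update l (st [ i ]≔ nothing) (just 1))
                (paired-all (λ l≢i l≢j → l≢j , λ l≡i → ⊥-elim (l≢i l≡i)) l∉is l∉js)))
            (λ h≮h → ⊥-elim (h≮h (proj₁ (ahead ≡.refl))))
        fights-topNewcomer (i ∷ is) (j ∷ js) st top (there l∈js) len (l≢i ∷ l∉is) (j∉js ∷ unique)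
          (_ , rest) = bounded-if (lookup hs i ℕ.<? lookup hs j)
            (λ _ → challenge-bounded (budget st i) i j (budget st i) 1 λ o →
              fights-topNewcomer is js (settle i j st o) top l∈js (ℕ.s≤s⁻¹ len) l∉is unique rest)
            (λ _ → fights-topNewcomer is js st top l∈js (ℕ.s≤s⁻¹ len) l∉is unique rest)

-- One whole round: ranking, fights and discarding.

Unique-resp-↭ : ∀ {A : Set} {xs ys : List A} → xs ↭ ys → Unique xs → Unique ys
Unique-resp-↭ Permutation.refl         u = u
Unique-resp-↭ (Permutation.prep x xs↭ys) (x∉ ∷ u) = All-resp-↭ xs↭ys x∉ ∷ Unique-resp-↭ xs↭ys u
Unique-resp-↭ (Permutation.swap x y xs↭ys) ((x≢y ∷ x∉) ∷ y∉ ∷ u) =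
  ((λ y≡x → x≢y (≡.sym y≡x)) ∷ All-resp-↭ xs↭ys y∉) ∷ All-resp-↭ xs↭ys x∉ ∷ Unique-resp-↭ xs↭ys u
Unique-resp-↭ (Permutation.trans p q)  u = Unique-resp-↭ q (Unique-resp-↭ p u)

lookup-removeAt : ∀ {A : Set} {n} (xs : Vec A (suc n)) i j →
                  lookup (removeAt xs i) j ≡ lookup xs (punchIn i j)
lookup-removeAt (x ∷ xs)         zero    j       = ≡.refl
lookup-removeAt (x ∷ xs@(_ ∷ _)) (suc i) zero    = ≡.refl
lookup-removeAt (x ∷ xs@(_ ∷ _)) (suc i) (suc j) = lookup-removeAt xs i j

Distinct : ∀ {A : Set} {s} → Vec A s → Set
Distinct v = ∀ {i j} → lookup v i ≡ lookup v j → i ≡ j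

distinct-removeAt : ∀ {A : Set} {n} (xs : Vec A (suc n)) i → Distinct xs → Distinct (removeAt xs i)
distinct-removeAt xs i distinct {j} {j′} eq = Fin.punchIn-injective i j j′
  (distinct (≡.trans (≡.sym (lookup-removeAt xs i j)) (≡.trans eq (lookup-removeAt xs i j′))))

length-filter-¬ : ∀ {A : Set} {P : A → Set} (P? : Decidable P) xs →
  length (List.filter (λ x → ¬? (P? x)) xs) ℕ.+ length (List.filter P? xs) ≡ length xs
length-filter-¬ P? []       = ≡.refl
length-filter-¬ P? (x ∷ xs) with does (P? x)
... | true  = ≡.trans (ℕ.+-suc _ _) (≡.cong suc (length-filter-¬ P? xs))
... | false = ≡.cong suc (length-filter-¬ P? xs)

kings+newcomers : ∀ {s} (st : Status s) → length (kings st) ℕ.+ length (newcomers st) ≡ s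
kings+newcomers {s} st = ≡.trans (length-filter-¬ (newcomer? st) (List.allFin s))
  (List.length-tabulate (λ i → i))

module Culling (ℝ : RealNumbers) (k s₀ : ℕ) where
  open OrderedField ℝ
  open Solver using (solve; _:+_; _:*_; _:=_; con)
  open Expectation ℝ
  open Algorithm ℝ k s₀
  open Challenge ℝ k s₀
  open Fights ℝ k s₀

  module _ {n : ℕ} {p : Fin n → UnitInterval} {R : ℕ → Set} {φ : Phase} {c : Coin φ n}
           {F : Config n R → Carrier} {Top : Fin n → Set} (Top? : Decidable Top)
           (separation : Separation p Top) where
    open Separation separation using (r; ρ; 0≤r; 0≤ρ; a; a′; b; b′; 0≤a; 0≤a′; 0≤b; 0≤b′;
      topWeight; otherWeight; 0≤topWeight; 0≤otherWeight; top-mean; other-mean; misranked)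

    -- Choosing the weight by the kind of the coin makes its mean at most `r` for every coin.
    headsWeight : Fin n → ℕ → Carrier
    headsWeight x h = if does (Top? x) then topWeight s₀ h else otherWeight s₀ h

    0≤headsWeight : ∀ x h → 0# ≤ headsWeight x h
    0≤headsWeight x h with does (Top? x)
    ... | true  = 0≤topWeight s₀ h
    ... | false = 0≤otherWeight s₀ h

    headsWeight-top : ∀ {x} h → Top x → headsWeight x h ≡ topWeight s₀ h
    headsWeight-top {x} h top with Top? x
    ... | yes _   = ≡.refl
    ... | no ¬top = ⊥-elim (¬top top)

    headsWeight-other : ∀ {x} h → ¬ Top x → headsWeight x h ≡ otherWeight s₀ h
    headsWeight-other {x} h ¬top with Top? x
    ... | yes top = ⊥-elim (¬top top)
    ... | no _    = ≡.refl

    tosses-headsWeight : ∀ {s} {mem : Vec (Fin n) s} i {K : ℕ → Program R φ s} {v u} → 0# ≤ u →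
      (∀ h → h ℕ.≤ s₀ → Bounded p c F mem (K h) (v + u * headsWeight (lookup mem i) h)) →
      Bounded p c F mem (tosses i s₀ K) (v + u * r)
    tosses-headsWeight {mem = mem} i 0≤u K≤ with Top? (lookup mem i)
    ... | yes top = tosses-weighted i (top-mean _ top) 0≤a 0≤a′ 0≤ρ s₀ 0≤u K≤
    ... | no ¬top = tosses-weighted i (other-mean _ ¬top) 0≤b 0≤b′ 0≤ρ s₀ 0≤u K≤

    totalWeight : ∀ {s m} → Vec (Fin n) s → Vec (Fin s) m → Vec ℕ m → Carrier
    totalWeight mem []       []       = 0#
    totalWeight mem (i ∷ is) (h ∷ hs) = headsWeight (lookup mem i) h + totalWeight mem is hs

    0≤totalWeight : ∀ {s m} (mem : Vec (Fin n) s) (is : Vec (Fin s) m) hs → 0# ≤ totalWeight mem is hs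
    0≤totalWeight mem []       []       = ≤-refl
    0≤totalWeight mem (i ∷ is) (h ∷ hs) =
      0≤+ (0≤headsWeight (lookup mem i) h) (0≤totalWeight mem is hs)

    headsWeight≤totalWeight : ∀ {s m} (mem : Vec (Fin n) s) (is : Vec (Fin s) m) hs l →
      headsWeight (lookup mem (lookup is l)) (lookup hs l) ≤ totalWeight mem is hs
    headsWeight≤totalWeight mem (i ∷ is) (h ∷ hs) zero    = x≤x+y (0≤totalWeight mem is hs)
    headsWeight≤totalWeight mem (i ∷ is) (h ∷ hs) (suc l) =
      ≤-trans (headsWeight≤totalWeight mem is hs l) (x≤y+x (0≤headsWeight (lookup mem i) h))

    -- The union bound over the stored coins: their weights are added, so the means add up to `m`
    -- times `r`.
    tossAll-weighted : ∀ {s m} {mem : Vec (Fin n) s} (is : Vec (Fin s) m)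
      {K : Vec ℕ m → Program R φ s} {v u} → 0# ≤ u →
      (∀ hs → (∀ l → lookup hs l ℕ.≤ s₀) → Bounded p c F mem (K hs) (v + u * totalWeight mem is hs)) →
      Bounded p c F mem (tossAll is K) (v + u * (fromℕ m * r))
    tossAll-weighted []       0≤u K≤ =
      bounded-≤ (≤-reflexive (+-congˡ (*-congˡ (sym (zeroˡ r))))) (K≤ [] λ ())
    tossAll-weighted {m = suc m} {mem} (i ∷ is) {K} {v} {u} 0≤u K≤ = bounded-≤
      (≤-reflexive (solve 4 (λ v u r x → (v :+ u :* (x :* r)) :+ u :* r := v :+ u :* ((con 1 :+ x) :* r))
        refl v u r (fromℕ m)))
      (tosses-headsWeight i 0≤u λ h h≤s₀ → bounded-≤
        (≤-reflexive (solve 4 (λ v u w x → (v :+ u :* w) :+ u :* x := (v :+ u :* x) :+ u :* w)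
          refl v u (headsWeight (lookup mem i) h) (fromℕ m * r)))
        (tossAll-weighted is 0≤u λ hs hs≤s₀ → bounded-≤
          (≤-reflexive (solve 4 (λ v u w x → v :+ u :* (w :+ x) := (v :+ u :* w) :+ u :* x)
            refl v u (headsWeight (lookup mem i) h) (totalWeight mem is hs)))
          (K≤ (h ∷ hs) λ { zero → h≤s₀ ; (suc l) → hs≤s₀ l })))

    Ranked : ∀ {s} → Vec (Fin n) s → Vec ℕ s → Set
    Ranked mem hs = ∀ {i j} → Top (lookup mem i) → ¬ Top (lookup mem j) → lookup hs j ℕ.< lookup hs i

    -- A misranked pair has a weight of at least 1, and the total weight dominates each summand. So
    -- the mean of the total bounds the chance of a misranked round.
    ranked⊎heavy : ∀ {s} (mem : Vec (Fin n) s) (hs : Vec ℕ s) → (∀ l → lookup hs l ℕ.≤ s₀) →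
      Ranked mem hs ⊎ 1# ≤ totalWeight mem (Vec.allFin s) hs
    ranked⊎heavy {s} mem hs hs≤s₀ with Fin.any? (λ i → Fin.any? (λ j →
      Top? (lookup mem i) ×-dec (¬? (Top? (lookup mem j)) ×-dec (lookup hs i ℕ.≤? lookup hs j))))
    ... | no none = inj₁ λ {i} {j} top ¬top → ℕ.≰⇒> λ hᵢ≤hⱼ → none (i , j , top , ¬top , hᵢ≤hⱼ)
    ... | yes (i , j , top , ¬top , hᵢ≤hⱼ) = inj₂ (misranked hᵢ≤hⱼ (hs≤s₀ j)
      (≤-trans (≤-reflexive (reflexive (≡.trans (≡.sym (headsWeight-top (lookup hs i) top))
        (≡.cong (λ l → headsWeight (lookup mem l) (lookup hs i)) (≡.sym (lookup-allFin i))))))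
        (headsWeight≤totalWeight mem (Vec.allFin s) hs i))
      (≤-trans (≤-reflexive (reflexive (≡.trans (≡.sym (headsWeight-other (lookup hs j) ¬top))
        (≡.cong (λ l → headsWeight (lookup mem l) (lookup hs j)) (≡.sym (lookup-allFin j))))))
        (headsWeight≤totalWeight mem (Vec.allFin s) hs j)))

    tossAll-ranked : ∀ {s} {mem : Vec (Fin n) s} {K : Vec ℕ s → Program R φ s} {v u} → 0# ≤ u →
      (∀ hs → Ranked mem hs → Bounded p c F mem (K hs) v) →
      (∀ hs → Bounded p c F mem (K hs) (v + u)) →
      Bounded p c F mem (tossAll (Vec.allFin s) K) (v + u * (fromℕ s * r))
    tossAll-ranked {s} {mem} {K} {v} {u} 0≤u good bad = tossAll-weighted (Vec.allFin s) 0≤u estimate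
      where
      estimate : ∀ hs → (∀ l → lookup hs l ℕ.≤ s₀) →
        Bounded p c F mem (K hs) (v + u * totalWeight mem (Vec.allFin s) hs)
      estimate hs hs≤s₀ with ranked⊎heavy mem hs hs≤s₀
      ... | inj₁ ranked = bounded-≤ (x≤x+y (0≤* 0≤u (0≤totalWeight mem (Vec.allFin s) hs)))
                            (good hs ranked)
      ... | inj₂ heavy  = bounded-≤ (+-monoʳ-≤ v (≤-trans (≤-reflexive (sym (*-identityʳ u)))
                            (*-monoˡ-≤ 0≤u heavy))) (bad hs)

    module _ (calibration : Calibration r) where
      open Calibration calibration hiding (0≤r)

      -- Follows the coin `x` through the renumbering of slots. If `x` itself is discarded, its
      -- status is `nothing`, whose potential is already 1.
      compact-potential : ∀ {s} {mem : Vec (Fin n) s} {x} st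
        {K : ∀ {s} → Status s → Program R φ s} →
        (∀ {s} {mem : Vec (Fin n) s} st {l} → Distinct mem → lookup mem l ≡ x →
          Bounded p c F mem (K st) (potential (lookup st l))) →
        (∀ {s} {mem : Vec (Fin n) s} st → Bounded p c F mem (K st) 1#) →
        Distinct mem → ∀ {l} → lookup mem l ≡ x →
        Bounded p c F mem (compact st K) (potential (lookup st l))
      compact-potential {suc s} {mem} st {K} K≤ K≤1 distinct {l} at with Fin.any? (newcomer? st)
      ... | no _         = K≤ st distinct at
      ... | yes (i , eq) = discarded (i Fin.≟ l)
        where
        compact≤1 : ∀ {s} {mem : Vec (Fin n) s} st → Bounded p c F mem (compact st K) 1#
        compact≤1 {zero}  st = K≤1 st
        compact≤1 {suc s} st with Fin.any? (newcomer? st)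
        ... | no _        = K≤1 st
        ... | yes (i , _) = record { bound = compact≤1 (removeAt st i) .bound }
        discarded : Dec (i ≡ l) → Bounded p c F mem (discard i (compact (removeAt st i) K))
          (potential (lookup st l))
        discarded (yes ≡.refl) = bounded-≤
          (≤-reflexive (reflexive (≡.cong potential (≡.sym eq))))
          record { bound = compact≤1 (removeAt st i) .bound }
        discarded (no i≢l) = bounded-≤
          (≤-reflexive (reflexive (≡.cong potential (removeAt-punchOut st i≢l))))
          record { bound = compact-potential (removeAt st i) K≤ K≤1 (distinct-removeAt mem i distinct)
            (≡.trans (removeAt-punchOut mem i≢l) at) .bound }

      module _ {s : ℕ} {mem : Vec (Fin n) s} (distinct : Distinct mem) (s≤2k : s ℕ.≤ k ℕ.+ k)
        (few : ∀ (is : List (Fin s)) → Unique is → All (Top ∘ lookup mem) is → length is ℕ.≤ k)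
        (st : Status s) (full : length (kings st) ≡ k ⊎ newcomers st ≡ [])
        (l : Fin s) (top : Top (lookup mem l))
        {K : ∀ {s} → Status s → Program R φ s}
        (K≤ : ∀ {s} {mem′ : Vec (Fin n) s} st {i} → Distinct mem′ → lookup mem′ i ≡ lookup mem l →
          Bounded p c F mem′ (K st) (potential (lookup st i)))
        (K≤1 : ∀ {s} {mem : Vec (Fin n) s} st → Bounded p c F mem (K st) 1#) where

        raised : Status s
        raised = Vec.map (Maybe.map suc) st

        K′≤ : ∀ st → Bounded p c F mem (compact st K) (potential (lookup st l))
        K′≤ st = compact-potential st K≤ K≤1 distinct ≡.refl

        is js : Vec ℕ s → List (Fin s)
        is hs = sort (ascending hs) (kings st)
        js hs = sort (descending hs) (newcomers st)

        unique-is : ∀ hs → Unique (is hs)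
        unique-is hs = Unique-resp-↭ (↭-sym (sort-↭ (ascending hs) (kings st)))
          (Unique.filter⁺ (king? st) (Unique.allFin⁺ s))

        unique-js : ∀ hs → Unique (js hs)
        unique-js hs = Unique-resp-↭ (↭-sym (sort-↭ (descending hs) (newcomers st)))
          (Unique.filter⁺ (newcomer? st) (Unique.allFin⁺ s))

        all-is : ∀ {P : Fin s → Set} hs → (∀ i → ¬ IsNewcomer st i → P i) → All P (is hs)
        all-is hs f = All-resp-↭ (↭-sym (sort-↭ (ascending hs) (kings st)))
          (All.map (λ {i} → f i) (All.all-filter (king? st) (List.allFin s)))

        all-js : ∀ {P : Fin s → Set} hs → (∀ j → IsNewcomer st j → P j) → All P (js hs)
        all-js hs f = All-resp-↭ (↭-sym (sort-↭ (descending hs) (newcomers st)))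
          (All.map (λ {j} → f j) (All.all-filter (newcomer? st) (List.allFin s)))

        length-is : ∀ hs → length (is hs) ≡ length (kings st)
        length-is hs = ↭-length (sort-↭ (ascending hs) (kings st))

        length-js : ∀ hs → length (js hs) ≡ length (newcomers st)
        length-js hs = ↭-length (sort-↭ (descending hs) (newcomers st))

        topSlot? : Decidable (Top ∘ lookup mem)
        topSlot? i = Top? (lookup mem i)

        few-pairs : ∀ hs → length (List.filter topSlot? (is hs)) ℕ.+ length (List.filter topSlot? (js hs)) ℕ.≤ k
        few-pairs hs = ≡.subst (ℕ._≤ k) (List.length-++ (List.filter topSlot? (is hs)))
          (few _ (Unique.++⁺ (Unique.filter⁺ topSlot? (unique-is hs)) (Unique.filter⁺ topSlot? (unique-js hs))
              (λ { {i} (i∈ , i∈′) → All.lookup (all-is hs λ _ king → king) (proj₁ (∈-filter⁻ topSlot? i∈))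
                (All.lookup (all-js hs λ _ new → new) (proj₁ (∈-filter⁻ topSlot? {xs = js hs} i∈′))) }))
            (All.++⁺ (All.all-filter topSlot? (is hs)) (All.all-filter topSlot? (js hs))))

        -- Kings and newcomers occupy different slots and together hold at most k top coins. With k
        -- kings this is the count that `matched` needs; without newcomers there is nothing to pair.
        matching : ∀ hs → Ranked mem hs →
          Paired (λ i j → ¬ (Top (lookup mem i) × Top (lookup mem j))) (is hs) (js hs)
        matching hs ranked = [ matchedByRank , unmatched ]′ full
          where
          matchedByRank : length (kings st) ≡ k → _
          matchedByRank kings≡k = matched (lookup hs) topSlot? (λ {i} {j} → ranked {i} {j})
            (Sorted⇒AllPairs (DecTotalOrder.totalOrder (ascending hs)) (sort-↗ (ascending hs) (kings st)))
            (Sorted⇒AllPairs (DecTotalOrder.totalOrder (descending hs)) (sort-↗ (descending hs) (newcomers st)))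
            (ℕ.≤-trans (few-pairs hs) (ℕ.≤-reflexive (≡.sym (≡.trans (length-is hs) kings≡k))))
          unmatched : newcomers st ≡ [] → Paired _ (is hs) (js hs)
          unmatched none = paired-all {Q = λ _ → ⊤} (λ _ new → ⊥-elim new)
            (All.universal (λ _ → tt) (is hs))
            (All-resp-↭ (↭-sym (sort-↭ (descending hs) (newcomers st))) (≡.subst (All _) (≡.sym none) []))

        cull-estimate : ∀ {v u} → 0# ≤ u →
          (∀ hs → Ranked mem hs →
            Bounded p c F mem (fights hs (is hs) (js hs) raised λ st → compact st K) v) →
          (∀ hs → Bounded p c F mem (fights hs (is hs) (js hs) raised λ st → compact st K) (v + u)) →
          Bounded p c F mem (cull st K) (v + u * (fromℕ (k ℕ.+ k) * r))
        cull-estimate {v} 0≤u good bad = bounded-≤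
          (+-monoʳ-≤ v (*-monoˡ-≤ 0≤u (*-monoʳ-≤ 0≤r (fromℕ-mono-≤ s≤2k))))
          (tossAll-ranked 0≤u good bad)

        fights≤1 : ∀ hs → Bounded p c F mem (fights hs (is hs) (js hs) raised λ st → compact st K) 1#
        fights≤1 hs = fights-bounded separation calibration hs (is hs) (js hs) raised
          λ st → bounded-≤ (potential≤1 (lookup st l)) (K′≤ st)

        -- A misranked round is written off entirely. In a ranked one the newcomer faces a king that
        -- is not a top coin and showed fewer heads.
        cull-topNewcomer : IsNewcomer st l →
          Bounded p c F mem (cull st K)
            (θ ^ 1 + (r ^ 1 + r ^ 1 + (r ^ 1 + r ^ 1)) + fromℕ (k ℕ.+ k) * r)
        cull-topNewcomer new = bounded-≤ (+-monoʳ-≤ _ (≤-reflexive (*-identityˡ _)))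
          (cull-estimate 0≤1 good (λ hs → bounded-≤ (x≤y+x 0≤v) (fights≤1 hs)))
          where
          0≤v : 0# ≤ θ ^ 1 + (r ^ 1 + r ^ 1 + (r ^ 1 + r ^ 1))
          0≤v = 0≤+ (0≤^ 0≤θ 1) (0≤+ (0≤+ (0≤^ 0≤r 1) (0≤^ 0≤r 1)) (0≤+ (0≤^ 0≤r 1) (0≤^ 0≤r 1)))
          l∈newcomers : l ∈ newcomers st
          l∈newcomers = ∈-filter⁺ (newcomer? st) (∈-allFin l) new
          newcomers≤kings : length (newcomers st) ℕ.≤ length (kings st)
          newcomers≤kings = [ (λ kings≡k → ≡.subst (length (newcomers st) ℕ.≤_) (≡.sym kings≡k)
              (ℕ.+-cancelˡ-≤ k _ _ (ℕ.≤-trans (ℕ.≤-reflexive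
                (≡.trans (≡.cong (ℕ._+ length (newcomers st)) (≡.sym kings≡k)) (kings+newcomers st))) s≤2k)))
            , (λ none → ℕ.≤-trans (ℕ.≤-reflexive (≡.cong length none)) ℕ.z≤n) ]′ full
          good : ∀ hs → Ranked mem hs →
            Bounded p c F mem (fights hs (is hs) (js hs) raised λ st → compact st K)
              (θ ^ 1 + (r ^ 1 + r ^ 1 + (r ^ 1 + r ^ 1)))
          good hs ranked = fights-topNewcomer separation calibration hs l K′≤ (is hs) (js hs) raised top
            (∈-resp-↭ (↭-sym (sort-↭ (descending hs) (newcomers st))) l∈newcomers)
            (≡.subst₂ ℕ._≤_ (≡.sym (length-js hs)) (≡.sym (length-is hs)) newcomers≤kings)
            (all-is hs λ { _ king ≡.refl → king new })
            (unique-js hs)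
            (paired-zip {Q = λ _ → ⊤} {S = λ _ → ⊤}
              (λ { _ _ unmatched ≡.refl → let ¬top = λ topᵢ → unmatched (topᵢ , top) in ranked top ¬top , ¬top })
              (All.universal (λ _ → tt) (is hs)) (All.universal (λ _ → tt) (js hs)) (matching hs ranked))

        module _ {b : ℕ} (king : lookup st l ≡ just b) where

          l≢newcomer : ∀ j → IsNewcomer st j → l ≢ j
          l≢newcomer j new ≡.refl with ≡.trans (≡.sym king) new
          ... | ()

          raised-l : lookup raised l ≡ just (suc b)
          raised-l = ≡.trans (lookup-map l (Maybe.map suc) st) (≡.cong (Maybe.map suc) king)

          fights-ranked : ∀ hs → Ranked mem hs →
            Bounded p c F mem (fights hs (is hs) (js hs) raised λ st → compact st K) (θ ^ suc b)
          fights-ranked hs ranked = fights-unchallenged separation calibration hs l K′≤ (is hs) (js hs) raised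
            raised-l
            (paired-zip {Q = λ _ → ⊤}
              (λ {i} {j} _ l≢j unmatched → l≢j , λ { ≡.refl →
                ℕ.<⇒≤ (ranked {i} {j} top λ topⱼ → unmatched (top , topⱼ)) })
              (All.universal (λ _ → tt) (is hs)) (all-js hs l≢newcomer) (matching hs ranked))

          θ^suc≤ : θ ^ suc b ≤ θ ^ b
          θ^suc≤ = ≤-trans (*-monoʳ-≤ (0≤^ 0≤θ b) θ≤1) (≤-reflexive (*-identityˡ _))

          -- Meant for rounds with top newcomers. A misranked one may pair two top coins, and no
          -- budget protects against an equally good coin, so the whole chance of a misranking is
          -- charged.
          cull-king : Bounded p c F mem (cull st K) (θ ^ b + fromℕ (k ℕ.+ k) * r)
          cull-king = bounded-≤ (+-mono-≤ θ^suc≤ (≤-reflexive (*-identityˡ _)))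
            (cull-estimate 0≤1 fights-ranked (λ hs → bounded-≤ (x≤y+x (0≤^ 0≤θ (suc b))) (fights≤1 hs)))

          -- There is no additive term, so such rounds may occur any number of times. A ranked round
          -- multiplies the potential by θ; a misranked one costs up to 2 θ^b, but its chance is at
          -- most 2kr.
          cull-king-noTop : (∀ j → IsNewcomer st j → ¬ Top (lookup mem j)) →
            Bounded p c F mem (cull st K) (θ ^ b)
          cull-king-noTop others = bounded-≤ total
            (cull-estimate (0≤+ (0≤^ 0≤θ b) (0≤^ 0≤θ b)) fights-ranked
              λ hs → bounded-≤ (≤-trans (≤-reflexive (+-cong reset reset)) (x≤y+x (0≤^ 0≤θ (suc b))))
                (fights-topKing separation calibration hs l K′≤ (is hs) (js hs) raised top raised-l (unique-is hs)
                  (all-js hs λ j new → l≢newcomer j new , others j new)))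
            where
            -- The unit earned in this round cancels the price of level 1.
            reset : θ ^ suc b * ϑ ^ 1 ≈ θ ^ b
            reset = θ^ϑ^ {suc b} {1} (ℕ.s≤s ℕ.z≤n)
            total : θ ^ suc b + (θ ^ b + θ ^ b) * (fromℕ (k ℕ.+ k) * r) ≤ θ ^ b
            total = ≤-trans
              (≤-reflexive (solve 4 (λ θ x m r → θ :* x :+ (x :+ x) :* (m :* r) := x :* (θ :+ m :* (r :+ r)))
                refl θ (θ ^ b) (fromℕ (k ℕ.+ k)) r))
              (≤-trans (*-monoˡ-≤ (0≤^ 0≤θ b) θ+r-small) (≤-reflexive (*-identityʳ (θ ^ b))))

-- Numbers of kings and newcomers, and their total budget.

module Statuses where
  open +-*-Solver using (solve; _:+_; _:=_; con)

  sumOf : ∀ {s} → (Maybe ℕ → ℕ) → Status s → ℕ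
  sumOf w []       = 0
  sumOf w (o ∷ st) = w o ℕ.+ sumOf w st

  swap-+ : ∀ a b c → a ℕ.+ b ℕ.+ c ≡ a ℕ.+ c ℕ.+ b
  swap-+ = solve 3 (λ a b c → a :+ b :+ c := a :+ c :+ b) ≡.refl

  -- Stated with a summand on either side, so that no truncated subtraction is involved.
  sumOf-update : ∀ {s} w (st : Status s) i o →
    sumOf w (st [ i ]≔ o) ℕ.+ w (lookup st i) ≡ sumOf w st ℕ.+ w o
  sumOf-update w (o′ ∷ st) zero    o =
    solve 3 (λ a b c → a :+ b :+ c := c :+ b :+ a) ≡.refl (w o) (sumOf w st) (w o′)
  sumOf-update w (o′ ∷ st) (suc i) o = ≡.trans (ℕ.+-assoc (w o′) _ _)
    (≡.trans (≡.cong (w o′ ℕ.+_) (sumOf-update w st i o)) (≡.sym (ℕ.+-assoc (w o′) _ _)))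

  sumOf-removeAt : ∀ {s} w (st : Status (suc s)) i → sumOf w (removeAt st i) ℕ.≤ sumOf w st
  sumOf-removeAt w (o ∷ st)           zero    = ℕ.m≤n+m (sumOf w st) (w o)
  sumOf-removeAt w (o ∷ st@(_ ∷ _))   (suc i) = ℕ.+-monoʳ-≤ (w o) (sumOf-removeAt w st i)

  isKing isNew : Maybe ℕ → ℕ
  isKing (just _) = 1
  isKing nothing  = 0
  isNew (just _)  = 0
  isNew nothing   = 1

  kingCount newCount totalBudget : ∀ {s} → Status s → ℕ
  kingCount   = sumOf isKing
  newCount    = sumOf isNew
  totalBudget = sumOf (fromMaybe 0)

  kingCount+newCount : ∀ {s} (st : Status s) → kingCount st ℕ.+ newCount st ≡ s
  kingCount+newCount []             = ≡.refl
  kingCount+newCount (just _ ∷ st)  = ≡.cong suc (kingCount+newCount st)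
  kingCount+newCount (nothing ∷ st) =
    ≡.trans (ℕ.+-suc (kingCount st) (newCount st)) (≡.cong suc (kingCount+newCount st))

  length-kings : ∀ {s} (st : Status s) → length (kings st) ≡ kingCount st
  length-kings st = count st (λ i → i) (king? st) (λ i → agree (lookup st i) (king? st i))
    where
    agree : ∀ o (d : Dec (¬ o ≡ nothing)) → (if does d then 1 else 0) ≡ isKing o
    agree (just _) (yes _) = ≡.refl
    agree nothing  (yes k) = ⊥-elim (k ≡.refl)
    agree (just _) (no ¬k) = ⊥-elim (¬k λ ())
    agree nothing  (no _)  = ≡.refl
    count : ∀ {s m} (st : Status s) (f : Fin s → Fin m) {P : Fin m → Set} (P? : Decidable P) →
      (∀ i → (if does (P? (f i)) then 1 else 0) ≡ isKing (lookup st i)) →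
      length (List.filter P? (List.tabulate f)) ≡ kingCount st
    count []       f P? eq = ≡.refl
    count (o ∷ st) f P? eq with does (P? (f zero)) | eq zero
    ... | true  | one = ≡.cong₂ ℕ._+_ one (count st (λ i → f (suc i)) P? (λ i → eq (suc i)))
    ... | false | nil = ≡.cong₂ ℕ._+_ nil (count st (λ i → f (suc i)) P? (λ i → eq (suc i)))

  length-newcomers : ∀ {s} (st : Status s) → length (newcomers st) ≡ newCount st
  length-newcomers st = ℕ.+-cancelˡ-≡ (kingCount st) _ _ (≡.trans
    (≡.cong (ℕ._+ length (newcomers st)) (≡.sym (length-kings st)))
    (≡.trans (kings+newcomers st) (≡.sym (kingCount+newCount st))))

  AllKings : ∀ {s} → Status s → Set
  AllKings st = ∀ i → ¬ IsNewcomer st i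

  allKings⇒newCount≡0 : ∀ {s} (st : Status s) → AllKings st → newCount st ≡ 0
  allKings⇒newCount≡0 []             _   = ≡.refl
  allKings⇒newCount≡0 (just _ ∷ st)  all = allKings⇒newCount≡0 st λ i → all (suc i)
  allKings⇒newCount≡0 (nothing ∷ st) all = ⊥-elim (all zero ≡.refl)

  allKings⇒kingCount : ∀ {s} (st : Status s) → AllKings st → kingCount st ≡ s
  allKings⇒kingCount st all = ≡.trans (≡.sym (ℕ.+-identityʳ _))
    (≡.trans (≡.cong (kingCount st ℕ.+_) (≡.sym (allKings⇒newCount≡0 st all))) (kingCount+newCount st))

  kingCount-raise : ∀ {s} (st : Status s) → kingCount (Vec.map (Maybe.map suc) st) ≡ kingCount st
  kingCount-raise []             = ≡.refl
  kingCount-raise (just _ ∷ st)  = ≡.cong suc (kingCount-raise st)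
  kingCount-raise (nothing ∷ st) = kingCount-raise st

  totalBudget-raise : ∀ {s} (st : Status s) →
    totalBudget (Vec.map (Maybe.map suc) st) ≡ totalBudget st ℕ.+ kingCount st
  totalBudget-raise []             = ≡.refl
  totalBudget-raise (just b ∷ st)  = ≡.trans (≡.cong (suc b ℕ.+_) (totalBudget-raise st))
    (solve 3 (λ b t c → con 1 :+ b :+ (t :+ c) := b :+ t :+ (con 1 :+ c)) ≡.refl
      b (totalBudget st) (kingCount st))
  totalBudget-raise (nothing ∷ st) = totalBudget-raise st

open Statuses

-- Amortised cost of a round.

module Invariants (ℝ : RealNumbers) (k s₀ : ℕ) where
  open OrderedField ℝ using (UnitInterval; Phase; Coin; Config; Program; Dist; Surely; exec;
    return; tossStored; bernoulli; arriving; ended; config)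
  open Expectation ℝ using (tosses)
  open Algorithm ℝ k s₀
  open +-*-Solver using (solve; _:+_; _:*_; _:=_; con)

  -- Tosses paid for by one unit of budget: s₀ of each coin of a pair.
  unit : ℕ
  unit = s₀ ℕ.+ s₀

  module _ {n : ℕ} {p : Fin n → UnitInterval} {R : ℕ → Set} {φ : Phase} {c : Coin φ n}
           {Q : Config n R → Set} {m : ℕ} where

    record Sure {s : ℕ} (mem : Vec (Fin n) s) (t : ℕ) (P : Program R φ s) : Set where
      constructor sure
      field surely : Surely Q (exec p P c mem t m)

    open Sure public

    sure-if : ∀ {s} {mem : Vec (Fin n) s} {t} {X : Set} (X? : Dec X) {P P′} →
      (X → Sure mem t P) → (¬ X → Sure mem t P′) → Sure mem t (if does X? then P else P′)
    sure-if (yes x) P P′ = P x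
    sure-if (no ¬x) P P′ = P′ ¬x

    tosses-sure : ∀ {s} {mem : Vec (Fin n) s} {t} i l {K : ℕ → Program R φ s} →
      (∀ h → Sure mem (t ℕ.+ l) (K h)) → Sure mem t (tosses i l K)
    tosses-sure {mem = mem} {t} i zero {K} sK = ≡.subst (λ t → Sure mem t (K 0)) (ℕ.+-identityʳ t) (sK 0)
    tosses-sure {mem = mem} {t} i (suc l) {K} sK = sure λ b → surely (tosses-sure i l λ h →
      ≡.subst (λ t → Sure mem t (K (if b then suc h else h))) (ℕ.+-suc t l) (sK _))

    tossAll-sure : ∀ {s l} {mem : Vec (Fin n) s} {t} (is : Vec (Fin s) l) {K : Vec ℕ l → Program R φ s} →
      (∀ hs → Sure mem (t ℕ.+ l ℕ.* s₀) (K hs)) → Sure mem t (tossAll is K)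
    tossAll-sure {mem = mem} {t} [] {K} sK = ≡.subst (λ t → Sure mem t (K [])) (ℕ.+-identityʳ t) (sK [])
    tossAll-sure {l = suc l} {mem} {t} (i ∷ is) {K} sK = tosses-sure i s₀ λ h → tossAll-sure is λ hs →
      ≡.subst (λ t → Sure mem t (K (h ∷ hs))) (≡.sym (ℕ.+-assoc t s₀ (l ℕ.* s₀))) (sK (h ∷ hs))

    -- Tosses made plus the value of the unspent budget never grow: level ℓ takes ℓ units and makes
    -- 2 s₀ ℓ tosses. A deposed king forfeits what it has left.
    challenge-sure : ∀ {s} {mem : Vec (Fin n) s} fuel i j b ℓ {t} {K : Maybe ℕ → Program R φ s} →
      (∀ o t′ → t′ ℕ.+ unit ℕ.* fromMaybe 0 o ℕ.≤ t ℕ.+ unit ℕ.* b → Sure mem t′ (K o)) →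
      Sure mem t (challenge fuel i j b ℓ K)
    challenge-sure zero i j b ℓ {t} sK = sK nothing t (ℕ.+-monoʳ-≤ t (ℕ.*-monoʳ-≤ unit ℕ.z≤n))
    challenge-sure {mem = mem} (suc fuel) i j b ℓ {t} {K} sK = sure-if (ℓ ℕ.≤? b)
      (λ ℓ≤b → tosses-sure i (s₀ ℕ.* ℓ) λ x → tosses-sure j (s₀ ℕ.* ℓ) λ y →
        sure-if (y ℕ.<? x)
          (λ _ → sK _ _ (ℕ.≤-reflexive (paid ℓ≤b)))
          (λ _ → challenge-sure fuel i j _ _ λ o t′ le →
            sK o t′ (ℕ.≤-trans le (ℕ.≤-reflexive (paid ℓ≤b)))))
      (λ _ → sK nothing t (ℕ.+-monoʳ-≤ t (ℕ.*-monoʳ-≤ unit ℕ.z≤n)))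
      where
      paid : ℓ ℕ.≤ b →
        t ℕ.+ s₀ ℕ.* ℓ ℕ.+ s₀ ℕ.* ℓ ℕ.+ unit ℕ.* (b ℕ.∸ ℓ) ≡ t ℕ.+ unit ℕ.* b
      paid ℓ≤b = ≡.trans
        (solve 4 (λ t s l d → t :+ s :* l :+ s :* l :+ (s :+ s) :* d := t :+ (s :+ s) :* (l :+ d))
          ≡.refl t s₀ ℓ (b ℕ.∸ ℓ))
        (≡.cong (λ b → t ℕ.+ unit ℕ.* b) (ℕ.m+[n∸m]≡n ℓ≤b))

    isKing≡1 : ∀ o → ¬ o ≡ nothing → isKing o ≡ 1
    isKing≡1 (just _) _ = ≡.refl
    isKing≡1 nothing  k = ⊥-elim (k ≡.refl)

    settle-kingCount : ∀ {s} {i j : Fin s} st o → ¬ IsNewcomer st i →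
      kingCount (settle i j st o) ℕ.≤ kingCount st
    settle-kingCount {i = i} st (just b) king = ℕ.+-cancelʳ-≤ 1 _ _ (ℕ.≤-reflexive
      (≡.trans (≡.cong (kingCount (st [ i ]≔ just b) ℕ.+_) (≡.sym (isKing≡1 (lookup st i) king)))
        (sumOf-update isKing st i (just b))))
    settle-kingCount {i = i} {j} st nothing king = ℕ.≤-trans
      (ℕ.m≤m+n _ (isKing (lookup st₁ j))) (ℕ.≤-reflexive (≡.trans (sumOf-update isKing st₁ j (just 1))
        (≡.trans (≡.cong (kingCount st₁ ℕ.+_) (≡.sym (isKing≡1 (lookup st i) king)))
          (≡.trans (sumOf-update isKing st i nothing) (ℕ.+-identityʳ _)))))
      where st₁ = st [ i ]≔ nothing

    settle-totalBudget : ∀ {s} {i j : Fin s} st o →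
      totalBudget (settle i j st o) ℕ.+ budget st i ℕ.≤ totalBudget st ℕ.+ (fromMaybe 0 o ℕ.+ 1)
    settle-totalBudget {i = i} st (just b) = ℕ.≤-trans (ℕ.≤-reflexive (sumOf-update (fromMaybe 0) st i (just b)))
      (ℕ.+-monoʳ-≤ (totalBudget st) (ℕ.m≤m+n b 1))
    settle-totalBudget {i = i} {j} st nothing = ℕ.≤-trans
      (ℕ.+-monoˡ-≤ (budget st i) (ℕ.≤-trans (ℕ.m≤m+n _ (fromMaybe 0 (lookup st₁ j)))
        (ℕ.≤-reflexive (sumOf-update (fromMaybe 0) st₁ j (just 1)))))
      (ℕ.≤-reflexive (≡.trans (swap-+ (totalBudget st₁) 1 (budget st i))
        (≡.cong (ℕ._+ 1) (≡.trans (sumOf-update (fromMaybe 0) st i nothing) (ℕ.+-identityʳ _)))))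
      where st₁ = st [ i ]≔ nothing

    -- The only budget created is one unit for each newcomer that deposes a king, hence at most
    -- `length js` units.
    fights-sure : ∀ {s} {mem : Vec (Fin n) s} hs is js st {t} {K : Status s → Program R φ s} →
      All (λ i → ¬ IsNewcomer st i) is → Unique is → All (λ j → All (_≢ j) is) js →
      (∀ st′ t′ → kingCount st′ ℕ.≤ kingCount st →
        t′ ℕ.+ unit ℕ.* totalBudget st′ ℕ.≤ t ℕ.+ unit ℕ.* (totalBudget st ℕ.+ length js) →
        Sure mem t′ (K st′)) →
      Sure mem t (fights hs is js st K)
    fights-sure hs []       js       st {t} _ _ _ sK = sK st t ℕ.≤-refl
      (ℕ.+-monoʳ-≤ t (ℕ.*-monoʳ-≤ unit (ℕ.m≤m+n _ (length js))))
    fights-sure hs (i ∷ is) []       st {t} _ _ _ sK = sK st t ℕ.≤-refl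
      (ℕ.+-monoʳ-≤ t (ℕ.*-monoʳ-≤ unit (ℕ.m≤m+n _ 0)))
    fights-sure {mem = mem} hs (i ∷ is) (j ∷ js) st {t} {K} (king ∷ kings) (i∉is ∷ unique)
      ((i≢j ∷ j∉is) ∷ disjoint) sK = sure-if (lookup hs i ℕ.<? lookup hs j)
        (λ _ → challenge-sure (budget st i) i j (budget st i) 1 λ o t₁ le₁ →
          fights-sure hs is js (settle i j st o)
            (still o kings i∉is j∉is)
            unique (All.map All.tail disjoint)
            λ st′ t′ count le → sK st′ t′ (ℕ.≤-trans count (settle-kingCount st o king))
              (ℕ.≤-trans le (paid o t₁ le₁)))
        (λ _ → fights-sure hs is js st kings unique (All.map All.tail disjoint)
          λ st′ t′ count le → sK st′ t′ count (ℕ.≤-trans le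
            (ℕ.+-monoʳ-≤ t (ℕ.*-monoʳ-≤ unit (ℕ.+-monoʳ-≤ (totalBudget st) (ℕ.n≤1+n (length js)))))))
      where
      still : ∀ o {is} → All (λ i → ¬ IsNewcomer st i) is → All (i ≢_) is → All (_≢ j) is →
        All (λ i′ → ¬ IsNewcomer (settle i j st o) i′) is
      still o []             []        []        = []
      still o (king ∷ kings) (i≢ ∷ is) (≢j ∷ js) =
        (λ new → king (≡.trans (≡.sym (settle-other st o (λ eq → i≢ (≡.sym eq)) ≢j)) new)) ∷ still o kings is js
      paid : ∀ o t₁ → t₁ ℕ.+ unit ℕ.* fromMaybe 0 o ℕ.≤ t ℕ.+ unit ℕ.* budget st i →
        t₁ ℕ.+ unit ℕ.* (totalBudget (settle i j st o) ℕ.+ length js) ℕ.≤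
        t ℕ.+ unit ℕ.* (totalBudget st ℕ.+ suc (length js))
      -- With the old budget of `i` added to both sides, `settle-totalBudget` and the cost of the
      -- challenge apply without subtraction.
      paid o t₁ le₁ = ℕ.+-cancelʳ-≤ (unit ℕ.* budget st i) _ _ (begin
        t₁ ℕ.+ unit ℕ.* (B′ ℕ.+ l) ℕ.+ unit ℕ.* b
          ≡⟨ solve 5 (λ t u B l b → t :+ u :* (B :+ l) :+ u :* b := t :+ u :* l :+ u :* (B :+ b))
               ≡.refl t₁ unit B′ l b ⟩
        t₁ ℕ.+ unit ℕ.* l ℕ.+ unit ℕ.* (B′ ℕ.+ b)
          ≤⟨ ℕ.+-monoʳ-≤ (t₁ ℕ.+ unit ℕ.* l) (ℕ.*-monoʳ-≤ unit (settle-totalBudget st o)) ⟩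
        t₁ ℕ.+ unit ℕ.* l ℕ.+ unit ℕ.* (totalBudget st ℕ.+ (x ℕ.+ 1))
          ≡⟨ solve 5 (λ t u B l x → t :+ u :* l :+ u :* (B :+ (x :+ con 1)) :=
               (t :+ u :* x) :+ u :* (B :+ (con 1 :+ l))) ≡.refl t₁ unit (totalBudget st) l x ⟩
        (t₁ ℕ.+ unit ℕ.* x) ℕ.+ unit ℕ.* (totalBudget st ℕ.+ suc l)
          ≤⟨ ℕ.+-monoˡ-≤ _ le₁ ⟩
        (t ℕ.+ unit ℕ.* b) ℕ.+ unit ℕ.* (totalBudget st ℕ.+ suc l)
          ≡⟨ swap-+ t _ _ ⟩
        t ℕ.+ unit ℕ.* (totalBudget st ℕ.+ suc l) ℕ.+ unit ℕ.* b ∎)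
        where
        open ℕ.≤-Reasoning
        B′ = totalBudget (settle i j st o)
        b = budget st i
        l = length js
        x = fromMaybe 0 o

    Within : ∀ {s s′} → Vec (Fin n) s′ → Vec (Fin n) s → Set
    Within mem′ mem = ∀ i → ∃ λ j → lookup mem′ i ≡ lookup mem j

    compact-sure : ∀ {s} {mem : Vec (Fin n) s} st {t} {K : ∀ {s} → Status s → Program R φ s} → Distinct mem →
      (∀ {s′} {mem′ : Vec (Fin n) s′} st′ → AllKings st′ → Distinct mem′ → Within mem′ mem →
        s′ ℕ.≤ kingCount st → totalBudget st′ ℕ.≤ totalBudget st → Sure mem′ t (K st′)) →
      Sure mem t (compact st K)
    compact-sure {zero} [] distinct sK = sK [] (λ ()) distinct (λ ()) ℕ.z≤n ℕ.z≤n
    compact-sure {suc s} {mem} st distinct sK with Fin.any? (newcomer? st)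
    ... | no none = sK st (λ i new → none (i , new)) distinct (λ i → i , ≡.refl)
      (ℕ.≤-reflexive (≡.sym (allKings⇒kingCount st λ i new → none (i , new)))) ℕ.≤-refl
    ... | yes (i , _) = sure (surely (compact-sure (removeAt st i) (distinct-removeAt mem i distinct)
      λ st′ all distinct′ within s′≤ budget≤ → sK st′ all distinct′
        (λ j → punchIn i (proj₁ (within j)) ,
          ≡.trans (proj₂ (within j)) (lookup-removeAt mem i (proj₁ (within j))))
        (ℕ.≤-trans s′≤ (sumOf-removeAt isKing st i))
        (ℕ.≤-trans budget≤ (sumOf-removeAt (fromMaybe 0) st i))))

    -- Of the 3 s s₀, one part s s₀ is for tossing every coin; the rest is 2 s₀ for each unit
    -- created, one per king as income and at most one per newcomer.
    cull-sure : ∀ {s} {mem : Vec (Fin n) s} st {t} {K : ∀ {s} → Status s → Program R φ s} → Distinct mem →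
      (∀ {s′} {mem′ : Vec (Fin n) s′} st′ t′ → AllKings st′ → Distinct mem′ → Within mem′ mem →
        s′ ℕ.≤ kingCount st →
        t′ ℕ.+ unit ℕ.* totalBudget st′ ℕ.≤ t ℕ.+ unit ℕ.* totalBudget st ℕ.+ 3 ℕ.* s ℕ.* s₀ →
        Sure mem′ t′ (K st′)) →
      Sure mem t (cull st K)
    cull-sure {s} {mem} st {t} {K} distinct sK = tossAll-sure (Vec.allFin s) λ hs →
      fights-sure hs _ _ raised
        (All-resp-↭ (↭-sym (sort-↭ (ascending hs) (kings st)))
          (All.map (λ {i} → raised-king i) (All.all-filter (king? st) (List.allFin s))))
        (Unique-resp-↭ (↭-sym (sort-↭ (ascending hs) (kings st)))
          (Unique.filter⁺ (king? st) (Unique.allFin⁺ s)))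
        (All-resp-↭ (↭-sym (sort-↭ (descending hs) (newcomers st)))
          (All.map (λ new → All-resp-↭ (↭-sym (sort-↭ (ascending hs) (kings st)))
            (All.map (λ { king ≡.refl → king new }) (All.all-filter (king? st) (List.allFin s))))
            (All.all-filter (newcomer? st) (List.allFin s))))
        λ st₁ t′ count le₁ → compact-sure st₁ distinct λ st′ all distinct′ within s′≤ budget≤ →
          sK st′ t′ all distinct′ within
            (ℕ.≤-trans s′≤ (ℕ.≤-trans count (ℕ.≤-reflexive (kingCount-raise st))))
            (ℕ.≤-trans (ℕ.+-monoʳ-≤ t′ (ℕ.*-monoʳ-≤ unit budget≤)) (ℕ.≤-trans le₁ (ℕ.≤-reflexive (paid hs))))
      where
      raised = Vec.map (Maybe.map suc) st
      raised-king : ∀ i → ¬ IsNewcomer st i → ¬ IsNewcomer raised i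
      raised-king i king new = king (nothing⁻ (lookup st i)
        (≡.trans (≡.sym (lookup-map i (Maybe.map suc) st)) new))
        where
        nothing⁻ : ∀ o → Maybe.map suc o ≡ nothing → o ≡ nothing
        nothing⁻ nothing _ = ≡.refl
      paid : ∀ hs → t ℕ.+ s ℕ.* s₀ ℕ.+ unit ℕ.* (totalBudget raised ℕ.+ length (sort (descending hs) (newcomers st)))
        ≡ t ℕ.+ unit ℕ.* totalBudget st ℕ.+ 3 ℕ.* s ℕ.* s₀
      paid hs = begin
        t ℕ.+ s ℕ.* s₀ ℕ.+ unit ℕ.* (totalBudget raised ℕ.+ length (sort (descending hs) (newcomers st)))
          ≡⟨ ≡.cong₂ (λ x y → t ℕ.+ s ℕ.* s₀ ℕ.+ unit ℕ.* (x ℕ.+ y)) (totalBudget-raise st)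
               (≡.trans (↭-length (sort-↭ (descending hs) (newcomers st))) (length-newcomers st)) ⟩
        t ℕ.+ s ℕ.* s₀ ℕ.+ unit ℕ.* (totalBudget st ℕ.+ kingCount st ℕ.+ newCount st)
          ≡⟨ solve 6 (λ t s s₀ B c w → t :+ s :* s₀ :+ (s₀ :+ s₀) :* (B :+ c :+ w) :=
               t :+ (s₀ :+ s₀) :* B :+ (s :+ con 2 :* (c :+ w)) :* s₀) ≡.refl
               t s s₀ (totalBudget st) (kingCount st) (newCount st) ⟩
        t ℕ.+ unit ℕ.* totalBudget st ℕ.+ (s ℕ.+ 2 ℕ.* (kingCount st ℕ.+ newCount st)) ℕ.* s₀
          ≡⟨ ≡.cong (λ x → t ℕ.+ unit ℕ.* totalBudget st ℕ.+ (s ℕ.+ 2 ℕ.* x) ℕ.* s₀) (kingCount+newCount st) ⟩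
        t ℕ.+ unit ℕ.* totalBudget st ℕ.+ 3 ℕ.* s ℕ.* s₀ ∎
        where open ≡.≡-Reasoning

-- The output and the invariant along the stream.

∈-⋃-slots : ∀ {n s} (mem : Vec (Fin n) s) {i : Fin s} {is} → i ∈ is →
  lookup mem i ∈ˢ ⋃ (List.map (λ i → ⁅ lookup mem i ⁆) is)
∈-⋃-slots mem {i} (here ≡.refl)  = x∈p∪q⁺ (inj₁ (x∈⁅x⁆ (lookup mem i)))
∈-⋃-slots mem     (there i∈is) = x∈p∪q⁺ (inj₂ (∈-⋃-slots mem i∈is))

∈-⋃-slots⁻ : ∀ {n s} (mem : Vec (Fin n) s) {x} is →
  x ∈ˢ ⋃ (List.map (λ i → ⁅ lookup mem i ⁆) is) → ∃ λ i → lookup mem i ≡ x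
∈-⋃-slots⁻ mem []       x∈ = ⊥-elim (∉⊥ x∈)
∈-⋃-slots⁻ mem (i ∷ is) x∈ with x∈p∪q⁻ ⁅ lookup mem i ⁆ _ x∈
... | inj₁ x∈i = i , ≡.sym (x∈⁅y⁆⇒x≡y (lookup mem i) x∈i)
... | inj₂ x∈is = ∈-⋃-slots⁻ mem is x∈is

module StreamInvariant (ℝ : RealNumbers) (k s₀ : ℕ) (1≤k : 1 ℕ.≤ k) where
  open OrderedField ℝ using (UnitInterval; Phase; Coin; Config; Program; Dist; Surely; exec; feed; finish; run;
    return; bernoulli; arriving; ended; config; store; Outcome; outcome)
  open Expectation ℝ using (surely-map; surely->>=)
  open Algorithm ℝ k s₀
  open Invariants ℝ k s₀
  open +-*-Solver using (solve; _:+_; _:*_; _:=_; con)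

  -- `paid` is a banker's invariant: every arrival deposits 6 s₀, and a newcomer keeps its deposit
  -- until the next round. The k newcomers of a full round then hold 6 k s₀, which is exactly its
  -- cost 3 (2k) s₀. `fresh` keeps the memory free of repetitions.
  record Invariant {n : ℕ} (arrived : ℕ) (cs : List (Fin n)) (cfg : Config n Status) : Set where
    open Config cfg
    field
      distinct : Distinct memory
      fresh    : ∀ i → lookup memory i ∉ cs
      shape    : (AllKings result × size ℕ.≤ k) ⊎ (kingCount result ≡ k × size ℕ.< k ℕ.+ k)
      paid     : tosses ℕ.+ unit ℕ.* totalBudget result ℕ.+ 6 ℕ.* s₀ ℕ.* newCount result
                 ℕ.≤ 6 ℕ.* s₀ ℕ.* arrived
      peak≤    : peakMemory ℕ.≤ k ℕ.+ k

    size≤2k : size ℕ.≤ k ℕ.+ k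
    size≤2k = [ (λ s → ℕ.≤-trans (proj₂ s) (ℕ.m≤m+n k k)) , (λ s → ℕ.<⇒≤ (proj₂ s)) ]′ shape

    kingCount≤k : kingCount result ℕ.≤ k
    kingCount≤k = [ (λ s → ℕ.≤-trans (ℕ.≤-reflexive (allKings⇒kingCount result (proj₁ s))) (proj₂ s))
                  , (λ s → ℕ.≤-reflexive (proj₁ s)) ]′ shape

    full : length (kings result) ≡ k ⊎ newcomers result ≡ []
    full = [ (λ s → inj₂ (none (≡.trans (length-newcomers result) (allKings⇒newCount≡0 result (proj₁ s)))))
           , (λ s → inj₁ (≡.trans (length-kings result) (proj₁ s))) ]′ shape
      where
      none : ∀ {A : Set} {xs : List A} → length xs ≡ 0 → xs ≡ []
      none {xs = []} _ = ≡.refl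

    size≥k⇒kingCount≡k : ¬ size ℕ.< k → kingCount result ≡ k
    size≥k⇒kingCount≡k s≮k = [ (λ s → ≡.trans (allKings⇒kingCount result (proj₁ s))
        (ℕ.≤-antisym (proj₂ s) (ℕ.≮⇒≥ s≮k))) , proj₁ ]′ shape

    size<k⇒allKings : size ℕ.< k → AllKings result
    size<k⇒allKings s<k = [ proj₁ , (λ s → ⊥-elim (ℕ.<⇒≱ s<k
      (≡.subst (ℕ._≤ size) (proj₁ s) (≡.subst (kingCount result ℕ.≤_) (kingCount+newCount result)
        (ℕ.m≤m+n (kingCount result) (newCount result)))))) ]′ shape

    size<2k : size ℕ.< k ℕ.+ k
    size<2k = [ (λ s → ℕ.≤-<-trans (proj₂ s) (ℕ.m<m+n k 1≤k)) , proj₂ ]′ shape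

  module _ {n : ℕ} {p : Fin n → UnitInterval} where

    distinct-∷ : ∀ {s c} {mem : Vec (Fin n) s} → Distinct mem → (∀ i → lookup mem i ≢ c) → Distinct (c ∷ mem)
    distinct-∷ distinct ≢c {zero}  {zero}  eq = ≡.refl
    distinct-∷ distinct ≢c {zero}  {suc j} eq = ⊥-elim (≢c j (≡.sym eq))
    distinct-∷ distinct ≢c {suc i} {zero}  eq = ⊥-elim (≢c i eq)
    distinct-∷ distinct ≢c {suc i} {suc j} eq = ≡.cong suc (distinct eq)

    module _ {a : ℕ} {c : Fin n} {cs : List (Fin n)} {s t m : ℕ} {st : Status s} {mem : Vec (Fin n) s}
             (inv : Invariant a (c ∷ cs) (config st mem t m)) (c∉cs : All (c ≢_) cs) where
      open Invariant inv

      distinct′ : Distinct (c ∷ mem)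
      distinct′ = distinct-∷ distinct λ i eq → fresh i (here eq)

      fresh′ : ∀ i → lookup (c ∷ mem) i ∉ cs
      fresh′ zero    c∈cs = All.lookup c∉cs c∈cs ≡.refl
      fresh′ (suc i) i∈cs = fresh i (there i∈cs)

      peak′ : m ℕ.⊔ suc s ℕ.≤ k ℕ.+ k
      peak′ = ℕ.⊔-lub peak≤ size<2k

      store-king : s ℕ.< k → Invariant (suc a) cs (config (just 1 ∷ st) (c ∷ mem) t (m ℕ.⊔ suc s))
      store-king s<k = record
        { distinct = distinct′
        ; fresh    = fresh′
        ; shape    = inj₁ ((λ { zero () ; (suc i) → size<k⇒allKings s<k i }) , s<k)
        ; paid     = begin
            t ℕ.+ unit ℕ.* suc B ℕ.+ 6 ℕ.* s₀ ℕ.* w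
              ≡⟨ solve 4 (λ t s B w → t :+ (s :+ s) :* (con 1 :+ B) :+ con 6 :* s :* w :=
                   (t :+ (s :+ s) :* B :+ con 6 :* s :* w) :+ con 2 :* s) ≡.refl t s₀ B w ⟩
            t ℕ.+ unit ℕ.* B ℕ.+ 6 ℕ.* s₀ ℕ.* w ℕ.+ 2 ℕ.* s₀
              ≤⟨ ℕ.+-mono-≤ paid (ℕ.*-monoˡ-≤ s₀ {2} {6} (ℕ.s≤s (ℕ.s≤s ℕ.z≤n))) ⟩
            6 ℕ.* s₀ ℕ.* a ℕ.+ 6 ℕ.* s₀
              ≡⟨ solve 2 (λ s a → s :* a :+ s := s :* (con 1 :+ a)) ≡.refl (6 ℕ.* s₀) a ⟩
            6 ℕ.* s₀ ℕ.* suc a ∎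
        ; peak≤    = peak′
        }
        where
        open ℕ.≤-Reasoning
        B = totalBudget st
        w = newCount st

      paid-newcomer : t ℕ.+ unit ℕ.* totalBudget st ℕ.+ 6 ℕ.* s₀ ℕ.* suc (newCount st) ℕ.≤ 6 ℕ.* s₀ ℕ.* suc a
      paid-newcomer = ≡.subst₂ ℕ._≤_
        (solve 3 (λ x s w → x :+ s :* w :+ s := x :+ s :* (con 1 :+ w)) ≡.refl
          (t ℕ.+ unit ℕ.* totalBudget st) (6 ℕ.* s₀) (newCount st))
        (solve 2 (λ s a → s :* a :+ s := s :* (con 1 :+ a)) ≡.refl (6 ℕ.* s₀) a)
        (ℕ.+-monoˡ-≤ (6 ℕ.* s₀) paid)

      store-newcomer : ¬ s ℕ.< k → suc s ℕ.< k ℕ.+ k →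
        Invariant (suc a) cs (config (nothing ∷ st) (c ∷ mem) t (m ℕ.⊔ suc s))
      store-newcomer s≮k s<2k = record
        { distinct = distinct′
        ; fresh    = fresh′
        ; shape    = inj₂ (size≥k⇒kingCount≡k s≮k , s<2k)
        ; paid     = paid-newcomer
        ; peak≤    = peak′
        }

      cull-surely : ¬ s ℕ.< k → ¬ suc s ℕ.< k ℕ.+ k →
        Surely (λ cfg → Invariant (suc a) cs cfg × AllKings (Config.result cfg))
          (exec p (cull (nothing ∷ st) return) c (c ∷ mem) t (m ℕ.⊔ suc s))
      cull-surely s≮k s≮2k = surely (cull-sure (nothing ∷ st) distinct′
        λ {s′} st′ t′ allKings distinct″ within s′≤ le → sure (record
          { distinct = distinct″
          ; fresh    = λ i i∈cs → fresh′ (proj₁ (within i)) (≡.subst (_∈ cs) (proj₂ (within i)) i∈cs)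
          ; shape    = inj₁ (allKings , ℕ.≤-trans s′≤ (ℕ.≤-reflexive (size≥k⇒kingCount≡k s≮k)))
          ; paid     = begin
              t′ ℕ.+ unit ℕ.* totalBudget st′ ℕ.+ 6 ℕ.* s₀ ℕ.* newCount st′
                ≡⟨ ≡.cong (λ w → t′ ℕ.+ unit ℕ.* totalBudget st′ ℕ.+ 6 ℕ.* s₀ ℕ.* w)
                     (allKings⇒newCount≡0 st′ allKings) ⟩
              t′ ℕ.+ unit ℕ.* totalBudget st′ ℕ.+ 6 ℕ.* s₀ ℕ.* 0
                ≡⟨ ≡.trans (≡.cong (t′ ℕ.+ unit ℕ.* totalBudget st′ ℕ.+_) (ℕ.*-zeroʳ (6 ℕ.* s₀)))
                     (ℕ.+-identityʳ _) ⟩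
              t′ ℕ.+ unit ℕ.* totalBudget st′
                ≤⟨ le ⟩
              t ℕ.+ unit ℕ.* totalBudget st ℕ.+ 3 ℕ.* suc s ℕ.* s₀
                ≡⟨ ≡.cong (λ x → t ℕ.+ unit ℕ.* totalBudget st ℕ.+ x) credit ⟩
              t ℕ.+ unit ℕ.* totalBudget st ℕ.+ 6 ℕ.* s₀ ℕ.* suc (newCount st)
                ≤⟨ paid-newcomer ⟩
              6 ℕ.* s₀ ℕ.* suc a ∎
          ; peak≤    = peak′
          } , allKings))
        where
        open ℕ.≤-Reasoning
        suc-s≡2k : suc s ≡ k ℕ.+ k
        suc-s≡2k = ℕ.≤-antisym size<2k (ℕ.≮⇒≥ s≮2k)
        newCount≡k : suc (newCount st) ≡ k
        newCount≡k = ℕ.+-cancelˡ-≡ k _ _ (≡.trans (ℕ.+-suc k (newCount st)) (≡.trans (≡.cong suc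
          (≡.trans (≡.cong (ℕ._+ newCount st) (≡.sym (size≥k⇒kingCount≡k s≮k))) (kingCount+newCount st)))
          suc-s≡2k))
        credit : 3 ℕ.* suc s ℕ.* s₀ ≡ 6 ℕ.* s₀ ℕ.* suc (newCount st)
        credit = ≡.trans (≡.cong (λ x → 3 ℕ.* x ℕ.* s₀) suc-s≡2k)
          (≡.trans (solve 2 (λ k s → con 3 :* (k :+ k) :* s := con 6 :* s :* k) ≡.refl k s₀)
            (≡.cong (6 ℕ.* s₀ ℕ.*_) (≡.sym newCount≡k)))

      arrive-surely : Surely (Invariant (suc a) cs) (exec p (arrive st) c mem t m)
      arrive-surely = surely (sure-if (s ℕ.<? k) (λ s<k → sure (store-king s<k)) λ s≮k →
        sure-if (suc s ℕ.<? k ℕ.+ k) (λ s<2k → sure (store-newcomer s≮k s<2k)) λ s≮2k →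
          sure (surely-map (exec p (cull (nothing ∷ st) return) c (c ∷ mem) t (m ℕ.⊔ suc s))
            (λ _ → proj₁) (cull-surely s≮k s≮2k)))

    feed-surely : ∀ {a} cs {cfg} → Unique cs → Invariant a cs cfg →
      Surely (Invariant (a ℕ.+ length cs) []) (feed p algorithm cs cfg)
    feed-surely {a} [] {cfg} _ inv = ≡.subst (λ a → Invariant a [] cfg) (≡.sym (ℕ.+-identityʳ a)) inv
    feed-surely {a} (c ∷ cs) {config st mem t m} (c∉cs ∷ unique) inv =
      surely->>= (exec p (arrive st) c mem t m) (arrive-surely inv c∉cs) λ cfg inv′ →
        ≡.subst (λ a → Surely (Invariant a []) (feed p algorithm cs cfg))
          (≡.sym (ℕ.+-suc a (length cs))) (feed-surely cs unique inv′)

    -- An upper bound on the number of kept coins suffices: k slots that contain all k top coins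
    -- have no room for others.
    record Final (o : Outcome n) : Set where
      field
        {size}  : ℕ
        kept    : Vec (Fin n) size
        kept≤k  : size ℕ.≤ k
        output≡ : Outcome.output o ≡ ⋃ (List.map (λ i → ⁅ lookup kept i ⁆) (List.allFin size))
        tosses≤ : Outcome.tosses o ℕ.≤ 12 ℕ.* s₀ ℕ.* n
        peak≤   : Outcome.peakMemory o ℕ.≤ k ℕ.+ k

    finish-surely : ∀ {cfg} → k ℕ.≤ n → Invariant n [] cfg → Surely Final (finish p algorithm cfg)
    finish-surely {config {size = s} st mem t m} k≤n inv = surely->>= (exec p (cull st _) tt mem t m)
      (surely (cull-sure st (distinct inv) λ {s′} {mem′} st′ t′ _ _ _ s′≤ le → sure (record
        { kept    = mem′
        ; kept≤k  = ℕ.≤-trans s′≤ (kingCount≤k inv)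
        ; output≡ = ≡.refl
        ; tosses≤ = begin
            t′
              ≤⟨ ℕ.m≤m+n t′ (unit ℕ.* totalBudget st′) ⟩
            t′ ℕ.+ unit ℕ.* totalBudget st′
              ≤⟨ le ⟩
            t ℕ.+ unit ℕ.* totalBudget st ℕ.+ 3 ℕ.* s ℕ.* s₀
              -- The last round may come with few newcomers, so their deposits need not cover it;
              -- but as s ≤ 2k ≤ 2n, it costs at most 6 s₀ n, which doubles the bound.
              ≤⟨ ℕ.+-mono-≤ (ℕ.≤-trans (ℕ.m≤m+n _ _) (paid inv))
                   (ℕ.*-monoˡ-≤ s₀ (ℕ.*-monoʳ-≤ 3 (ℕ.≤-trans (size≤2k inv) (ℕ.+-mono-≤ k≤n k≤n)))) ⟩
            6 ℕ.* s₀ ℕ.* n ℕ.+ 3 ℕ.* (n ℕ.+ n) ℕ.* s₀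
              ≡⟨ solve 2 (λ s n → con 6 :* s :* n :+ con 3 :* (n :+ n) :* s := con 12 :* s :* n) ≡.refl s₀ n ⟩
            12 ℕ.* s₀ ℕ.* n ∎
        ; peak≤   = peak≤ inv
        })))
      λ _ final → final
      where
      open ℕ.≤-Reasoning
      open Invariant

    initially : ∀ cs → Invariant {n} 0 cs (config [] [] 0 0)
    initially cs = record
      { distinct = λ { {()} }
      ; fresh    = λ ()
      ; shape    = inj₁ ((λ ()) , ℕ.z≤n)
      ; paid     = ℕ.≤-reflexive (solve 1 (λ s → (s :+ s) :* con 0 :+ con 6 :* s :* con 0 := con 6 :* s :* con 0)
                     ≡.refl s₀)
      ; peak≤    = ℕ.z≤n
      }

    run-surely : k ℕ.≤ n → Surely Final (run p algorithm)
    run-surely k≤n = surely->>= (feed p algorithm (List.allFin n) (config [] [] 0 0))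
      (feed-surely (List.allFin n) (Unique.allFin⁺ n) (initially (List.allFin n)))
      λ cfg inv → finish-surely k≤n
        (≡.subst (λ a → Invariant a [] cfg) (List.length-tabulate (λ (i : Fin n) → i)) inv)

-- The probability of losing a fixed top coin.

module StreamLoss (ℝ : RealNumbers) (k s₀ : ℕ) (1≤k : 1 ℕ.≤ k) where
  open OrderedField ℝ hiding (zero)
  open Solver using (solve; _:+_; _:*_; _:=_; con)
  open Expectation ℝ
  open Algorithm ℝ k s₀
  open Challenge ℝ k s₀
  open Culling ℝ k s₀
  open StreamInvariant ℝ k s₀ 1≤k

  module _ {n : ℕ} {p : Fin n → UnitInterval} {Top : Fin n → Set} (Top? : Decidable Top)
           (separation : Separation p Top) (calibration : Calibration (Separation.r separation))
           (few : ∀ (cs : List (Fin n)) → Unique cs → All Top cs → length cs ℕ.≤ k)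
           (x : Fin n) (top : Top x) where
    open Separation separation using (r; 0≤r)
    open Calibration calibration hiding (0≤r)

    -- `η` is the potential of a top coin that has yet to survive its first round, and `ζ` bounds
    -- the chance of a misranked round.
    η ζ : Carrier
    η = θ ^ 1 + (r ^ 1 + r ^ 1 + (r ^ 1 + r ^ 1))
    ζ = fromℕ (k ℕ.+ k) * r

    0≤ζ : 0# ≤ ζ
    0≤ζ = 0≤* (0≤fromℕ (k ℕ.+ k)) 0≤r

    0≤4r : 0# ≤ r ^ 1 + r ^ 1 + (r ^ 1 + r ^ 1)
    0≤4r = 0≤+ (0≤+ (0≤^ 0≤r 1) (0≤^ 0≤r 1)) (0≤+ (0≤^ 0≤r 1) (0≤^ 0≤r 1))

    -- Differs from `potential` at `nothing`: before a round a newcomer still has its chance, after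
    -- the fights it is about to be discarded.
    slotPotential : Maybe ℕ → Carrier
    slotPotential (just b) = θ ^ b
    slotPotential nothing  = η

    indicator : Fin n → ℕ
    indicator c = if does (Top? c) then 1 else 0

    indicator-top : ∀ {c} → Top c → indicator c ≡ 1
    indicator-top {c} t with Top? c
    ... | yes _ = ≡.refl
    ... | no ¬t = ⊥-elim (¬t t)

    newTop : Maybe ℕ → Fin n → ℕ
    newTop (just _) c = 0
    newTop nothing  c = indicator c

    newTops : ∀ {s} → Status s → Vec (Fin n) s → ℕ
    newTops []       []        = 0
    newTops (o ∷ st) (c ∷ mem) = newTop o c ℕ.+ newTops st mem

    newTop≤newTops : ∀ {s} (st : Status s) mem i → newTop (lookup st i) (lookup mem i) ℕ.≤ newTops st mem
    newTop≤newTops (o ∷ st) (c ∷ mem) zero    = ℕ.m≤m+n (newTop o c) (newTops st mem)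
    newTop≤newTops (o ∷ st) (c ∷ mem) (suc i) =
      ℕ.≤-trans (newTop≤newTops st mem i) (ℕ.m≤n+m (newTops st mem) (newTop o c))

    newTops≥1 : ∀ {s} (st : Status s) mem i → IsNewcomer st i → Top (lookup mem i) → 1 ℕ.≤ newTops st mem
    newTops≥1 st mem i new t = ≡.subst (ℕ._≤ newTops st mem)
      (≡.trans (≡.cong (λ o → newTop o (lookup mem i)) new) (indicator-top t)) (newTop≤newTops st mem i)

    newTops-allKings : ∀ {s} (st : Status s) mem → AllKings st → newTops st mem ≡ 0
    newTops-allKings []             []        _   = ≡.refl
    newTops-allKings (just _ ∷ st)  (c ∷ mem) all = newTops-allKings st mem λ i → all (suc i)
    newTops-allKings (nothing ∷ st) (c ∷ mem) all = ⊥-elim (all zero ≡.refl)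

    topCount : List (Fin n) → ℕ
    topCount []       = 0
    topCount (c ∷ cs) = indicator c ℕ.+ topCount cs

    topCount≤k : ∀ {cs} → Unique cs → topCount cs ℕ.≤ k
    topCount≤k {cs} unique = ≡.subst (ℕ._≤ k) (filtered cs)
      (few (List.filter Top? cs) (Unique.filter⁺ Top? unique) (All.all-filter Top? cs))
      where
      filtered : ∀ cs → length (List.filter Top? cs) ≡ topCount cs
      filtered []       = ≡.refl
      filtered (c ∷ cs) with does (Top? c)
      ... | true  = ≡.cong suc (filtered cs)
      ... | false = filtered cs

    lost : Outcome n → Carrier
    lost o = if does (x ∈? Outcome.output o) then 0# else 1#

    lost≤1 : ∀ o → lost o ≤ 1#
    lost≤1 o with does (x ∈? Outcome.output o)
    ... | true  = 0≤1
    ... | false = ≤-refl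

    lost-kept : ∀ o → x ∈ˢ Outcome.output o → lost o ≈ 0#
    lost-kept o x∈ with x ∈? Outcome.output o
    ... | yes _  = refl
    ... | no  x∉ = ⊥-elim (x∉ x∈)

    -- The expected loss once all coins but cs have arrived.
    loss : List (Fin n) → Config n Status → Carrier
    loss cs cfg = E (feed p algorithm cs cfg >>= finish p algorithm) lost

    loss≤1 : ∀ cs cfg → loss cs cfg ≤ 1#
    loss≤1 cs cfg = E-≤-const d (surely-⊤ {P = λ _ → ⊤} d (λ _ → tt)) (λ o _ → lost≤1 o)
      where
      d = feed p algorithm cs cfg >>= finish p algorithm

    loss-∷ : ∀ c cs {s} (st : Status s) mem t m →
      loss (c ∷ cs) (config st mem t m) ≡ E (exec p (arrive st) c mem t m) (loss cs)
    loss-∷ c cs st mem t m = ≡.trans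
      (E->>= (exec p (arrive st) c mem t m >>= feed p algorithm cs) (finish p algorithm) lost)
      (≡.trans (E->>= (exec p (arrive st) c mem t m) (feed p algorithm cs) _)
        (E-cong (exec p (arrive st) c mem t m) λ cfg →
          ≡.sym (E->>= (feed p algorithm cs cfg) (finish p algorithm) lost)))
      where
      E-cong : ∀ {A : Set} (d : Dist A) {f g : A → Carrier} → (∀ a → f a ≡ g a) → E d f ≡ E d g
      E-cong (return a)      f≡g = f≡g a
      E-cong (bernoulli q d) f≡g = ≡.cong₂ (λ x y → value q * x + (1# - value q) * y)
        (E-cong (d true) f≡g) (E-cong (d false) f≡g)

    -- The index is the potential of `x`. A discarded `x` has no constructor; its loss is bounded by
    -- 1 directly.
    data Located (cs : List (Fin n)) {s : ℕ} (st : Status s) (mem : Vec (Fin n) s) : Carrier → Set where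
      stored : ∀ l → lookup mem l ≡ x → Located cs st mem (slotPotential (lookup st l))
      future : x ∈ cs → Located cs st mem η

    ζ* : ℕ → Carrier
    ζ* m = ζ * fromℕ m

    ζ*-mono : ∀ {m m′} → m ℕ.≤ m′ → ζ* m ≤ ζ* m′
    ζ*-mono m≤m′ = *-monoˡ-≤ 0≤ζ (fromℕ-mono-≤ m≤m′)

    ζ≤ζ* : ∀ {m} → 1 ℕ.≤ m → ζ ≤ ζ* m
    ζ≤ζ* {m} 1≤m = ≤-trans (≤-reflexive (trans (sym (*-identityʳ ζ)) (*-congˡ (sym fromℕ-1)))) (ζ*-mono 1≤m)

    0≤ζ* : ∀ m → 0# ≤ ζ* m
    0≤ζ* m = 0≤* 0≤ζ (0≤fromℕ m)

    -- A round is charged ζ only if some newcomer is a top coin, which may be `x` itself; then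
    -- `newTops` is at least 1 and provides it.
    cull-stored : ∀ {φ R} {c : Coin φ n} {F : Config n R → Carrier} {s} {mem : Vec (Fin n) s} {st : Status s}
      {K : ∀ {s} → Status s → Program R φ s} → Distinct mem → s ℕ.≤ k ℕ.+ k →
      length (kings st) ≡ k ⊎ newcomers st ≡ [] →
      (∀ {s} {mem′ : Vec (Fin n) s} st {i} → Distinct mem′ → lookup mem′ i ≡ x →
        Bounded p c F mem′ (K st) (potential (lookup st i))) →
      (∀ {s} {mem : Vec (Fin n) s} st → Bounded p c F mem (K st) 1#) →
      ∀ l → lookup mem l ≡ x →
      Bounded p c F mem (cull st K) (slotPotential (lookup st l) + ζ* (newTops st mem))
    cull-stored {c = c} {F} {s} {mem} {st} {K} distinct s≤2k full K≤ K≤1 l ≡.refl = split (lookup st l) ≡.refl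
      where
      few-slots : ∀ (is : List (Fin s)) → Unique is → All (Top ∘ lookup mem) is → length is ℕ.≤ k
      few-slots is unique tops = ≡.subst (ℕ._≤ k) (List.length-map (lookup mem) is)
        (few (List.map (lookup mem) is) (Unique.map⁺ distinct unique) (All.map⁺ tops))
      split : ∀ o → lookup st l ≡ o → Bounded p c F mem (cull st K) (slotPotential o + ζ* (newTops st mem))
      split nothing new = bounded-≤ (+-monoʳ-≤ η (ζ≤ζ* (newTops≥1 st mem l new top)))
        (cull-topNewcomer Top? separation calibration distinct s≤2k few-slots st full l top K≤ K≤1 new)
      split (just b) king with Fin.any? (λ j → newcomer? st j ×-dec Top? (lookup mem j))
      ... | yes (j , new , topⱼ) = bounded-≤ (+-monoʳ-≤ (θ ^ b) (ζ≤ζ* (newTops≥1 st mem j new topⱼ)))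
        (cull-king Top? separation calibration distinct s≤2k few-slots st full l top K≤ K≤1 king)
      ... | no none = bounded-≤ (x≤x+y (0≤ζ* (newTops st mem)))
        (cull-king-noTop Top? separation calibration distinct s≤2k few-slots st full l top K≤ K≤1 king
          (λ j new topⱼ → none (j , new , topⱼ)))

    loss-[] : ∀ {a s t m v} {st : Status s} {mem} → Invariant a [] (config st mem t m) →
      Located [] st mem v → loss [] (config st mem t m) ≤ v + ζ* (newTops st mem)
    loss-[] {t = t} {m} {st = st} {mem} inv (stored l at) = ≤-trans
      (≤-reflexive (reflexive (E->>= (exec p (cull st _) tt mem t m) _ lost)))
      (cull-stored {c = tt} {F = endLoss} (Invariant.distinct inv) (Invariant.size≤2k inv) (Invariant.full inv)
        kept (λ {s} {mem} st → bounded λ t m → lost≤1 (endOutcome (config (List.allFin s) mem t m))) l at .bound t m)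
      where
      endOutcome : Config n (λ s → List (Fin s)) → Outcome n
      endOutcome (config slots mem t m) = outcome (⋃ (List.map (λ i → ⁅ lookup mem i ⁆) slots)) t m
      endLoss : Config n (λ s → List (Fin s)) → Carrier
      endLoss cfg = lost (endOutcome cfg)
      kept : ∀ {s} {mem′ : Vec (Fin n) s} (st : Status s) {i} → Distinct mem′ → lookup mem′ i ≡ x →
        Bounded p tt endLoss mem′ (return (List.allFin s)) (potential (lookup st i))
      kept {s} {mem′} st {i} _ ≡.refl = bounded λ t m → ≤-trans
        (≤-reflexive (lost-kept (endOutcome (config (List.allFin s) mem′ t m)) (∈-⋃-slots mem′ (∈-allFin i)))) (0≤potential (lookup st i))
        where
        0≤potential : ∀ o → 0# ≤ potential o
        0≤potential (just b) = 0≤^ 0≤θ b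
        0≤potential nothing  = 0≤1

    -- The potential of `x` as a function of the configuration alone, so that its expectation over a
    -- round makes sense. The slot found is the right one because the memory has no repetitions.
    storedPotential : Config n Status → Carrier
    storedPotential (config st mem _ _) with Fin.any? (λ i → lookup mem i Fin.≟ x)
    ... | yes (i , _) = potential (lookup st i)
    ... | no _        = 1#

    storedPotential≤1 : ∀ cfg → storedPotential cfg ≤ 1#
    storedPotential≤1 (config st mem _ _) with Fin.any? (λ i → lookup mem i Fin.≟ x)
    ... | yes (i , _) = potential≤1 (lookup st i)
    ... | no _        = ≤-refl

    storedPotential-at : ∀ {s} (st : Status s) mem t m {i} → Distinct mem → lookup mem i ≡ x →
      storedPotential (config st mem t m) ≡ potential (lookup st i)
    storedPotential-at st mem t m {i} distinct at with Fin.any? (λ i → lookup mem i Fin.≟ x)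
    ... | yes (j , at′) = ≡.cong (potential ∘ lookup st) (distinct (≡.trans at′ (≡.sym at)))
    ... | no none       = ⊥-elim (none (i , at))

    -- One ζ is set aside for each top coin that is still to come or waiting as a newcomer. A round
    -- with top newcomers spends one ζ and uses up at least one such coin, since no newcomer
    -- outlives a round.
    LossBounded : ℕ → List (Fin n) → Set
    LossBounded a cs = ∀ {s t m v} {st : Status s} {mem} → Invariant a cs (config st mem t m) →
      Located cs st mem v → loss cs (config st mem t m) ≤ v + ζ* (topCount cs ℕ.+ newTops st mem)

    module _ {a : ℕ} {cs : List (Fin n)} (unique : Unique cs) (IH : LossBounded a cs) where

      loss-culled : ∀ cfg → Invariant a cs cfg × AllKings (Config.result cfg) →
        loss cs cfg ≤ storedPotential cfg + ζ* (topCount cs)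
      loss-culled cfg@(config st mem t m) (inv , all) with Fin.any? (λ i → lookup mem i Fin.≟ x)
      ... | no _         = ≤-trans (loss≤1 cs cfg) (x≤x+y (0≤ζ* (topCount cs)))
      ... | yes (i , at) = ≤-trans (IH inv (stored i at)) (+-mono-≤ (slot (lookup st i) (all i))
        (ζ*-mono (ℕ.≤-reflexive (≡.trans (≡.cong (topCount cs ℕ.+_) (newTops-allKings st mem all))
          (ℕ.+-identityʳ (topCount cs))))))
        where
        slot : ∀ o → ¬ o ≡ nothing → slotPotential o ≤ potential o
        slot (just b) _    = ≤-refl
        slot nothing  king = ⊥-elim (king ≡.refl)

      -- After the round there are no newcomers, so the rest of the stream is charged ζ only for top
      -- coins to come. This amount does not depend on the outcome of the round and leaves the
      -- expectation as a constant.
      loss-cull : ∀ {c : Fin n} {s v} {st : Status s} {mem} → Distinct mem → s ℕ.≤ k ℕ.+ k →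
        length (kings st) ≡ k ⊎ newcomers st ≡ [] →
        Located cs st mem v →
        ∀ {t m} → Surely (λ cfg → Invariant a cs cfg × AllKings (Config.result cfg)) (exec p (cull st return) c mem t m) →
        E (exec p (cull st return) c mem t m) (loss cs) ≤ v + ζ* (topCount cs ℕ.+ newTops st mem)
      loss-cull {c} {s} {st = st} {mem} distinct s≤2k full (stored l at) {t} {m} culled = begin
        E (exec p (cull st return) c mem t m) (loss cs)
          ≤⟨ E-mono (exec p (cull st return) c mem t m) culled loss-culled ⟩
        E (exec p (cull st return) c mem t m) (λ cfg → storedPotential cfg + ζ* (topCount cs))
          ≈⟨ trans (E-+ (exec p (cull st return) c mem t m) _ _)
               (+-congˡ (E-const (exec p (cull st return) c mem t m) _)) ⟩
        E (exec p (cull st return) c mem t m) storedPotential + ζ* (topCount cs)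
          ≤⟨ +-monoˡ-≤ _ (cull-stored {c = c} {F = storedPotential} distinct s≤2k full
               (λ {_} {mem′} st distinct′ at → bounded λ t m →
                 ≤-reflexive (reflexive (storedPotential-at st mem′ t m distinct′ at)))
               (λ {_} {mem′} st → bounded λ t m → storedPotential≤1 (config st mem′ t m)) l at .bound t m) ⟩
        slotPotential (lookup st l) + ζ* (newTops st mem) + ζ* (topCount cs)
          ≈⟨ trans (solve 4 (λ v z y w → v :+ z :* y :+ z :* w := v :+ z :* (w :+ y)) refl
               (slotPotential (lookup st l)) ζ (fromℕ (newTops st mem)) (fromℕ (topCount cs)))
               (+-congˡ (*-congˡ (sym (fromℕ-+ (topCount cs) (newTops st mem))))) ⟩
        slotPotential (lookup st l) + ζ* (topCount cs ℕ.+ newTops st mem) ∎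
        where open ≤-Reasoning
      loss-cull {c} {s} {st = st} {mem} distinct s≤2k full (future x∈cs) {t} {m} culled =
        E-≤-const (exec p (cull st return) c mem t m) culled λ { (config st′ mem′ _ _) (inv , all) →
          ≤-trans (IH inv (future x∈cs)) (+-monoʳ-≤ η (ζ*-mono (ℕ.≤-trans
            (ℕ.≤-reflexive (≡.trans (≡.cong (topCount cs ℕ.+_) (newTops-allKings st′ mem′ all))
              (ℕ.+-identityʳ (topCount cs)))) (ℕ.m≤m+n (topCount cs) (newTops st mem))))) }

    -- The arriving coin may be `x` itself; the hypothesis on `o` ensures that moving it into a slot
    -- does not raise its potential above η.
    locate-∷ : ∀ {c cs s v} o {st : Status s} {mem} → slotPotential o ≤ η →
      Located (c ∷ cs) st mem v → ∃ λ v′ → v′ ≤ v × Located cs (o ∷ st) (c ∷ mem) v′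
    locate-∷ o o≤η (stored l at)          = _ , ≤-refl , stored (suc l) at
    locate-∷ o o≤η (future (here ≡.refl)) = _ , o≤η , stored zero ≡.refl
    locate-∷ o o≤η (future (there x∈cs))  = _ , ≤-refl , future x∈cs

    loss-bounded : ∀ {a} cs → Unique cs → LossBounded a cs
    loss-bounded []       _                inv located = loss-[] inv located
    loss-bounded {a} (c ∷ cs) (c∉cs ∷ unique) {s} {t} {m} {v} {st} {mem} inv located = ≤-trans
      (≤-reflexive (reflexive (loss-∷ c cs st mem t m)))
      (choose (s ℕ.<? k)
        (λ s<k → after (just 1) (x≤x+y 0≤4r) (store-king {p = p} inv c∉cs s<k)
          (ℕ.+-monoˡ-≤ (newTops st mem) (ℕ.m≤n+m (topCount cs) (indicator c))))
        λ s≮k → choose (suc s ℕ.<? k ℕ.+ k)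
          (λ s<2k → after nothing ≤-refl (store-newcomer {p = p} inv c∉cs s≮k s<2k)
            (ℕ.≤-reflexive (shift (topCount cs) (newTops st mem))))
          λ s≮2k → culled s≮k s≮2k (locate-∷ nothing ≤-refl located))
      where
      w = v + ζ* (topCount (c ∷ cs) ℕ.+ newTops st mem)
      choose : ∀ {X : Set} (X? : Dec X) {P Q} →
        (X → E (exec p P c mem t m) (loss cs) ≤ w) → (¬ X → E (exec p Q c mem t m) (loss cs) ≤ w) →
        E (exec p (if does X? then P else Q) c mem t m) (loss cs) ≤ w
      choose (yes x) P Q = P x
      choose (no ¬x) P Q = Q ¬x
      shift : ∀ y z → y ℕ.+ (indicator c ℕ.+ z) ≡ indicator c ℕ.+ y ℕ.+ z
      shift y z = ≡.trans (≡.sym (ℕ.+-assoc y (indicator c) z)) (≡.cong (ℕ._+ z) (ℕ.+-comm y (indicator c)))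
      after : ∀ o → slotPotential o ≤ η → Invariant (suc a) cs (config (o ∷ st) (c ∷ mem) t (m ℕ.⊔ suc s)) →
        topCount cs ℕ.+ newTops (o ∷ st) (c ∷ mem) ℕ.≤ topCount (c ∷ cs) ℕ.+ newTops st mem →
        loss cs (config (o ∷ st) (c ∷ mem) t (m ℕ.⊔ suc s)) ≤ w
      after o o≤η inv′ le with locate-∷ o o≤η located
      ... | v′ , v′≤v , located′ = ≤-trans (loss-bounded cs unique inv′ located′) (+-mono-≤ v′≤v (ζ*-mono le))
      culled : ¬ s ℕ.< k → ¬ suc s ℕ.< k ℕ.+ k →
        (∃ λ v′ → v′ ≤ v × Located cs (nothing ∷ st) (c ∷ mem) v′) →
        E (exec p (cull (nothing ∷ st) return) c (c ∷ mem) t (m ℕ.⊔ suc s)) (loss cs) ≤ w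
      culled s≮k s≮2k (v′ , v′≤v , located′) = ≤-trans
        (loss-cull unique (loss-bounded cs unique) (distinct′ {p = p} inv c∉cs) (Invariant.size<2k inv)
          (inj₁ (≡.trans (length-kings (nothing ∷ st)) (Invariant.size≥k⇒kingCount≡k inv s≮k)))
          located′ (cull-surely inv c∉cs s≮k s≮2k))
        (+-mono-≤ v′≤v (ζ*-mono (ℕ.≤-reflexive (shift (topCount cs) (newTops st mem)))))

-- Rounding, powers, and the weights of heads and tails.

module Numerics (ℝ : RealNumbers) where
  open OrderedField ℝ hiding (zero)
  open Solver using (solve; _:+_; _:*_; _:=_; con)

  fromℕ<fromℕ-suc : ∀ m → fromℕ m < fromℕ (suc m)
  fromℕ<fromℕ-suc m = <-respˡ-≈ (+-identityˡ _) (+-monoˡ-< (fromℕ m) 0<1)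

  two : Carrier
  two = fromℕ 2

  two≈1+1 : two ≈ 1# + 1#
  two≈1+1 = +-congˡ (+-identityʳ 1#)

  -- The order being undecidable, rounding up is only possible with some slack.
  round : ∀ x → ∃ λ m → x ≤ fromℕ m × (0# ≤ x → fromℕ m ≤ x + two)
  round x with archimedean x
  ... | m , x<m = search m (<-trans x<m (fromℕ<fromℕ-suc m))
    where
    search : ∀ m → x < fromℕ (suc m) → ∃ λ m → x ≤ fromℕ m × (0# ≤ x → fromℕ m ≤ x + two)
    search zero    x<1 = 1 , <⇒≤ x<1 , λ 0≤x →
      ≤-trans (fromℕ-mono-≤ {1} {2} (ℕ.s≤s ℕ.z≤n)) (x≤y+x 0≤x)
    search (suc m) x<m+2 with <-cotrans (fromℕ<fromℕ-suc m) x
    ... | inj₁ m<x   = suc (suc m) , <⇒≤ x<m+2 , λ _ → ≤-trans (≤-reflexive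
      (trans (sym (+-assoc 1# 1# (fromℕ m))) (trans (+-comm _ (fromℕ m)) (+-congˡ (sym two≈1+1)))))
      (+-monoˡ-≤ two (<⇒≤ m<x))
    ... | inj₂ x<m+1 = search m x<m+1

  ½*two : ½ * two ≈ 1#
  ½*two = trans (*-congʳ (*-identityˡ _)) (inverse-*ˡ (fromℕ⁺ 2 (ℕ.s≤s ℕ.z≤n)))

  ½+½ : ½ + ½ ≈ 1#
  ½+½ = trans (trans (+-cong (sym (*-identityʳ ½)) (sym (*-identityʳ ½))) (sym (distribˡ ½ 1# 1#)))
    (trans (*-congˡ (sym two≈1+1)) ½*two)

  x½+x½ : ∀ x → x * ½ + x * ½ ≈ x
  x½+x½ x = trans (sym (distribˡ x ½ ½)) (trans (*-congˡ ½+½) (*-identityʳ x))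

  0<½ : 0# < ½
  0<½ = <-respʳ-≈ (sym (*-identityˡ _)) (0<inverse (fromℕ⁺ 2 (ℕ.s≤s ℕ.z≤n)))

  ½≤1 : ½ ≤ 1#
  ½≤1 = ≤-trans (x≤x+y (<⇒≤ 0<½)) (≤-reflexive ½+½)

  bernoulli-inequality : ∀ {x} → 0# ≤ x → ∀ m → 1# + fromℕ m * x ≤ (1# + x) ^ m
  bernoulli-inequality {x} 0≤x zero    = ≤-reflexive (trans (+-congˡ (zeroˡ x)) (+-identityʳ 1#))
  bernoulli-inequality {x} 0≤x (suc m) = begin
    1# + (1# + y) * x
      ≤⟨ x≤x+y (0≤* (0≤* (0≤fromℕ m) 0≤x) 0≤x) ⟩
    1# + (1# + y) * x + y * x * x
      ≈⟨ solve 2 (λ x y → con 1 :+ (con 1 :+ y) :* x :+ y :* x :* x := (con 1 :+ x) :* (con 1 :+ y :* x))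
           refl x y ⟩
    (1# + x) * (1# + y * x)
      ≤⟨ *-monoˡ-≤ (0≤+ 0≤1 0≤x) (bernoulli-inequality 0≤x m) ⟩
    (1# + x) * (1# + x) ^ m ∎
    where
    open ≤-Reasoning
    y = fromℕ m

  -- As y (1 + x) ≤ 1, the power y^m is at most 1/(1 + x)^m, and (1 + x)^m ≥ 1 + mx ≥ 2 by
  -- Bernoulli. This stands in for 1 - x ≤ exp(-x).
  power-halves : ∀ {x y m} → 0# ≤ x → 0# ≤ y → y + x ≈ 1# → 1# ≤ fromℕ m * x → y ^ m ≤ ½
  power-halves {x} {y} {m} 0≤x 0≤y y+x 1≤mx = *-cancelˡ-≤ (0<fromℕ-suc 1) (begin
    two * y ^ m
      ≈⟨ *-comm two _ ⟩
    y ^ m * two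
      ≤⟨ *-monoˡ-≤ (0≤^ 0≤y m) (≤-trans (≤-trans (≤-reflexive two≈1+1) (+-monoʳ-≤ 1# 1≤mx))
           (bernoulli-inequality 0≤x m)) ⟩
    y ^ m * (1# + x) ^ m
      ≈⟨ ^-distrib-* y (1# + x) m ⟨
    (y * (1# + x)) ^ m
      ≤⟨ ^≤1 (0≤* 0≤y (0≤+ 0≤1 0≤x)) product≤1 m ⟩
    1#
      ≈⟨ trans (*-comm two ½) ½*two ⟨
    two * ½ ∎)
    where
    open ≤-Reasoning
    y≤1 : y ≤ 1#
    y≤1 = ≤-trans (x≤x+y 0≤x) (≤-reflexive y+x)
    product≤1 : y * (1# + x) ≤ 1#
    product≤1 = ≤-trans (≤-reflexive (trans (distribˡ y 1# x) (+-congʳ (*-identityʳ y))))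
      (≤-trans (+-monoʳ-≤ y (≤-trans (*-monoʳ-≤ 0≤x y≤1) (≤-reflexive (*-identityˡ x)))) (≤-reflexive y+x))

  -- The weights multiply by a on tails and by a′ on heads for top coins, and by the
  -- inverses for the others; c is the midpoint of the gap and h a quarter of it.
  module Weights (h c : Carrier) (0<h : 0# < h) (0≤c : 0# ≤ c) (c+2h≤1 : c + (h + h) ≤ 1#) where

    0≤h : 0# ≤ h
    0≤h = <⇒≤ 0<h

    -- A coin of bias q has mean weight 1 + h (c - q) under `a` and `a′`, so `c` is where top coins
    -- and others part. The decay κ is half of h² because of the inverse weights: there a gain of h²
    -- is divided by a product a a′ that may be as large as 2.
    c̄ κ a a′ ρ : Carrier
    c̄  = 1# - c
    κ  = h * h * ½
    a  = 1# + c * h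
    a′ = 1# - c̄ * h
    ρ  = 1# - κ

    c+c̄ : c + c̄ ≈ 1#
    c+c̄ = x+y-x

    c≤1 : c ≤ 1#
    c≤1 = ≤-trans (x≤x+y (0≤+ 0≤h 0≤h)) c+2h≤1

    0≤c̄ : 0# ≤ c̄
    0≤c̄ = x≤y⇒0≤y-x c≤1

    c̄≤1 : c̄ ≤ 1#
    c̄≤1 = ≤-trans (x≤y+x 0≤c) (≤-reflexive c+c̄)

    2h≤1 : h + h ≤ 1#
    2h≤1 = ≤-trans (x≤y+x 0≤c) c+2h≤1

    h≤1 : h ≤ 1#
    h≤1 = ≤-trans (x≤x+y 0≤h) 2h≤1

    h<1 : h < 1#
    h<1 = <-≤-trans (<-respˡ-≈ (+-identityʳ h) (+-monoʳ-< h 0<h)) 2h≤1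

    c̄h≤h : c̄ * h ≤ h
    c̄h≤h = ≤-trans (*-monoʳ-≤ 0≤h c̄≤1) (≤-reflexive (*-identityˡ h))

    ch≤1 : c * h ≤ 1#
    ch≤1 = *-≤1 0≤c c≤1 h≤1

    a′+c̄h : a′ + c̄ * h ≈ 1#
    a′+c̄h = trans (+-comm _ _) x+y-x

    0<a′ : 0# < a′
    0<a′ = x<y⇒0<y-x (≤-<-trans c̄h≤h h<1)

    0<a : 0# < a
    0<a = <-≤-trans 0<1 (x≤x+y (0≤* 0≤c 0≤h))

    a′≤1 : a′ ≤ 1#
    a′≤1 = ≤-trans (x≤x+y (0≤* 0≤c̄ 0≤h)) (≤-reflexive a′+c̄h)

    a′≤a : a′ ≤ a
    a′≤a = ≤-trans a′≤1 (x≤x+y (0≤* 0≤c 0≤h))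

    0≤h² : 0# ≤ h * h
    0≤h² = 0≤* 0≤h 0≤h

    0≤κ : 0# ≤ κ
    0≤κ = 0≤* 0≤h² (<⇒≤ 0<½)

    κ≤h² : κ ≤ h * h
    κ≤h² = ≤-trans (*-monoˡ-≤ 0≤h² ½≤1) (≤-reflexive (*-identityʳ (h * h)))

    ρ+κ : ρ + κ ≈ 1#
    ρ+κ = trans (+-comm _ _) x+y-x

    0≤ρ : 0# ≤ ρ
    0≤ρ = x≤y⇒0≤y-x (≤-trans κ≤h² (*-≤1 0≤h h≤1 h≤1))

    -- The mean plus q h is exactly 1 + c h, and q h exceeds c h by at least 2 h².
    top-mean : ∀ {q q̄} → q + q̄ ≈ 1# → c + (h + h) ≤ q → q * a′ + q̄ * a ≤ ρ
    top-mean {q} {q̄} q+q̄ c+2h≤q = +-cancelʳ-≤ κ (≤-trans (+-monoʳ-≤ _ (≤-trans κ≤h² (x≤x+y 0≤h²)))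
      (≤-trans (+-cancelʳ-≤ (c * h) (begin
        X + (h * h + h * h) + c * h
          ≈⟨ solve 3 (λ X h c → X :+ (h :* h :+ h :* h) :+ c :* h := X :+ (c :+ (h :+ h)) :* h) refl X h c ⟩
        X + (c + (h + h)) * h
          ≤⟨ +-monoʳ-≤ X (*-monoʳ-≤ 0≤h c+2h≤q) ⟩
        X + q * h
          ≈⟨ +-congˡ (*-congʳ (trans (sym (*-identityʳ q)) (*-congˡ (sym c+c̄)))) ⟩
        X + q * (c + c̄) * h
          ≈⟨ solve 6 (λ q q̄ a′ c c̄ h →
               q :* a′ :+ q̄ :* (con 1 :+ c :* h) :+ q :* (c :+ c̄) :* h :=
               q :* (a′ :+ c̄ :* h) :+ q̄ :+ (q :+ q̄) :* (c :* h)) refl q q̄ a′ c c̄ h ⟩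
        q * (a′ + c̄ * h) + q̄ + (q + q̄) * (c * h)
          ≈⟨ +-cong (+-congʳ (trans (*-congˡ a′+c̄h) (*-identityʳ q))) (trans (*-congʳ q+q̄) (*-identityˡ _)) ⟩
        q + q̄ + c * h
          ≈⟨ +-congʳ q+q̄ ⟩
        1# + c * h ∎)) (≤-reflexive (sym ρ+κ))))
      where
      open ≤-Reasoning
      X = q * a′ + q̄ * a

    module _ {q q̄ : Carrier} (q+q̄ : q + q̄ ≈ 1#) (q+2h≤c : q + (h + h) ≤ c) where
      open ≤-Reasoning

      Y : Carrier
      Y = q * a + q̄ * a′

      -- The difference of a a′ and `Y` is h (c - q) - c c̄ h²; the first term is at least 2h², the
      -- second at most h².
      numerator : Y + h * h ≤ a * a′
      numerator = +-cancelʳ-≤ (c̄ * h + c * h * (c̄ * h)) (begin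
        Y + h * h + (c̄ * h + c * h * (c̄ * h))
          ≈⟨ solve 4 (λ Y h c̄ c → Y :+ h :* h :+ (c̄ :* h :+ c :* h :* (c̄ :* h)) :=
               Y :+ c̄ :* h :+ (h :* h :+ c :* h :* (c̄ :* h))) refl Y h c̄ c ⟩
        Y + c̄ * h + (h * h + c * h * (c̄ * h))
          ≈⟨ +-congʳ Y+c̄h ⟩
        1# + q * h + (h * h + c * h * (c̄ * h))
          ≤⟨ +-monoʳ-≤ _ (+-monoʳ-≤ (h * h) (*-mono-≤ (0≤* 0≤c 0≤h) 0≤h
               (≤-trans (*-monoʳ-≤ 0≤h c≤1) (≤-reflexive (*-identityˡ h))) c̄h≤h)) ⟩
        1# + q * h + (h * h + h * h)
          ≈⟨ solve 2 (λ q h → con 1 :+ q :* h :+ (h :* h :+ h :* h) := con 1 :+ (q :+ (h :+ h)) :* h) refl q h ⟩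
        1# + (q + (h + h)) * h
          ≤⟨ +-monoʳ-≤ 1# (*-monoʳ-≤ 0≤h q+2h≤c) ⟩
        1# + c * h
          ≈⟨ trans (*-congˡ a′+c̄h) (*-identityʳ a) ⟨
        a * (a′ + c̄ * h)
          ≈⟨ solve 4 (λ a′ c̄ c h → (con 1 :+ c :* h) :* (a′ :+ c̄ :* h) :=
               (con 1 :+ c :* h) :* a′ :+ (c̄ :* h :+ c :* h :* (c̄ :* h))) refl a′ c̄ c h ⟩
        a * a′ + (c̄ * h + c * h * (c̄ * h)) ∎)
        where
        Y+c̄h : Y + c̄ * h ≈ 1# + q * h
        Y+c̄h = begin-equality
          Y + c̄ * h
            ≈⟨ +-congˡ (*-congʳ (trans (sym (*-identityˡ c̄)) (*-congʳ (sym q+q̄)))) ⟩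
          Y + (q + q̄) * c̄ * h
            ≈⟨ solve 6 (λ q q̄ a′ c c̄ h →
                 q :* (con 1 :+ c :* h) :+ q̄ :* a′ :+ (q :+ q̄) :* c̄ :* h :=
                 q̄ :* (a′ :+ c̄ :* h) :+ q :+ q :* ((c :+ c̄) :* h)) refl q q̄ a′ c c̄ h ⟩
          q̄ * (a′ + c̄ * h) + q + q * ((c + c̄) * h)
            ≈⟨ +-cong (+-congʳ (trans (*-congˡ a′+c̄h) (*-identityʳ q̄)))
                 (*-congˡ (trans (*-congʳ c+c̄) (*-identityˡ h))) ⟩
          q̄ + q + q * h
            ≈⟨ +-congʳ (trans (+-comm q̄ q) q+q̄) ⟩
          1# + q * h ∎

      Y≤ρaa′ : Y ≤ ρ * (a * a′)
      Y≤ρaa′ = +-cancelʳ-≤ (κ * (a * a′)) (begin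
        Y + κ * (a * a′)
          ≤⟨ +-monoʳ-≤ Y (*-monoˡ-≤ 0≤κ (*-mono-≤ (<⇒≤ 0<a) 0≤1 (+-monoʳ-≤ 1# ch≤1) a′≤1)) ⟩
        Y + κ * ((1# + 1#) * 1#)
          ≈⟨ +-congˡ (trans (solve 2 (λ x y → x :* y :* ((con 1 :+ con 1) :* con 1) := x :* (y :+ y)) refl (h * h) ½)
               (trans (*-congˡ ½+½) (*-identityʳ _))) ⟩
        Y + h * h
          ≤⟨ numerator ⟩
        a * a′
          ≈⟨ trans (*-congʳ ρ+κ) (*-identityˡ _) ⟨
        (ρ + κ) * (a * a′)
          ≈⟨ distribʳ (a * a′) ρ κ ⟩
        ρ * (a * a′) + κ * (a * a′) ∎)

      -- Clearing the denominators `a` and `a′` turns the mean of the inverse weights into `Y`.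
      other-mean : ∀ {b b′} → a * b ≈ 1# → a′ * b′ ≈ 1# → q * b′ + q̄ * b ≤ ρ
      other-mean {b} {b′} ab a′b′ = *-cancelˡ-≤ (*-pos 0<a 0<a′) (begin
        a * a′ * (q * b′ + q̄ * b)
          ≈⟨ solve 6 (λ a a′ q q̄ b b′ → a :* a′ :* (q :* b′ :+ q̄ :* b) :=
               q :* a :* (a′ :* b′) :+ q̄ :* a′ :* (a :* b)) refl a a′ q q̄ b b′ ⟩
        q * a * (a′ * b′) + q̄ * a′ * (a * b)
          ≈⟨ +-cong (trans (*-congˡ a′b′) (*-identityʳ _)) (trans (*-congˡ ab) (*-identityʳ _)) ⟩
        Y
          ≤⟨ Y≤ρaa′ ⟩
        ρ * (a * a′)
          ≈⟨ *-comm ρ _ ⟩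
        a * a′ * ρ ∎)

-- The choice of the parameters.

module Parameters (ℝ : RealNumbers) (logarithm : Reals.BinaryLogarithm ℝ) (k : ℕ) (1≤k : 1 ℕ.≤ k)
                  (Δ δ : Reals.ℝ⁺ ℝ) where
  open OrderedField ℝ hiding (zero)
  open Numerics ℝ
  open BinaryLogarithm logarithm
  open Solver using (solve; _:+_; _:*_; _:=_; con)
  open GroupProperties (CommutativeRing.+-group commutativeRing)
    using () renaming (∙-cancelʳ to +-cancelʳ)

  K L Γ h κ : Carrier
  K = fromℕ k
  L = log (fromℕ⁺ k 1≤k /⁺ δ)
  Γ = inverse (Δ *⁺ Δ)
  h = proj₁ Δ * ½ * ½
  κ = h * h * ½

  -- As κ = Δ²/32, the mean weight halves in 32 M tosses, and N such blocks bring it down to τ ≤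
  -- δ/k. Five times as many give r ≤ τ⁵, as 4rϑ² ≤ 1 requires with ϑ = 1/τ².
  M N s₀ : ℕ
  M = proj₁ (round Γ)
  N = proj₁ (round L)
  s₀ = 32 ℕ.* M ℕ.* (5 ℕ.* N)

  τ T : Carrier
  τ = ½ ^ N
  T = two ^ N

  0≤K : 0# ≤ K
  0≤K = 0≤fromℕ k

  1≤K : 1# ≤ K
  1≤K = ≤-trans (≤-reflexive (sym fromℕ-1)) (fromℕ-mono-≤ 1≤k)

  0≤Γ : 0# ≤ Γ
  0≤Γ = <⇒≤ (0<inverse (Δ *⁺ Δ))

  ΓΔ² : Γ * (proj₁ Δ * proj₁ Δ) ≈ 1#
  ΓΔ² = inverse-*ˡ (Δ *⁺ Δ)

  0<h : 0# < h
  0<h = *-pos (*-pos (proj₂ Δ) 0<½) 0<½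

  0≤κ : 0# ≤ κ
  0≤κ = 0≤* (0≤* (<⇒≤ 0<h) (<⇒≤ 0<h)) (<⇒≤ 0<½)

  32Γκ : fromℕ 32 * (Γ * κ) ≈ 1#
  32Γκ = trans (*-congʳ 32≈two⁵) (trans
    (solve 4 (λ t Γ Δ e → t :* (t :* (t :* (t :* t))) :* (Γ :* (Δ :* e :* e :* (Δ :* e :* e) :* e)) :=
        Γ :* (Δ :* Δ) :* ((e :* t) :* ((e :* t) :* ((e :* t) :* ((e :* t) :* (e :* t))))))
      refl two Γ (proj₁ Δ) ½)
    (trans (*-cong ΓΔ² (trans (*-cong ½*two (trans (*-cong ½*two (trans (*-cong ½*two
      (trans (*-cong ½*two ½*two) 1*1)) 1*1)) 1*1)) 1*1)) 1*1))
    where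
    1*1 : 1# * 1# ≈ 1#
    1*1 = *-identityˡ 1#
    32≈two⁵ : fromℕ 32 ≈ two * (two * (two * (two * two)))
    32≈two⁵ = trans (fromℕ-* 2 16) (*-congˡ (trans (fromℕ-* 2 8) (*-congˡ (trans (fromℕ-* 2 4) (*-congˡ (fromℕ-* 2 2))))))

  1≤32Mκ : 1# ≤ fromℕ (32 ℕ.* M) * κ
  1≤32Mκ = begin
    1#                         ≈⟨ 32Γκ ⟨
    fromℕ 32 * (Γ * κ)         ≤⟨ *-monoˡ-≤ (0≤fromℕ 32) (*-monoʳ-≤ 0≤κ (proj₁ (proj₂ (round Γ)))) ⟩
    fromℕ 32 * (fromℕ M * κ)   ≈⟨ *-assoc _ _ κ ⟨
    fromℕ 32 * fromℕ M * κ     ≈⟨ *-congʳ (fromℕ-* 32 M) ⟨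
    fromℕ (32 ℕ.* M) * κ       ∎
    where open ≤-Reasoning

  ρ^s₀≤τ⁵ : ∀ {ρ} → 0# ≤ ρ → ρ + κ ≈ 1# → ρ ^ s₀ ≤ τ ^ 5
  ρ^s₀≤τ⁵ {ρ} 0≤ρ ρ+κ = begin
    ρ ^ s₀                       ≈⟨ ^-assocʳ ρ (32 ℕ.* M) (5 ℕ.* N) ⟨
    (ρ ^ (32 ℕ.* M)) ^ (5 ℕ.* N) ≤⟨ ^-monoˡ-≤ (0≤^ 0≤ρ (32 ℕ.* M)) (power-halves {m = 32 ℕ.* M} 0≤κ 0≤ρ ρ+κ 1≤32Mκ) (5 ℕ.* N) ⟩
    ½ ^ (5 ℕ.* N)                ≈⟨ reflexive (≡.cong (½ ^_) (ℕ.*-comm 5 N)) ⟩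
    ½ ^ (N ℕ.* 5)                ≈⟨ ^-assocʳ ½ N 5 ⟨
    τ ^ 5                        ∎
    where open ≤-Reasoning

  two^ : ℕ → ℝ⁺
  two^ m = two ^ m , 0<^ (0<fromℕ-suc 1) m

  log-two^ : ∀ m → log (two^ m) ≈ fromℕ m
  -- The logarithm of 1 vanishes because 1 · 1 = 1 makes it equal to its double.
  log-two^ zero    = +-cancelʳ (log (two^ 0)) _ _ (trans (sym (log-* (two^ 0) (two^ 0)))
    (trans (log-cong (*-identityˡ 1#)) (sym (+-identityˡ _))))
  log-two^ (suc m) = trans (log-cong {y = fromℕ⁺ 2 (ℕ.s≤s ℕ.z≤n) *⁺ two^ m} refl)
    (trans (log-* _ (two^ m)) (+-cong log-2 (log-two^ m)))

  -- The inequality being a negation, it suffices to refute T < k/δ; taking logarithms would give N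
  -- < L.
  K/δ≤T : proj₁ (fromℕ⁺ k 1≤k /⁺ δ) ≤ T
  K/δ≤T T<K/δ = proj₁ (proj₂ (round L)) (<-respˡ-≈ (log-two^ N) (log-mono {two^ N} T<K/δ))

  fromℕ⁺-value : ∀ k (1≤k : 1 ℕ.≤ k) → proj₁ (fromℕ⁺ k 1≤k) ≡ fromℕ k
  fromℕ⁺-value (suc k) _ = ≡.refl

  K/δ*δ : proj₁ (fromℕ⁺ k 1≤k /⁺ δ) * proj₁ δ ≈ K
  K/δ*δ = trans (*-assoc _ _ _) (trans (*-congˡ (inverse-*ˡ δ))
    (trans (*-identityʳ _) (reflexive (fromℕ⁺-value k 1≤k))))

  τT : τ * T ≈ 1#
  τT = trans (sym (^-distrib-* ½ two N)) (trans (^-congˡ N ½*two) (1^≈1 N))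

  0≤τ : 0# ≤ τ
  0≤τ = 0≤^ (<⇒≤ 0<½) N

  Kτ≤δ : K * τ ≤ proj₁ δ
  Kτ≤δ = begin
    K * τ                                          ≈⟨ *-congʳ K/δ*δ ⟨
    proj₁ (fromℕ⁺ k 1≤k /⁺ δ) * proj₁ δ * τ        ≤⟨ *-monoʳ-≤ 0≤τ (*-monoʳ-≤ (<⇒≤ (proj₂ δ)) K/δ≤T) ⟩
    T * proj₁ δ * τ                                ≈⟨ solve 3 (λ T δ τ → T :* δ :* τ := τ :* T :* δ) refl T (proj₁ δ) τ ⟩
    τ * T * proj₁ δ                                ≈⟨ trans (*-congʳ τT) (*-identityˡ _) ⟩
    proj₁ δ                                        ∎
    where open ≤-Reasoning

  module _ (δ<½ : proj₁ δ < ½) where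

    1<L : 1# < L
    1<L = <-respˡ-≈ log-2 (log-mono (*-cancelˡ-< (proj₂ δ) (<-≤-trans 2δ<1
      (≤-trans 1≤K (≤-reflexive (trans (sym K/δ*δ) (*-comm _ _)))))))
      where
      2δ<1 : proj₁ δ * two < 1#
      2δ<1 = <-respˡ-≈ (*-comm two _) (<-respʳ-≈ (trans (*-comm two ½) ½*two)
        (*-monoˡ-< (0<fromℕ-suc 1) δ<½))

    -- From δ < ½ follow k/δ > 2 and L > 1. The resulting τ ≤ 1/4 absorbs the factors 4 in the
    -- estimates below.
    2≤N : 2 ℕ.≤ N
    2≤N = bound N (<-≤-trans 1<L (proj₁ (proj₂ (round L))))
      where
      bound : ∀ m → 1# < fromℕ m → 2 ℕ.≤ m
      bound zero          lt = ⊥-elim (<-asym lt 0<1)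
      bound (suc zero)    lt = ⊥-elim (<-irrefl (sym fromℕ-1) lt)
      bound (suc (suc m)) lt = ℕ.s≤s (ℕ.s≤s ℕ.z≤n)

    τ≤½½ : τ ≤ ½ * ½
    τ≤½½ = ≤-trans (^-antitoneʳ-≤ (<⇒≤ 0<½) ½≤1 2≤N) (≤-reflexive (*-congˡ (*-identityʳ ½)))

    4τ≤1 : τ + τ + (τ + τ) ≤ 1#
    4τ≤1 = ≤-trans (+-mono-≤ (+-mono-≤ τ≤½½ τ≤½½) (+-mono-≤ τ≤½½ τ≤½½))
      (≤-reflexive (trans (+-cong (x½+x½ ½) (x½+x½ ½)) ½+½))

    1≤T : 1# ≤ T
    1≤T = ≤-trans (≤-reflexive (sym (1^≈1 N))) (^-monoˡ-≤ 0≤1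
      (≤-trans (≤-reflexive (sym fromℕ-1)) (fromℕ-mono-≤ {1} {2} (ℕ.s≤s ℕ.z≤n))) N)

    τ≤1 : τ ≤ 1#
    τ≤1 = ≤-trans (x≤x+y 0≤τ) (≤-trans (x≤x+y (0≤+ 0≤τ 0≤τ)) 4τ≤1)

    2Kτ≤1 : K * τ + K * τ ≤ 1#
    2Kτ≤1 = ≤-trans (+-mono-≤ Kτ≤½ Kτ≤½) (≤-reflexive ½+½)
      where
      Kτ≤½ : K * τ ≤ ½
      Kτ≤½ = ≤-trans Kτ≤δ (<⇒≤ δ<½)

    0≤Kτ : 0# ≤ K * τ
    0≤Kτ = 0≤* 0≤K 0≤τ

    Kτ≤1 : K * τ ≤ 1#
    Kτ≤1 = ≤-trans (x≤x+y 0≤Kτ) 2Kτ≤1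

    private
      0≤4τ : 0# ≤ τ + τ + (τ + τ)
      0≤4τ = 0≤+ (0≤+ 0≤τ 0≤τ) (0≤+ 0≤τ 0≤τ)

      shrink : ∀ {x y} → 0# ≤ y → x ≤ 1# → x * y ≤ y
      shrink 0≤y x≤1 = ≤-trans (*-monoʳ-≤ 0≤y x≤1) (≤-reflexive (*-identityˡ _))

    module _ {r : Carrier} (0≤r : 0# ≤ r) (r≤τ⁵ : r ≤ τ ^ 5) where
      open Challenge ℝ k s₀

      calibration : Calibration r
      calibration = record
        { θ = τ * τ
        ; ϑ = T * T
        ; 0≤r = 0≤r
        ; 0≤θ = 0≤* 0≤τ 0≤τ
        ; 0≤ϑ = 0≤* 0≤T 0≤T
        ; 1≤ϑ = ≤-trans (≤-reflexive (sym (*-identityˡ 1#))) (*-mono-≤ 0≤1 0≤T 1≤T 1≤T)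
        ; θϑ  = trans (solve 2 (λ x y → x :* x :* (y :* y) := (x :* y) :* (x :* y)) refl τ T)
                  (trans (*-cong τT τT) (*-identityˡ 1#))
        -- Four of the five factors τ cancel against ϑ² = T⁴, and the fifth absorbs the 4.
        ; r-small = begin
            (r + r + (r + r)) * (T * T * (T * T))
              ≤⟨ *-monoʳ-≤ (0≤* (0≤* 0≤T 0≤T) (0≤* 0≤T 0≤T))
                   (+-mono-≤ (+-mono-≤ r≤τ⁵ r≤τ⁵) (+-mono-≤ r≤τ⁵ r≤τ⁵)) ⟩
            (τ ^ 5 + τ ^ 5 + (τ ^ 5 + τ ^ 5)) * (T * T * (T * T))
              ≈⟨ solve 2 (λ τ T → let τ⁵ = τ :* (τ :* (τ :* (τ :* (τ :* con 1)))) in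
                   (τ⁵ :+ τ⁵ :+ (τ⁵ :+ τ⁵)) :* (T :* T :* (T :* T)) :=
                   (τ :* T) :* ((τ :* T) :* ((τ :* T) :* ((τ :* T) :* (τ :+ τ :+ (τ :+ τ)))))) refl τ T ⟩
            (τ * T) * ((τ * T) * ((τ * T) * ((τ * T) * (τ + τ + (τ + τ)))))
              ≈⟨ unit (unit (unit (unit refl))) ⟩
            τ + τ + (τ + τ)
              ≤⟨ 4τ≤1 ⟩
            1# ∎
        ; θ+r-small = begin
            τ * τ + fromℕ (k ℕ.+ k) * (r + r)
              ≤⟨ +-mono-≤ (shrink 0≤τ τ≤1)
                   (*-mono-≤ (0≤fromℕ (k ℕ.+ k)) (0≤+ (0≤^ 0≤τ 5) (0≤^ 0≤τ 5)) (≤-reflexive (fromℕ-+ k k))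
                     (+-mono-≤ r≤τ⁵ r≤τ⁵)) ⟩
            τ + (K + K) * (τ ^ 5 + τ ^ 5)
              ≈⟨ +-congˡ (solve 2 (λ K τ → let τ⁵ = τ :* (τ :* (τ :* (τ :* (τ :* con 1)))) in
                   (K :+ K) :* (τ⁵ :+ τ⁵) := (K :* τ) :* ((τ :+ τ :+ (τ :+ τ)) :* (τ :* (τ :* τ)))) refl K τ) ⟩
            τ + (K * τ) * ((τ + τ + (τ + τ)) * (τ * (τ * τ)))
              ≤⟨ +-monoʳ-≤ τ (≤-trans (shrink (0≤* 0≤4τ (0≤* 0≤τ (0≤* 0≤τ 0≤τ))) Kτ≤1)
                   (≤-trans (shrink (0≤* 0≤τ (0≤* 0≤τ 0≤τ)) 4τ≤1)
                     (≤-trans (shrink (0≤* 0≤τ 0≤τ) τ≤1) (shrink 0≤τ τ≤1)))) ⟩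
            τ + τ
              ≤⟨ x≤x+y (0≤+ 0≤τ 0≤τ) ⟩
            τ + τ + (τ + τ)
              ≤⟨ 4τ≤1 ⟩
            1# ∎
        }
        where
        open ≤-Reasoning
        0≤T : 0# ≤ T
        0≤T = ≤-trans 0≤1 1≤T
        unit : ∀ {x y} → x ≈ y → (τ * T) * x ≈ y
        unit x≈y = trans (*-congʳ τT) (trans (*-identityˡ _) x≈y)

      -- The union bound over k top coins, each lost with chance at most η + ζ k. Every factor K, up
      -- to three of them, is matched with a τ, as Kτ ≤ δ < ½. What is left is Kτ times at most 3τ ≤
      -- 1.
      total-failure : K * ((τ * τ) ^ 1 + (r ^ 1 + r ^ 1 + (r ^ 1 + r ^ 1)) + fromℕ (k ℕ.+ k) * r * K) ≤ proj₁ δ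
      total-failure = begin
        K * ((τ * τ) ^ 1 + (r ^ 1 + r ^ 1 + (r ^ 1 + r ^ 1)) + fromℕ (k ℕ.+ k) * r * K)
          ≈⟨ *-congˡ (+-congˡ (*-congʳ (*-congʳ (fromℕ-+ k k)))) ⟩
        K * ((τ * τ) ^ 1 + (r ^ 1 + r ^ 1 + (r ^ 1 + r ^ 1)) + (K + K) * r * K)
          ≈⟨ solve 3 (λ K τ r → K :* (τ :* τ :* con 1 :+ (r :* con 1 :+ r :* con 1 :+ (r :* con 1 :+ r :* con 1))
                 :+ (K :+ K) :* r :* K) :=
               K :* (τ :* τ) :+ (K :* (con 1 :+ con 1 :+ (con 1 :+ con 1)) :+ K :* ((K :+ K) :* K)) :* r) refl K τ r ⟩
        K * (τ * τ) + (K * (1# + 1# + (1# + 1#)) + K * ((K + K) * K)) * r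
          ≤⟨ +-monoʳ-≤ _ (*-monoˡ-≤ (0≤+ (0≤* 0≤K (0≤+ (0≤+ 0≤1 0≤1) (0≤+ 0≤1 0≤1)))
               (0≤* 0≤K (0≤* (0≤+ 0≤K 0≤K) 0≤K))) r≤τ⁵) ⟩
        K * (τ * τ) + (K * (1# + 1# + (1# + 1#)) + K * ((K + K) * K)) * τ ^ 5
          ≈⟨ solve 2 (λ K τ → let τ⁵ = τ :* (τ :* (τ :* (τ :* (τ :* con 1)))) in
               K :* (τ :* τ) :+ (K :* (con 1 :+ con 1 :+ (con 1 :+ con 1)) :+ K :* ((K :+ K) :* K)) :* τ⁵ :=
               (K :* τ) :* (τ :+ ((τ :+ τ :+ (τ :+ τ)) :* (τ :* (τ :* τ)) :+
                 (K :* τ :+ K :* τ) :* ((K :* τ) :* (τ :* τ))))) refl K τ ⟩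
        (K * τ) * (τ + ((τ + τ + (τ + τ)) * (τ * (τ * τ)) + (K * τ + K * τ) * ((K * τ) * (τ * τ))))
          ≤⟨ *-monoˡ-≤ 0≤Kτ (+-monoʳ-≤ τ (+-mono-≤
               (≤-trans (shrink (0≤* 0≤τ (0≤* 0≤τ 0≤τ)) 4τ≤1) (≤-trans (shrink (0≤* 0≤τ 0≤τ) τ≤1) (shrink 0≤τ τ≤1)))
               (≤-trans (shrink (0≤* 0≤Kτ (0≤* 0≤τ 0≤τ)) 2Kτ≤1)
                 (≤-trans (shrink (0≤* 0≤τ 0≤τ) Kτ≤1) (shrink 0≤τ τ≤1))))) ⟩
        (K * τ) * (τ + (τ + τ))
          ≤⟨ *-monoˡ-≤ 0≤Kτ (≤-trans (x≤x+y 0≤τ) (≤-trans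
               (≤-reflexive (solve 1 (λ τ → τ :+ (τ :+ τ) :+ τ := τ :+ τ :+ (τ :+ τ)) refl τ)) 4τ≤1)) ⟩
        (K * τ) * 1#
          ≈⟨ *-identityʳ _ ⟩
        K * τ
          ≤⟨ Kτ≤δ ⟩
        proj₁ δ ∎
        where open ≤-Reasoning

    three : Carrier
    three = fromℕ 3

    x+two≤three*x : ∀ {x} → 1# ≤ x → x + two ≤ three * x
    x+two≤three*x {x} 1≤x = ≤-trans (+-monoʳ-≤ x (≤-trans (≤-reflexive (sym (*-identityʳ two)))
      (*-monoˡ-≤ (0≤fromℕ 2) 1≤x))) (≤-reflexive (trans (+-congʳ (sym (*-identityˡ x))) (sym (distribʳ x 1# two))))

    -- The factor 1920 is 12 · 32 · 5. Rounding adds at most 2 to Γ ≥ 1 and to L > 1, hence at most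
    -- triples each, and 1920 · 9 = 17280.
    toss-bound : proj₁ Δ ≤ 1# → ∀ n →
      fromℕ (12 ℕ.* s₀ ℕ.* n) ≤ fromℕ 17280 * (fromℕ n / (Δ *⁺ Δ)) * L
    toss-bound Δ≤1 n = begin
      fromℕ (12 ℕ.* s₀ ℕ.* n)
        ≈⟨ reflexive (≡.cong fromℕ (reorder M N n)) ⟩
      fromℕ (1920 ℕ.* (M ℕ.* N ℕ.* n))
        ≈⟨ trans (fromℕ-* 1920 (M ℕ.* N ℕ.* n)) (*-congˡ (trans (fromℕ-* (M ℕ.* N) n) (*-congʳ (fromℕ-* M N)))) ⟩
      fromℕ 1920 * (fromℕ M * fromℕ N * fromℕ n)
        ≤⟨ *-monoˡ-≤ (0≤fromℕ 1920) (*-monoʳ-≤ (0≤fromℕ n)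
             (*-mono-≤ (0≤fromℕ M) (0≤* (0≤fromℕ 3) 0≤L) M≤3Γ N≤3L)) ⟩
      fromℕ 1920 * ((three * Γ) * (three * L) * fromℕ n)
        ≈⟨ solve 5 (λ c t Γ L n → c :* ((t :* Γ) :* (t :* L) :* n) := c :* (t :* t) :* (n :* Γ) :* L) refl
             (fromℕ 1920) three Γ L (fromℕ n) ⟩
      fromℕ 1920 * (three * three) * (fromℕ n * Γ) * L
        ≈⟨ *-congʳ (*-congʳ (trans (*-congˡ (sym (fromℕ-* 3 3))) (sym (fromℕ-* 1920 9)))) ⟩
      fromℕ 17280 * (fromℕ n * Γ) * L ∎
      where
      open ≤-Reasoning
      0≤L : 0# ≤ L
      0≤L = <⇒≤ (<-trans 0<1 1<L)
      1≤Γ : 1# ≤ Γ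
      1≤Γ = ≤-trans (≤-reflexive (sym ΓΔ²)) (≤-trans
        (*-monoˡ-≤ 0≤Γ (*-≤1 (<⇒≤ (proj₂ Δ)) Δ≤1 Δ≤1)) (≤-reflexive (*-identityʳ Γ)))
      M≤3Γ : fromℕ M ≤ three * Γ
      M≤3Γ = ≤-trans (proj₂ (proj₂ (round Γ)) 0≤Γ) (x+two≤three*x 1≤Γ)
      N≤3L : fromℕ N ≤ three * L
      N≤3L = ≤-trans (proj₂ (proj₂ (round L)) 0≤L) (x+two≤three*x (<⇒≤ 1<L))
      reorder : ∀ M N n → 12 ℕ.* (32 ℕ.* M ℕ.* (5 ℕ.* N)) ℕ.* n ≡ 1920 ℕ.* (M ℕ.* N ℕ.* n)
      reorder = S.solve 3 (λ M N n → S.con 12 S.:* (S.con 32 S.:* M S.:* (S.con 5 S.:* N)) S.:* n S.:=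
        S.con 1920 S.:* (M S.:* N S.:* n)) ≡.refl
        where module S = +-*-Solver

-- Counting top coins.

lookup-injective : ∀ {A : Set} {xs : List A} → Unique xs → ∀ {i j} → List.lookup xs i ≡ List.lookup xs j → i ≡ j
lookup-injective (_  ∷ _) {zero}  {zero}  eq = ≡.refl
lookup-injective (x∉ ∷ _) {zero}  {suc j} eq = ⊥-elim (All.lookup x∉ (∈-lookup j) eq)
lookup-injective (x∉ ∷ _) {suc i} {zero}  eq = ⊥-elim (All.lookup x∉ (∈-lookup i) (≡.sym eq))
lookup-injective (_  ∷ u) {suc i} {suc j} eq = ≡.cong suc (lookup-injective u eq)

module _ {n : ℕ} (σ : Permutation′ n) (k : ℕ) where

  rank : Fin n → ℕ
  rank c = toℕ (σ ⟨$⟩ˡ c)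

  rank-injective : ∀ {c c′} → rank c ≡ rank c′ → c ≡ c′
  rank-injective eq = ≡.trans (≡.sym (inverseʳ σ)) (≡.trans (≡.cong (σ ⟨$⟩ʳ_) (Fin.toℕ-injective eq)) (inverseʳ σ))

  -- By position in the ranking and not by bias, which keeps it decidable.
  Top : Fin n → Set
  Top c = rank c ℕ.< k

  top? : Decidable Top
  top? c = rank c ℕ.<? k

  -- The ranks embed a list of top coins without repetitions into `Fin k`.
  few-tops : ∀ cs → Unique cs → All Top cs → length cs ℕ.≤ k
  few-tops cs unique tops = Fin.injective⇒≤ {f = λ i → fromℕ< (All.lookup tops (∈-lookup i))}
    λ eq → lookup-injective unique (rank-injective (Fin.fromℕ<-injective _ _ _ _ eq))

  module _ (k≤n : k ℕ.≤ n) where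

    topCoin : Fin k → Fin n
    topCoin j = σ ⟨$⟩ʳ inject≤ j k≤n

    rank-topCoin : ∀ j → rank (topCoin j) ≡ toℕ j
    rank-topCoin j = ≡.trans (≡.cong toℕ (inverseˡ σ)) (Fin.toℕ-inject≤ j k≤n)

    top-topCoin : ∀ j → Top (topCoin j)
    top-topCoin j = ≡.subst (ℕ._< k) (≡.sym (rank-topCoin j)) (Fin.toℕ<n j)

    topCoin-rank : ∀ {c} (top : Top c) → topCoin (fromℕ< top) ≡ c
    topCoin-rank top = rank-injective (≡.trans (rank-topCoin (fromℕ< top)) (Fin.toℕ-fromℕ< top))

    -- Any further coin would be a (k + 1)-st one in at most k slots.
    kept-top : ∀ {s} (kept : Vec (Fin n) s) → s ℕ.≤ k → (∀ j → ∃ λ i → lookup kept i ≡ topCoin j) →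
               ∀ i → Top (lookup kept i)
    kept-top {s} kept s≤k slot i = decidable-stable (top? (lookup kept i)) λ ¬top →
      ℕ.<⇒≱ (Fin.injective⇒≤ (slots-injective ¬top)) s≤k
      where
      slots : Fin (suc k) → Fin s
      slots zero    = i
      slots (suc j) = proj₁ (slot j)
      slots-injective : ¬ Top (lookup kept i) → ∀ {j j′} → slots j ≡ slots j′ → j ≡ j′
      slots-injective ¬top {zero}  {zero}   eq = ≡.refl
      slots-injective ¬top {zero}  {suc j′} eq = ⊥-elim (¬top (≡.subst Top
        (≡.trans (≡.sym (proj₂ (slot j′))) (≡.cong (lookup kept) (≡.sym eq))) (top-topCoin j′)))
      slots-injective ¬top {suc j} {zero}   eq = ⊥-elim (¬top (≡.subst Top
        (≡.trans (≡.sym (proj₂ (slot j))) (≡.cong (lookup kept) eq)) (top-topCoin j)))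
      slots-injective ¬top {suc j} {suc j′} eq = ≡.cong suc (Fin.toℕ-injective
        (≡.trans (≡.sym (rank-topCoin j)) (≡.trans (≡.cong rank
          (≡.trans (≡.sym (proj₂ (slot j))) (≡.trans (≡.cong (lookup kept) eq) (proj₂ (slot j′)))))
          (rank-topCoin j′))))

-- The union bound over the top coins and the conclusion.

module FindingTop (ℝ : RealNumbers) where
  open OrderedField ℝ hiding (zero)
  open Numerics ℝ
  open Expectation ℝ

  ∑ : ∀ m → (Fin m → Carrier) → Carrier
  ∑ zero    f = 0#
  ∑ (suc m) f = f zero + ∑ m (λ j → f (suc j))

  E-∑ : ∀ {A : Set} (d : Dist A) m (f : Fin m → A → Carrier) →
        E d (λ a → ∑ m (λ j → f j a)) ≈ ∑ m (λ j → E d (f j))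
  E-∑ d zero    f = E-const d 0#
  E-∑ d (suc m) f = trans (E-+ d (f zero) _) (+-congˡ (E-∑ d m (λ j → f (suc j))))

  ∑-≤ : ∀ m {f v} → (∀ j → f j ≤ v) → ∑ m f ≤ fromℕ m * v
  ∑-≤ zero    {v = v} f≤v = ≤-reflexive (sym (zeroˡ v))
  ∑-≤ (suc m) {v = v} f≤v = ≤-trans (+-mono-≤ (f≤v zero) (∑-≤ m (λ j → f≤v (suc j))))
    (≤-reflexive (trans (+-congʳ (sym (*-identityˡ v))) (sym (distribʳ v 1# (fromℕ m)))))

  0≤∑ : ∀ m {f} → (∀ j → 0# ≤ f j) → 0# ≤ ∑ m f
  0≤∑ zero    0≤f = ≤-refl
  0≤∑ (suc m) 0≤f = 0≤+ (0≤f zero) (0≤∑ m (λ j → 0≤f (suc j)))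

  term≤∑ : ∀ m {f} → (∀ j → 0# ≤ f j) → ∀ j → f j ≤ ∑ m f
  term≤∑ (suc m) 0≤f zero    = x≤x+y (0≤∑ m (λ j → 0≤f (suc j)))
  term≤∑ (suc m) 0≤f (suc j) = ≤-trans (term≤∑ m (λ j → 0≤f (suc j)) j) (x≤y+x (0≤f zero))

  module _ {n : ℕ} (p : Fin n → UnitInterval) (σ : Permutation′ n) (ranking : IsRanking p σ) where

    top-bias : ∀ k (1≤k : 1 ℕ.≤ k) (k≤n : k ℕ.≤ n) c → Top σ k c →
      value (p (coin[ k ] σ 1≤k k≤n)) ≤ value (p c)
    top-bias (suc k) 1≤k k<n c top = ≡.subst (λ c → value (p (σ ⟨$⟩ʳ fromℕ< k<n)) ≤ value (p c)) (inverseʳ σ)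
      (ranking (σ ⟨$⟩ˡ c) (fromℕ< k<n) (≡.subst (rank σ (suc k) c ℕ.≤_) (≡.sym (Fin.toℕ-fromℕ< k<n)) (ℕ.s≤s⁻¹ top)))

    other-bias : ∀ k (k<n : k ℕ.< n) c → ¬ Top σ k c →
      value (p c) ≤ value (p (coin[ suc k ] σ (ℕ.s≤s ℕ.z≤n) k<n))
    other-bias k k<n c ¬top = ≡.subst (λ c → value (p c) ≤ value (p (σ ⟨$⟩ʳ fromℕ< k<n))) (inverseʳ σ)
      (ranking (fromℕ< k<n) (σ ⟨$⟩ˡ c) (≡.subst (ℕ._≤ rank σ k c) (≡.sym (Fin.toℕ-fromℕ< k<n)) (ℕ.≮⇒≥ ¬top)))

  module _ (logarithm : BinaryLogarithm) (k : ℕ) (1≤k : 1 ℕ.≤ k) (Δ δ : ℝ⁺) (δ<½ : proj₁ δ < ½) where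
    open Parameters ℝ logarithm k 1≤k Δ δ hiding (κ; 0≤κ)
    open Algorithm ℝ k s₀ using (algorithm)
    open Challenge ℝ k s₀
    open StreamInvariant ℝ k s₀ 1≤k
    open StreamLoss ℝ k s₀ 1≤k

    module _ {n : ℕ} (k<n : k ℕ.< n) (p : Fin n → UnitInterval) (σ : Permutation′ n)
             (ranking : IsRanking p σ) (gap≈Δ : gap p σ k 1≤k k<n ≈ proj₁ Δ) where

      k≤n : k ℕ.≤ n
      k≤n = ℕ.<⇒≤ k<n

      p[k] p[k+1] middle : Carrier
      p[k]   = value (p (coin[ k ] σ 1≤k k≤n))
      p[k+1] = value (p (coin[ suc k ] σ (ℕ.s≤s ℕ.z≤n) k<n))
      middle = p[k+1] + (h + h)

      p[k+1]+Δ : p[k+1] + proj₁ Δ ≈ p[k]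
      p[k+1]+Δ = trans (+-congˡ (sym gap≈Δ)) x+y-x

      4h≈Δ : h + h + (h + h) ≈ proj₁ Δ
      4h≈Δ = trans (+-cong (x½+x½ _) (x½+x½ _)) (x½+x½ _)

      middle+2h : middle + (h + h) ≈ p[k]
      middle+2h = trans (+-assoc _ _ _) (trans (+-congˡ 4h≈Δ) p[k+1]+Δ)

      Δ≤1 : proj₁ Δ ≤ 1#
      Δ≤1 = ≤-trans (x≤y+x (0≤value (p _))) (≤-trans (≤-reflexive p[k+1]+Δ) (value≤1 (p _)))

      open Weights h middle 0<h (0≤+ (0≤value (p _)) (0≤+ (<⇒≤ 0<h) (<⇒≤ 0<h)))
        (≤-trans (≤-reflexive middle+2h) (value≤1 (p _)))

      separation : Separation p (Top σ k)
      separation = record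
        { a = a ; a′ = a′ ; b = inverse (a , 0<a) ; b′ = inverse (a′ , 0<a′) ; ρ = ρ
        ; 0≤a  = <⇒≤ 0<a
        ; 0≤a′ = <⇒≤ 0<a′
        ; 0≤b  = <⇒≤ (0<inverse (a , 0<a))
        ; 0≤b′ = <⇒≤ (0<inverse (a′ , 0<a′))
        ; 0≤ρ  = 0≤ρ
        ; a′≤a = a′≤a
        ; ab   = inverse-*ʳ (a , 0<a)
        ; a′b′ = inverse-*ʳ (a′ , 0<a′)
        ; top-mean   = λ c top → top-mean x+y-x
            (≤-trans (≤-reflexive middle+2h) (top-bias p σ ranking k 1≤k k≤n c top))
        ; other-mean = λ c ¬top → other-mean x+y-x
            (+-monoˡ-≤ (h + h) (other-bias p σ ranking k k<n c ¬top))
            (inverse-*ʳ (a , 0<a)) (inverse-*ʳ (a′ , 0<a′))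
        }
        where
        inverse-*ʳ : ∀ y → proj₁ y * inverse y ≈ 1#
        inverse-*ʳ y = trans (*-comm _ _) (inverse-*ˡ y)

      open Separation separation using (r; 0≤r)

      calibrated : Calibration r
      calibrated = calibration δ<½ 0≤r (ρ^s₀≤τ⁵ 0≤ρ ρ+κ)

      coin : Fin k → Fin n
      coin = topCoin σ k k≤n

      miss : Fin k → Outcome n → Carrier
      miss j o = if does (coin j ∈? Outcome.output o) then 0# else 1#

      miss-bound : ∀ j → E (run p algorithm) (miss j) ≤
        (τ * τ) ^ 1 + (r ^ 1 + r ^ 1 + (r ^ 1 + r ^ 1)) + fromℕ (k ℕ.+ k) * r * K
      miss-bound j = ≤-trans
        (loss-bounded (top? σ k) separation calibrated (few-tops σ k) (coin j) (top-topCoin σ k k≤n j)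
          (List.allFin n) (Unique.allFin⁺ n) (initially {p = p} (List.allFin n))
          (future (∈-allFin (coin j))))
        -- The memory starts empty and at most k top coins arrive, so ζ is charged at most k times.
        (+-monoʳ-≤ _ (*-monoˡ-≤ (0≤* (0≤fromℕ (k ℕ.+ k)) 0≤r) (fromℕ-mono-≤
          (ℕ.≤-trans (ℕ.≤-reflexive (ℕ.+-identityʳ _))
            (topCount≤k (top? σ k) separation calibrated (few-tops σ k) (coin j) (top-topCoin σ k k≤n j)
              (Unique.allFin⁺ n))))))

      -- The top coins in the output already fill the at most k kept slots, so no other coin can be
      -- in it.
      finds : ∀ {o : Outcome n} → Final {p = p} o → (∀ j → coin j ∈ˢ Outcome.output o) → FindsTop σ k o
      finds {o} final found = ≡.trans (≡.sym (tabulate∘lookup (Outcome.output o))) (tabulate-cong agree)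
        where
        open Final final
        slot : ∀ {c} → c ∈ˢ Outcome.output o → ∃ λ i → lookup kept i ≡ c
        slot {c} c∈ = ∈-⋃-slots⁻ kept (List.allFin size) (≡.subst (c ∈ˢ_) output≡ c∈)
        kept-tops : ∀ i → Top σ k (lookup kept i)
        kept-tops = kept-top σ k k≤n kept kept≤k (λ j → slot (found j))
        agree : ∀ c → lookup (Outcome.output o) c ≡ does (top? σ k c)
        agree c = does-≡ (top? σ k c)
          (λ top → []=⇒lookup (≡.subst (_∈ˢ Outcome.output o) (topCoin-rank σ k k≤n top) (found (fromℕ< top))))
          (λ ¬top → ¬-not λ inside → ¬top (≡.subst (Top σ k) (proj₂ (slot (lookup⇒[]= c _ inside)))
            (kept-tops (proj₁ (slot (lookup⇒[]= c _ inside))))))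
          where
          does-≡ : ∀ {P : Set} (P? : Dec P) {b} → (P → b ≡ true) → (¬ P → b ≡ false) → b ≡ does P?
          does-≡ (yes x) b≡true b≡false = b≡true x
          does-≡ (no ¬x) b≡true b≡false = b≡false ¬x

      hit : Outcome n → Carrier
      hit o = if does (findsTop? σ k o) then 1# else 0#

      0≤miss : ∀ j o → 0# ≤ miss j o
      0≤miss j o with does (coin j ∈? Outcome.output o)
      ... | true  = ≤-refl
      ... | false = 0≤1

      0≤hit : ∀ o → 0# ≤ hit o
      0≤hit o with does (findsTop? σ k o)
      ... | true  = 0≤1
      ... | false = ≤-refl

      -- A wrong output lacks some top coin, so the failure probability is at most the expected
      -- number of missing top coins.
      hit-or-miss : ∀ o → Final {p = p} o → 1# ≤ hit o + ∑ k (λ j → miss j o)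
      hit-or-miss o final = split (Fin.any? (λ j → ¬? (coin j ∈? Outcome.output o)))
        where
        split : Dec (∃ λ j → ¬ (coin j ∈ˢ Outcome.output o)) → 1# ≤ hit o + ∑ k (λ j → miss j o)
        split (yes (j , missing)) = ≤-trans
          (≤-reflexive (reflexive (≡.cong (if_then 0# else 1#) (≡.sym (dec-false (coin j ∈? Outcome.output o) missing)))))
          (≤-trans (term≤∑ k (λ j → 0≤miss j o) j) (x≤y+x (0≤hit o)))
        split (no none) = ≤-trans
          (≤-reflexive (reflexive (≡.cong (if_then 1# else 0#) (≡.sym (dec-true (findsTop? σ k o) (finds final
            λ j → decidable-stable (coin j ∈? Outcome.output o) λ j∉ → none (j , j∉)))))))
          (x≤x+y (0≤∑ k (λ j → 0≤miss j o)))

      success : 1# - proj₁ δ ≤ Pr[ findsTop? σ k ] (run p algorithm)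
      success = +-cancelʳ-≤ (proj₁ δ) (begin
        1# - proj₁ δ + proj₁ δ
          ≈⟨ trans (+-comm _ _) x+y-x ⟩
        1#
          ≈⟨ E-const d 1# ⟨
        E d (λ _ → 1#)
          ≤⟨ E-mono d (run-surely {p = p} k≤n) hit-or-miss ⟩
        E d (λ o → hit o + ∑ k (λ j → miss j o))
          ≈⟨ trans (E-+ d hit _) (+-cong (reflexive (≡.sym (Pr≡E (findsTop? σ k) d))) (E-∑ d k miss)) ⟩
        Pr[ findsTop? σ k ] d + ∑ k (λ j → E d (miss j))
          ≤⟨ +-monoʳ-≤ _ (≤-trans (∑-≤ k miss-bound) (total-failure δ<½ 0≤r (ρ^s₀≤τ⁵ 0≤ρ ρ+κ))) ⟩
        Pr[ findsTop? σ k ] d + proj₁ δ ∎)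
        where
        open ≤-Reasoning
        d = run p algorithm

      resources : Surely
        (λ o → (fromℕ (Outcome.tosses o) ≤ fromℕ 17280 * (fromℕ n / (Δ *⁺ Δ)) * BinaryLogarithm.log logarithm (fromℕ⁺ k 1≤k /⁺ δ)) ×
               (Outcome.peakMemory o ℕ.≤ 17280 ℕ.* k))
        (run p algorithm)
      resources = surely-map (run p algorithm)
        (λ o final → ≤-trans (fromℕ-mono-≤ (Final.tosses≤ final)) (toss-bound δ<½ Δ≤1 n) ,
          -- Memory needs only the factor 2; the statement has one constant for both bounds, and the
          -- tosses determine it.
          ℕ.≤-trans (Final.peak≤ final) (ℕ.≤-trans (ℕ.+-monoʳ-≤ k (ℕ.m≤m+n k 0))
            (ℕ.*-monoˡ-≤ k {2} {17280} (ℕ.s≤s (ℕ.s≤s ℕ.z≤n)))))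
        (run-surely {p = p} k≤n)

theorem2 : (ℝ : RealNumbers) →
    let open Streaming ℝ in
    (logarithm : BinaryLogarithm) →
    let open BinaryLogarithm logarithm in
    ∃ λ (C : ℕ) →
    ∀ (k : ℕ) (1≤k : 1 ℕ.≤ k) (Δ δ : ℝ⁺) → proj₁ δ < ½ →
    Σ StreamingAlgorithm λ alg →
    ∀ (n : ℕ) (k<n : k ℕ.< n) (p : Fin n → UnitInterval) (σ : Permutation′ n) →
    IsRanking p σ →
    gap p σ k 1≤k k<n ≈ proj₁ Δ →
    (1# - proj₁ δ ≤ Pr[ findsTop? σ k ] (run p alg)) ×
    Surely
    (λ o →
    (fromℕ (Outcome.tosses o)
    ≤ fromℕ C * (fromℕ n / (Δ *⁺ Δ)) * log (fromℕ⁺ k 1≤k /⁺ δ)) ×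
    (Outcome.peakMemory o ℕ.≤ C ℕ.* k))
    (run p alg)
theorem2 ℝ logarithm = 17280 , λ k 1≤k Δ δ δ<½ →
  Algorithm.algorithm ℝ k (Parameters.s₀ ℝ logarithm k 1≤k Δ δ) ,
  λ n k<n p σ ranking gap≈Δ →
    FindingTop.success ℝ logarithm k 1≤k Δ δ δ<½ k<n p σ ranking gap≈Δ ,
    FindingTop.resources ℝ logarithm k 1≤k Δ δ δ<½ k<n p σ ranking gap≈Δ
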